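{- Let $p>3$ be a prime. Then: (a) $$\sum_{k=0}^{p-1}\frac{\binom{4k}{2k}\binom{2k}k}{64^k}H_k^{(2)}\equiv-E_{p^2-p-2}\left(\frac14\right)\pmod{p^2},\qquad \sum_{k=0}^{p-1}\frac{\binom{4k}{2k}\binom{2k}k}{64^k}H_k^{(2)}\equiv-E_{p-3}\left(\frac14\right)\pmod p.$$ (b) $$\sum_{k=0}^{p-1}\frac{\binom{2k}k^2}{16^k}H_k^{(2)}\equiv\frac14\sum_{k=0}^{p-1}\frac{\binom{4k}{2k}\binom{2k}k}{(2k+1)64^k}H_k^{(2)}\equiv\frac15\sum_{k=0}^{p-1}\frac{\binom{6k}{3k}\binom{3k}k}{432^k}H_k^{(2)}\equiv-4E_{p^2-p-2}\pmod{p^2},$$ and $$\sum_{k=0}^{p-1}\frac{\binom{2k}k^2}{16^k}H_k^{(2)}\equiv-4E_{p-3}\pmod p.$$ (c) $$\sum_{k=0}^{p-1}\frac{\binom{2k}k\binom{3k}k}{27^k}H_k^{(2)}\equiv\frac12\sum_{k=0}^{p-1}\frac{\binom{2k}k\binom{3k}k}{(2k+1)27^k}H_k^{(2)}\equiv\frac15\sum_{k=0}^{p-1}\frac{\binom{6k}{3k}\binom{3k}k}{(2k+1)432^k}H_k^{(2)}\equiv(3p-3)B_{p^2-p-1}\left(\frac13\right)\pmod{p^2},$$ and $$\sum_{k=0}^{p-1}\frac{\binom{2k}k\binom{3k}k}{27^k}H_k^{(2)}\equiv-\frac32B_{p-2}\left(\frac13\right)\pmod p.$$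
   Context: For $n\in\mathbb N=\{0,1,2,\ldots\}$, $H_n^{(2)}=\sum_{0<k\le n}\frac1{k^2}$ is the second-order harmonic number. $B_0,B_1,\ldots$ are the Bernoulli numbers (with $B_1=-\frac12$) and $B_n(x)=\sum_{k=0}^n\binom nkB_kx^{n-k}$ is the Bernoulli polynomial of degree $n$. $E_0,E_1,\ldots$ are the Euler numbers and $E_n(x)=\sum_{k=0}^n\binom nk\frac{E_k}{2^k}\left(x-\frac12\right)^{n-k}$ is the Euler polynomial of degree $n$; $E_n$ without argument is the Euler number. Congruences modulo $p^j$ are in the ring $\mathbb Z_p$ of $p$-adic integers (equivalently, among rationals with denominator prime to $p$). -}

module Defs where

open import Data.Nat.Base as ℕ using (ℕ; zero; suc; NonZero; s≤s; ⌊_/2⌋)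
open import Data.Nat.Combinatorics using (_C_)
open import Data.Nat.Divisibility using (_∤_)
open import Data.Nat.Induction using (<-rec)
open import Data.Nat.Properties using (m∸n≤m; m^n≢0; m*n≢0)
open import Data.Integer.Base as ℤ using (ℤ; +_; 1ℤ)
import Data.Integer.Properties as ℤₚ
open import Data.Rational.Base using (ℚ; 1ℚ; ½; _/_; ↧ₙ_; -_; _-_; _*_)
open import Data.Rational.Properties using (+-0-commutativeMonoid; +-*-commutativeRing)
open import Data.Fin.Base using (toℕ)
open import Data.Fin.Properties using (toℕ<n)
open import Function.Base using (it)
open import Data.Product.Base using (_×_; ∃)
open import Relation.Binary.PropositionalEquality.Core using (_≡_)
open import Algebra.Bundles using (CommutativeRing)

open import Algebra.Properties.CommutativeMonoid.Sum +-0-commutativeMonoid using (sum)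
open import Algebra.Properties.CommutativeMonoid.Sum ℤₚ.+-0-commutativeMonoid using () renaming (sum to sumℤ)
open import Algebra.Properties.Semiring.Exp (CommutativeRing.semiring +-*-commutativeRing) using (_^_)

infixl 7 _÷_^_ _÷_·_^_

_÷_^_ : ℤ → (d : ℕ) .{{_ : NonZero d}} → ℕ → ℚ
a ÷ d ^ k = (a / (d ℕ.^ k)) {{m^n≢0 d k}}

_÷_·_^_ : ℤ → (e : ℕ) .{{_ : NonZero e}} (d : ℕ) .{{_ : NonZero d}} → ℕ → ℚ
a ÷ e · d ^ k = (a / (e ℕ.* d ℕ.^ k)) {{m*n≢0 e (d ℕ.^ k) {{it}} {{m^n≢0 d k}}}}

fromℤ : ℤ → ℚ
fromℤ i = i / 1

fromℕ : ℕ → ℚ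
fromℕ n = fromℤ (+ n)

infix 5 sumBelow sumUpTo

sumBelow : ℕ → (ℕ → ℚ) → ℚ
sumBelow n f = sum {n} (λ i → f (toℕ i))

sumUpTo : ℕ → (ℕ → ℚ) → ℚ
sumUpTo n = sumBelow (suc n)

syntax sumBelow n (λ k → x) = ∑[ k < n ] x
syntax sumUpTo  n (λ k → x) = ∑[ k ≤ n ] x

-- The summation index is shifted: k ranges over 0, …, n − 1.
H⁽²⁾ : ℕ → ℚ
H⁽²⁾ n = ∑[ k < n ] 1ℤ / (suc k ℕ.* suc k)

-- B₀ = 1, and ∑_{k ≤ n} C(n+1,k) Bₖ = 0 for n ≥ 1, solved for Bₙ.
-- In particular B₁ = −1/2.
bernoulliStep : ∀ n → (∀ {k} → k ℕ.< n → ℚ) → ℚ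
bernoulliStep zero      B = 1ℚ
bernoulliStep n@(suc _) B =
  - ((1ℤ / suc n) * sum {n} (λ i → fromℕ (suc n C toℕ i) * B (toℕ<n i)))

bernoulli : ℕ → ℚ
bernoulli = <-rec (λ _ → ℚ) bernoulliStep

-- E₀ = 1, and ∑_{0 ≤ 2j ≤ n} C(n,2j) Eₙ₋₂ⱼ = 0 for n ≥ 1, solved for Eₙ
-- (equivalently ∑ Eₙ tⁿ/n! = 1 / cosh t).  The index j − 1 ranges over Fin ⌊ n /2⌋.
eulerStep : ∀ n → (∀ {k} → k ℕ.< n → ℤ) → ℤ
eulerStep zero        E = 1ℤ
eulerStep n@(suc n-1) E =
  ℤ.- sumℤ {⌊ n /2⌋} (λ i → let 2j = 2 ℕ.* suc (toℕ i) in
        + (n C 2j) ℤ.* E {n ℕ.∸ 2j} (s≤s (m∸n≤m n-1 (ℕ.pred 2j))))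

euler : ℕ → ℤ
euler = <-rec (λ _ → ℤ) eulerStep

bernoulliPoly : ℕ → ℚ → ℚ
bernoulliPoly n x = ∑[ k ≤ n ] fromℕ (n C k) * bernoulli k * x ^ (n ℕ.∸ k)

eulerPoly : ℕ → ℚ → ℚ
eulerPoly n x = ∑[ k ≤ n ] fromℕ (n C k) * (euler k ÷ 2 ^ k) * (x - ½) ^ (n ℕ.∸ k)

-- For p prime, membership of a rational in the ring ℤ₍ₚ₎ = ℚ ∩ ℤₚ; the
-- denominator is the one in lowest terms.
IsIntegralAt : ℕ → ℚ → Set
IsIntegralAt p x = p ∤ ↧ₙ x

-- Congruence in ℤ₍ₚ₎: both sides are required to lie in that ring.
infix 4 _≡_[mod_^_]
_≡_[mod_^_] : ℚ → ℚ → ℕ → ℕ → Set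
a ≡ b [mod p ^ j ] =
  IsIntegralAt p a × IsIntegralAt p b ×
  ∃ λ c → IsIntegralAt p c × a - b ≡ fromℕ (p ℕ.^ j) * c

{-# OPTIONS --safe #-}

-- With tₖ(x) = (−1)ᵏ C(x,k) C(x+k,k), the summands are tₖ(x) Hₖ⁽²⁾ at x = −1/2, −1/3, −1/4, −1/6, possibly
-- divided by 2k + 1.  Let S(x) = ∑_{k<p} tₖ(x) Hₖ⁽²⁾ and U(x) = (2x+1) ∑_{k<p} tₖ(x) Hₖ⁽²⁾/(2k+1).  Telescoping gives
--   x² (S(x) + S(x−1)) = 2 w(x) (1 + x² Hₚ₋₁⁽²⁾) − 2,   U(x) − U(x−1) = S(x) + S(x−1),
-- where w(x) = ∏_{0<j<p} (1 − x²/j²) vanishes modulo p² at integers x prime to p.  For n = φ(pʲ) − 2, S(x) and −Eₙ(−x) satisfy the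
-- same recurrence f(x) + f(x−1) ≡ −2xⁿ ≡ −2/x² there, and both are invariant under x ↦ −1 − x.  Their difference D
-- therefore vanishes at 0, p − 1 and −p, which kills the linear term of D at 0 modulo p; hence D ≡ 0 at the multiples
-- of p, then at all integers, and by density on ℤ₍ₚ₎.  The values of U follow from those of S by the relations
-- 4 S(2x) ≡ U(x) − U(x − 1/2) and 4 U(2x+1) ≡ U(x) + U(x + 1/2), which hold because both sides have the same
-- differences.  The special values of Euler and Bernoulli polynomials are compared by umbral calculus: a sequence a is
-- determined by T a ± a, where T translates the associated Appell polynomials by 1.

module Submission where

open import Defs
open import Data.Nat.Base as ℕ using (ℕ; zero; suc; _∸_; NonZero; z≤n; s≤s; ⌊_/2⌋; _!)
open import Data.Nat.Combinatorics
  using (_C_; nCn≡1; nC1≡n; nCk≡nC[n∸k]; nCk+nC[k+1]≡[n+1]C[k+1]; k>n⇒nCk≡0; k![n∸k]!∣n!; nCk≡n!/k![n-k]!)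
import Data.Nat.Coprimality as Coprime
open import Data.Nat.Divisibility as ∣ using (_∣_; _∤_; divides)
open import Data.Nat.DivMod using (_%_; m≡m%n+[m/n]*n; m%n<n; m/n*n≡m)
open import Data.Nat.Induction using (<-rec; <-wellFounded)
open import Data.Nat.Primality using (Prime; prime?; euclidsLemma; prime⇒irreducible; prime⇒nonZero; prime⇒nonTrivial)
import Data.Nat.Properties as ℕₚ
open import Data.Nat.Properties using (_!≢0; _!*_!≢0)
open import Data.Nat.Tactic.RingSolver renaming (solve-∀ to ℕ-solve-∀)
open import Data.Integer.Base as ℤ using (ℤ; +_; 1ℤ)
import Data.Integer.Properties as ℤₚ
open import Data.Rational.Base using (ℚ; mkℚ; 0ℚ; 1ℚ; ½; _/_; ↥_; ↧_; ↧ₙ_; -_; _+_; _-_; _*_; toℚᵘ)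
import Data.Rational.Properties as ℚₚ
import Data.Rational.Unnormalised.Base as ℚᵘ
import Data.Rational.Unnormalised.Properties as ℚᵘₚ
open import Data.Fin.Base using (toℕ)
open import Data.Fin.Properties using (toℕ<n)
open import Data.Product.Base using (_×_; _,_; proj₁; proj₂; ∃)
open import Data.Sum.Base using ([_,_]′)
open import Function.Base using (_∘_; it)
open import Induction.WellFounded using (module FixPoint)
open import Relation.Nullary.Decidable using (dec⇒maybe; toSum; toWitness; toWitnessFalse)
open import Relation.Nullary.Negation using (contradiction)
open import Relation.Binary.PropositionalEquality
open import Algebra.Bundles using (CommutativeRing)
open import Algebra.Properties.CommutativeMonoid.Sum ℤₚ.+-0-commutativeMonoid using ()
  renaming (sum to sumℤ; sum-cong-≗ to ℤ-sum-cong-≗)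
open import Algebra.Properties.Semiring.Exp (CommutativeRing.semiring ℚₚ.+-*-commutativeRing) using (_^_; ^-assocʳ)
open import Algebra.Properties.Semiring.Sum (CommutativeRing.semiring ℚₚ.+-*-commutativeRing)
  using (sum-cong-≗; ∑-distrib-+; *-distribˡ-sum)
open import Tactic.RingSolver using (solve-∀)
open import Tactic.RingSolver.Core.AlmostCommutativeRing using (AlmostCommutativeRing; fromCommutativeRing)

open ≡-Reasoning

-- Telescoping gives information only at integers prime to p, whereas the points -1/2, -1/3, -1/4,
-- -1/6 are fractions. Hence the functions are treated as polynomials over ℤ₍ₚ₎, whose values follow
-- congruences of the argument. U resists this, because 2k + 1 = p for one k < p: only p·U has
-- integral coefficients, and arguments must agree modulo p³ to control U modulo p². Integrality of
-- the special values of U is therefore not shown in advance but read off from the congruences that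
-- link them to S. The four points are related by doubling and by x ↦ -1 - x, under which S is even
-- and U is odd. This produces the small constants of the theorem: doubling -1/4 gives the 1/4 of
-- (b), while -1/3 and -2/3 give two linear relations between S(-1/3), U(-1/3) and U(-1/6). The 1/5
-- of (c) comes from 5 U(-1/3) ≡ U(-1/6), and the 1/5 of (b) from 2 Eₙ(1/6) ≡ (3² + 1) Eₙ(1/2).

ℚ-ring : AlmostCommutativeRing _ _
ℚ-ring = fromCommutativeRing ℚₚ.+-*-commutativeRing (λ x → dec⇒maybe (0ℚ ℚₚ.≟ x))

-- Rationals and integers

fromℤ-mkℚ : ∀ i → toℚᵘ (fromℤ i) ℚᵘ.≃ ℚᵘ.mkℚᵘ i 0
fromℤ-mkℚ i = ℚₚ.toℚᵘ-fromℚᵘ (ℚᵘ.mkℚᵘ i 0)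

fromℤ-+ : ∀ i j → fromℤ (i ℤ.+ j) ≡ fromℤ i + fromℤ j
fromℤ-+ i j = ℚₚ.toℚᵘ-injective (ℚᵘₚ.≃-trans (fromℤ-mkℚ (i ℤ.+ j)) (ℚᵘₚ.≃-sym (ℚᵘₚ.≃-trans
  (ℚₚ.toℚᵘ-homo-+ (fromℤ i) (fromℤ j))
  (ℚᵘₚ.≃-trans (ℚᵘₚ.+-cong (fromℤ-mkℚ i) (fromℤ-mkℚ j))
    (ℚᵘ.*≡* (cong (ℤ._* 1ℤ) (cong₂ ℤ._+_ (ℤₚ.*-identityʳ i) (ℤₚ.*-identityʳ j))))))))

fromℤ-* : ∀ i j → fromℤ (i ℤ.* j) ≡ fromℤ i * fromℤ j
fromℤ-* i j = ℚₚ.toℚᵘ-injective (ℚᵘₚ.≃-trans (fromℤ-mkℚ (i ℤ.* j)) (ℚᵘₚ.≃-sym (ℚᵘₚ.≃-trans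
  (ℚₚ.toℚᵘ-homo-* (fromℤ i) (fromℤ j))
  (ℚᵘₚ.≃-trans (ℚᵘₚ.*-cong (fromℤ-mkℚ i) (fromℤ-mkℚ j)) (ℚᵘ.*≡* refl)))))

fromℤ-neg : ∀ i → fromℤ (ℤ.- i) ≡ - fromℤ i
fromℤ-neg i = ℚₚ.toℚᵘ-injective (ℚᵘₚ.≃-trans (fromℤ-mkℚ (ℤ.- i)) (ℚᵘₚ.≃-sym (ℚᵘₚ.≃-trans
  (ℚₚ.toℚᵘ-homo‿- (fromℤ i))
  (ℚᵘₚ.≃-trans (ℚᵘₚ.-‿cong (fromℤ-mkℚ i)) (ℚᵘ.*≡* refl)))))

fromℤ-injective : ∀ {i j} → fromℤ i ≡ fromℤ j → i ≡ j
fromℤ-injective {i} {j} eq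
  with ℚᵘ.*≡* e ← ℚᵘₚ.≃-trans (ℚᵘₚ.≃-sym (fromℤ-mkℚ i))
                    (ℚᵘₚ.≃-trans (ℚᵘₚ.≃-reflexive (cong toℚᵘ eq)) (fromℤ-mkℚ j))
  = trans (sym (ℤₚ.*-identityʳ i)) (trans e (ℤₚ.*-identityʳ j))

/-*-cancel : ∀ i n .{{_ : NonZero n}} → (i / n) * fromℕ n ≡ fromℤ i
/-*-cancel i n@(suc m) = ℚₚ.toℚᵘ-injective (ℚᵘₚ.≃-trans (ℚₚ.toℚᵘ-homo-* (i / n) (fromℕ n))
  (ℚᵘₚ.≃-trans (ℚᵘₚ.*-cong (ℚₚ.toℚᵘ-fromℚᵘ (ℚᵘ.mkℚᵘ i m)) (fromℤ-mkℚ (+ n)))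
  (ℚᵘₚ.≃-trans (ℚᵘ.*≡* lem) (ℚᵘₚ.≃-sym (fromℤ-mkℚ i)))))
  where
  lem : (i ℤ.* + n) ℤ.* 1ℤ ≡ i ℤ.* (+ (n ℕ.* 1))
  lem = trans (ℤₚ.*-identityʳ _) (cong (λ k → i ℤ.* + k) (sym (ℕₚ.*-identityʳ n)))

fromℕ-+ : ∀ m n → fromℕ (m ℕ.+ n) ≡ fromℕ m + fromℕ n
fromℕ-+ m n = fromℤ-+ (+ m) (+ n)

fromℕ-suc : ∀ n → fromℕ (suc n) ≡ fromℕ n + 1ℚ
fromℕ-suc n = trans (fromℕ-+ 1 n) (ℚₚ.+-comm 1ℚ (fromℕ n))

fromℕ-* : ∀ m n → fromℕ (m ℕ.* n) ≡ fromℕ m * fromℕ n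
fromℕ-* m n = trans (cong fromℤ (ℤₚ.pos-* m n)) (fromℤ-* (+ m) (+ n))

fromℕ-^ : ∀ m n → fromℕ (m ℕ.^ n) ≡ fromℕ m ^ n
fromℕ-^ m zero    = refl
fromℕ-^ m (suc n) = trans (fromℕ-* m (m ℕ.^ n)) (cong (fromℕ m *_) (fromℕ-^ m n))

*-cancelʳ-fromℕ : ∀ n .{{_ : NonZero n}} {x y} → x * fromℕ n ≡ y * fromℕ n → x ≡ y
*-cancelʳ-fromℕ n {x} {y} eq = trans (lem x) (trans (cong (_* (1ℤ / n)) eq) (sym (lem y)))
  where
  lem : ∀ z → z ≡ z * fromℕ n * (1ℤ / n)
  lem z = begin
    z                         ≡⟨ ℚₚ.*-identityʳ z ⟨
    z * 1ℚ                    ≡⟨ cong (z *_) (/-*-cancel 1ℤ n) ⟨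
    z * ((1ℤ / n) * fromℕ n)  ≡⟨ r z (1ℤ / n) (fromℕ n) ⟩
    z * fromℕ n * (1ℤ / n)    ∎
    where
    r : ∀ a b c → a * (b * c) ≡ a * c * b
    r = solve-∀ ℚ-ring

^-distrib-* : ∀ x y n → (x * y) ^ n ≡ x ^ n * y ^ n
^-distrib-* x y zero    = refl
^-distrib-* x y (suc n) = trans (cong (x * y *_) (^-distrib-* x y n)) (r x y (x ^ n) (y ^ n))
  where
  r : ∀ a b c d → a * b * (c * d) ≡ (a * c) * (b * d)
  r = solve-∀ ℚ-ring

1^n≡1 : ∀ n → 1ℚ ^ n ≡ 1ℚ
1^n≡1 zero    = refl
1^n≡1 (suc n) = trans (ℚₚ.*-identityˡ _) (1^n≡1 n)

-- Finite sums

sumBelow-suc : ∀ n f → sumBelow (suc n) f ≡ sumBelow n f + f n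
sumBelow-suc zero    f = ℚₚ.+-comm (f 0) 0ℚ
sumBelow-suc (suc n) f =
  trans (cong (_+_ (f 0)) (sumBelow-suc n (f ∘ suc))) (sym (ℚₚ.+-assoc (f 0) (sumBelow n (f ∘ suc)) (f (suc n))))

sumBelow-cong : ∀ n {f g} → (∀ k → k ℕ.< n → f k ≡ g k) → sumBelow n f ≡ sumBelow n g
sumBelow-cong n f≗g = sum-cong-≗ {n} (λ i → f≗g (toℕ i) (toℕ<n i))

sumBelow-+ : ∀ n f g → sumBelow n (λ k → f k + g k) ≡ sumBelow n f + sumBelow n g
sumBelow-+ n f g = ∑-distrib-+ {n} (f ∘ toℕ) (g ∘ toℕ)

sumBelow-* : ∀ n x f → sumBelow n (λ k → x * f k) ≡ x * sumBelow n f
sumBelow-* n x f = sym (*-distribˡ-sum {n} x (f ∘ toℕ))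

-- The local ring ℤ₍ₚ₎

module Local (p : ℕ) (p-prime : Prime p) where

  instance
    p≢0 : NonZero p
    p≢0 = prime⇒nonZero p-prime

  ∤-* : ∀ m n → p ∤ m → p ∤ n → p ∤ m ℕ.* n
  ∤-* m n p∤m p∤n = [ p∤m , p∤n ]′ ∘ euclidsLemma m n p-prime

  -- The denominator need not be in lowest terms, so closure under sums and products only multiplies
  -- denominators. Reduction is dealt with once, in `Integral⇒IsIntegralAt`.
  record Integral (x : ℚ) : Set where
    constructor integral
    field
      {den}  : ℕ
      {num}  : ℤ
      p∤den  : p ∤ den
      x*den≡ : x * fromℕ den ≡ fromℤ num

  p∤1 : p ∤ 1
  p∤1 p∣1 = ℕ.nonTrivial⇒≢1 {{prime⇒nonTrivial p-prime}} (∣.∣1⇒≡1 p∣1)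

  fromℤ-integral : ∀ i → Integral (fromℤ i)
  fromℤ-integral i = integral {den = 1} {i} p∤1 (ℚₚ.*-identityʳ (fromℤ i))

  fromℕ-integral : ∀ n → Integral (fromℕ n)
  fromℕ-integral n = fromℤ-integral (+ n)

  /-integral : ∀ i n .{{_ : NonZero n}} → p ∤ n → Integral (i / n)
  /-integral i n p∤n = integral {num = i} p∤n (/-*-cancel i n)

  +-integral : ∀ {x y} → Integral x → Integral y → Integral (x + y)
  +-integral {x} {y} (integral {d} {i} p∤d x≡) (integral {e} {j} p∤e y≡) =
    integral {num = i ℤ.* + e ℤ.+ j ℤ.* + d} (∤-* d e p∤d p∤e) (begin
      (x + y) * fromℕ (d ℕ.* e)                          ≡⟨ cong ((x + y) *_) (fromℕ-* d e) ⟩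
      (x + y) * (fromℕ d * fromℕ e)                      ≡⟨ r x y (fromℕ d) (fromℕ e) ⟩
      x * fromℕ d * fromℕ e + y * fromℕ e * fromℕ d      ≡⟨ cong₂ (λ u v → u * fromℕ e + v * fromℕ d) x≡ y≡ ⟩
      fromℤ i * fromℕ e + fromℤ j * fromℕ d              ≡⟨ cong₂ _+_ (fromℤ-* i (+ e)) (fromℤ-* j (+ d)) ⟨
      fromℤ (i ℤ.* + e) + fromℤ (j ℤ.* + d)              ≡⟨ fromℤ-+ (i ℤ.* + e) (j ℤ.* + d) ⟨
      fromℤ (i ℤ.* + e ℤ.+ j ℤ.* + d)                    ∎)
    where
    r : ∀ x y d e → (x + y) * (d * e) ≡ x * d * e + y * e * d
    r = solve-∀ ℚ-ring

  *-integral : ∀ {x y} → Integral x → Integral y → Integral (x * y)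
  *-integral {x} {y} (integral {d} {i} p∤d x≡) (integral {e} {j} p∤e y≡) =
    integral {num = i ℤ.* j} (∤-* d e p∤d p∤e) (begin
      x * y * fromℕ (d ℕ.* e)            ≡⟨ cong (x * y *_) (fromℕ-* d e) ⟩
      x * y * (fromℕ d * fromℕ e)        ≡⟨ r x y (fromℕ d) (fromℕ e) ⟩
      x * fromℕ d * (y * fromℕ e)        ≡⟨ cong₂ _*_ x≡ y≡ ⟩
      fromℤ i * fromℤ j                  ≡⟨ fromℤ-* i j ⟨
      fromℤ (i ℤ.* j)                    ∎)
    where
    r : ∀ x y d e → x * y * (d * e) ≡ x * d * (y * e)
    r = solve-∀ ℚ-ring

  neg-integral : ∀ {x} → Integral x → Integral (- x)
  neg-integral {x} (integral {d} {i} p∤d x≡) = integral {num = ℤ.- i} p∤d (begin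
    - x * fromℕ d      ≡⟨ ℚₚ.neg-distribˡ-* x (fromℕ d) ⟨
    - (x * fromℕ d)    ≡⟨ cong (-_) x≡ ⟩
    - fromℤ i          ≡⟨ fromℤ-neg i ⟨
    fromℤ (ℤ.- i)      ∎)

  minus-integral : ∀ {x y} → Integral x → Integral y → Integral (x - y)
  minus-integral Ix Iy = +-integral Ix (neg-integral Iy)

  ^-integral : ∀ {x} n → Integral x → Integral (x ^ n)
  ^-integral zero    Ix = fromℕ-integral 1
  ^-integral (suc n) Ix = *-integral Ix (^-integral n Ix)

  sum-integral : ∀ n {f} → (∀ k → k ℕ.< n → Integral (f k)) → Integral (sumBelow n f)
  sum-integral zero    If = fromℕ-integral 0
  sum-integral (suc n) If =
    +-integral (If 0 (s≤s z≤n)) (sum-integral n (λ k k<n → If (suc k) (s≤s k<n)))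

  -- Cross-multiplying gives ↥x · d = i · ↧x; as ↧x is coprime to ↥x it divides d, so p cannot
  -- divide it.
  Integral⇒IsIntegralAt : ∀ {x} → Integral x → IsIntegralAt p x
  Integral⇒IsIntegralAt {x} (integral {d} {i} p∤d x≡) p∣↧x = p∤d (∣.∣-trans p∣↧x ↧x∣d)
    where
    e : ↥ x ℤ.* + d ≡ i ℤ.* ↧ x
    e = fromℤ-injective (begin
      fromℤ (↥ x ℤ.* + d)                ≡⟨ fromℤ-* (↥ x) (+ d) ⟩
      fromℤ (↥ x) * fromℕ d              ≡⟨ cong (_* fromℕ d) (/-*-cancel (↥ x) (↧ₙ x)) ⟨
      (↥ x / ↧ₙ x) * fromℕ (↧ₙ x) * fromℕ d  ≡⟨ cong (λ z → z * fromℕ (↧ₙ x) * fromℕ d) (ℚₚ.↥p/↧p≡p x) ⟩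
      x * fromℕ (↧ₙ x) * fromℕ d         ≡⟨ r x (fromℕ (↧ₙ x)) (fromℕ d) ⟩
      x * fromℕ d * fromℕ (↧ₙ x)         ≡⟨ cong (_* fromℕ (↧ₙ x)) x≡ ⟩
      fromℤ i * fromℕ (↧ₙ x)             ≡⟨ fromℤ-* i (↧ x) ⟨
      fromℤ (i ℤ.* ↧ x)                  ∎)
      where
      r : ∀ a b c → a * b * c ≡ a * c * b
      r = solve-∀ ℚ-ring
    ↧x∣d : ↧ₙ x ∣ d
    ↧x∣d = Coprime.coprime-divisor (Coprime.sym (Coprime.recompute (coprime x)))
      (divides ℤ.∣ i ∣ (trans (sym (ℤₚ.abs-* (↥ x) (+ d))) (trans (cong ℤ.∣_∣ e) (ℤₚ.abs-* i (↧ x)))))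
      where
      coprime : ∀ y → Coprime.Coprime ℤ.∣ ↥ y ∣ (↧ₙ y)
      coprime (mkℚ _ _ c) = Coprime.recompute c

  -- Divisibility by powers of p and congruences

  infix 4 _∣ᵖ_ _≈_mod_

  -- x ∈ pʲ ℤ₍ₚ₎
  record _∣ᵖ_ (j : ℕ) (x : ℚ) : Set where
    constructor divisible
    field
      {quot}   : ℚ
      quot-int : Integral quot
      x≡       : x ≡ fromℕ (p ℕ.^ j) * quot

  -- Only the difference is constrained, so congruences can be stated for values of U before these
  -- are known to be integral.
  record _≈_mod_ (x y : ℚ) (j : ℕ) : Set where
    constructor diff
    field ∣-diff : j ∣ᵖ (x - y)
  open _≈_mod_ public

  ∣ᵖ-+ : ∀ {j x y} → j ∣ᵖ x → j ∣ᵖ y → j ∣ᵖ (x + y)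
  ∣ᵖ-+ {j} (divisible {a} Ia x≡) (divisible {b} Ib y≡) =
    divisible (+-integral Ia Ib) (trans (cong₂ _+_ x≡ y≡) (sym (ℚₚ.*-distribˡ-+ (fromℕ (p ℕ.^ j)) a b)))

  ∣ᵖ-*ˡ : ∀ {j x y} → Integral x → j ∣ᵖ y → j ∣ᵖ (x * y)
  ∣ᵖ-*ˡ {j} {x} Ix (divisible {b} Ib y≡) =
    divisible (*-integral Ix Ib) (trans (cong (x *_) y≡) (r x (fromℕ (p ℕ.^ j)) b))
    where
    r : ∀ a b c → a * (b * c) ≡ b * (a * c)
    r = solve-∀ ℚ-ring

  ∣ᵖ-*ʳ : ∀ {j x y} → j ∣ᵖ x → Integral y → j ∣ᵖ (x * y)
  ∣ᵖ-*ʳ {j} {x} {y} dx Iy = subst (j ∣ᵖ_) (ℚₚ.*-comm y x) (∣ᵖ-*ˡ Iy dx)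

  ∣ᵖ-* : ∀ {i j x y} → i ∣ᵖ x → j ∣ᵖ y → (i ℕ.+ j) ∣ᵖ (x * y)
  ∣ᵖ-* {i} {j} (divisible {a} Ia x≡) (divisible {b} Ib y≡) =
    divisible (*-integral Ia Ib) (begin
      _                                                ≡⟨ cong₂ _*_ x≡ y≡ ⟩
      fromℕ (p ℕ.^ i) * a * (fromℕ (p ℕ.^ j) * b)      ≡⟨ r (fromℕ (p ℕ.^ i)) a (fromℕ (p ℕ.^ j)) b ⟩
      fromℕ (p ℕ.^ i) * fromℕ (p ℕ.^ j) * (a * b)      ≡⟨ cong (_* (a * b)) (fromℕ-* (p ℕ.^ i) (p ℕ.^ j)) ⟨
      fromℕ (p ℕ.^ i ℕ.* p ℕ.^ j) * (a * b)            ≡⟨ cong (λ m → fromℕ m * (a * b)) (ℕₚ.^-distribˡ-+-* p i j) ⟨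
      fromℕ (p ℕ.^ (i ℕ.+ j)) * (a * b)                ∎)
    where
    r : ∀ x a y b → x * a * (y * b) ≡ x * y * (a * b)
    r = solve-∀ ℚ-ring

  ∣ᵖ-neg : ∀ {j x} → j ∣ᵖ x → j ∣ᵖ (- x)
  ∣ᵖ-neg {j} {x} dx = subst (j ∣ᵖ_) (r x) (∣ᵖ-*ˡ (fromℤ-integral (ℤ.- 1ℤ)) dx)
    where
    r : ∀ y → - 1ℚ * y ≡ - y
    r = solve-∀ ℚ-ring

  ∣ᵖ-0 : ∀ {j} → j ∣ᵖ 0ℚ
  ∣ᵖ-0 {j} = divisible (fromℕ-integral 0) (sym (ℚₚ.*-zeroʳ (fromℕ (p ℕ.^ j))))

  ∣ᵖ⇒Integral : ∀ {j x} → j ∣ᵖ x → Integral x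
  ∣ᵖ⇒Integral {j} (divisible Ia x≡) = subst Integral (sym x≡) (*-integral (fromℕ-integral (p ℕ.^ j)) Ia)

  ∣ᵖ-weaken : ∀ {i j x} → i ℕ.≤ j → j ∣ᵖ x → i ∣ᵖ x
  ∣ᵖ-weaken {i} {j} {x} i≤j (divisible {a} Ia x≡) =
    divisible (*-integral (fromℕ-integral (p ℕ.^ (j ∸ i))) Ia) (begin
      x                                                ≡⟨ x≡ ⟩
      fromℕ (p ℕ.^ j) * a                              ≡⟨ cong (λ k → fromℕ (p ℕ.^ k) * a) (ℕₚ.m+[n∸m]≡n i≤j) ⟨
      fromℕ (p ℕ.^ (i ℕ.+ (j ∸ i))) * a                ≡⟨ cong (λ m → fromℕ m * a) (ℕₚ.^-distribˡ-+-* p i (j ∸ i)) ⟩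
      fromℕ (p ℕ.^ i ℕ.* p ℕ.^ (j ∸ i)) * a            ≡⟨ cong (_* a) (fromℕ-* (p ℕ.^ i) (p ℕ.^ (j ∸ i))) ⟩
      fromℕ (p ℕ.^ i) * fromℕ (p ℕ.^ (j ∸ i)) * a      ≡⟨ ℚₚ.*-assoc (fromℕ (p ℕ.^ i)) _ a ⟩
      fromℕ (p ℕ.^ i) * (fromℕ (p ℕ.^ (j ∸ i)) * a)    ∎)

  p∣ᵖ : 1 ∣ᵖ fromℕ p
  p∣ᵖ = divisible (fromℕ-integral 1) (trans (sym (ℚₚ.*-identityʳ (fromℕ p))) (cong (λ m → fromℕ m * 1ℚ) (sym (ℕₚ.*-identityʳ p))))

  ≈-refl : ∀ {j x} → x ≈ x mod j
  ≈-refl {j} {x} = diff (subst (j ∣ᵖ_) (sym (ℚₚ.+-inverseʳ x)) ∣ᵖ-0)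

  ≈-reflexive : ∀ {j x y} → x ≡ y → x ≈ y mod j
  ≈-reflexive refl = ≈-refl

  ≈-sym : ∀ {j x y} → x ≈ y mod j → y ≈ x mod j
  ≈-sym {j} {x} {y} (diff h) = diff (subst (j ∣ᵖ_) (r x y) (∣ᵖ-neg h))
    where
    r : ∀ x y → - (x - y) ≡ y - x
    r = solve-∀ ℚ-ring

  ≈-trans : ∀ {j x y z} → x ≈ y mod j → y ≈ z mod j → x ≈ z mod j
  ≈-trans {j} {x} {y} {z} (diff h) (diff k) = diff (subst (j ∣ᵖ_) (r x y z) (∣ᵖ-+ h k))
    where
    r : ∀ x y z → (x - y) + (y - z) ≡ x - z
    r = solve-∀ ℚ-ring

  ≈-+ : ∀ {j x y u v} → x ≈ y mod j → u ≈ v mod j → x + u ≈ y + v mod j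
  ≈-+ {j} {x} {y} {u} {v} (diff h) (diff k) = diff (subst (j ∣ᵖ_) (r x y u v) (∣ᵖ-+ h k))
    where
    r : ∀ x y u v → (x - y) + (u - v) ≡ (x + u) - (y + v)
    r = solve-∀ ℚ-ring

  ≈-neg : ∀ {j x y} → x ≈ y mod j → - x ≈ - y mod j
  ≈-neg {j} {x} {y} (diff h) = diff (subst (j ∣ᵖ_) (r x y) (∣ᵖ-neg h))
    where
    r : ∀ x y → - (x - y) ≡ - x - - y
    r = solve-∀ ℚ-ring

  ≈-*ˡ : ∀ {j x y} a → Integral a → x ≈ y mod j → a * x ≈ a * y mod j
  ≈-*ˡ {j} {x} {y} a Ia (diff h) = diff (subst (j ∣ᵖ_) (r a x y) (∣ᵖ-*ˡ Ia h))
    where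
    r : ∀ a x y → a * (x - y) ≡ a * x - a * y
    r = solve-∀ ℚ-ring

  ≈-* : ∀ {j x y u v} → Integral u → Integral y → x ≈ y mod j → u ≈ v mod j → x * u ≈ y * v mod j
  ≈-* {j} {x} {y} {u} {v} Iu Iy (diff h) (diff k) =
    diff (subst (j ∣ᵖ_) (r x y u v) (∣ᵖ-+ (∣ᵖ-*ʳ h Iu) (∣ᵖ-*ˡ Iy k)))
    where
    r : ∀ x y u v → (x - y) * u + y * (u - v) ≡ x * u - y * v
    r = solve-∀ ℚ-ring

  ≈0⇒∣ᵖ : ∀ {j x} → x ≈ 0ℚ mod j → j ∣ᵖ x
  ≈0⇒∣ᵖ {j} {x} (diff h) = subst (j ∣ᵖ_) (ℚₚ.+-identityʳ x) h

  ∣ᵖ⇒≈0 : ∀ {j x} → j ∣ᵖ x → x ≈ 0ℚ mod j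
  ∣ᵖ⇒≈0 {j} {x} h = diff (subst (j ∣ᵖ_) (sym (ℚₚ.+-identityʳ x)) h)

  -- This is how sums with denominators 2k + 1, the quotients by 5, and the multiples of Bernoulli
  -- values acquire their integrality in the theorem.
  ≈-integral : ∀ {j x y} → Integral y → x ≈ y mod j → Integral x
  ≈-integral {j} {x} {y} Iy (diff h) = subst Integral (r x y) (+-integral (∣ᵖ⇒Integral h) Iy)
    where
    r : ∀ x y → (x - y) + y ≡ x
    r = solve-∀ ℚ-ring

  ≈⇒≡mod : ∀ {j x y} → Integral y → x ≈ y mod j → x ≡ y [mod p ^ j ]
  ≈⇒≡mod Iy x≈y@(diff (divisible {c} Ic eq)) =
    Integral⇒IsIntegralAt (≈-integral Iy x≈y) , Integral⇒IsIntegralAt Iy , c , Integral⇒IsIntegralAt Ic , eq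

-- Umbral calculus of sequences

Seq : Set
Seq = ℕ → ℚ

-- (a + y)ⁿ with aᵏ read as a k.
translate : ℚ → Seq → Seq
translate y a zero    = a 0
translate y a (suc n) = y * translate y a n + translate y (a ∘ suc) n

-- Reading a as the exponential generating function A(t) = ∑ aₙ tⁿ/n!, `translate y` multiplies A(t)
-- by e^(yt), `dilate c` replaces t by ct, and `powers x` is e^(xt), so that `powers 0ℚ` is the
-- constant 1. The identities below are identities of such series.
dilate : ℚ → Seq → Seq
dilate c a n = c ^ n * a n

_⊞_ : Seq → Seq → Seq
(a ⊞ b) n = a n + b n

_⊡_ : ℚ → Seq → Seq
(c ⊡ a) n = c * a n

infixl 6 _⊞_
infixr 7 _⊡_

-- Pascal's rule splits the sum for n + 1: the part with C(n,k) is the sum for the shifted sequence,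
-- and the part with C(n,k+1), together with the term k = 0, is y times the sum for n.
appell-sum : ∀ a y n → (∑[ k ≤ n ] fromℕ (n C k) * a k * y ^ (n ∸ k)) ≡ translate y a n
appell-sum a y zero = r (a 0)
  where
  r : ∀ x → 1ℚ * x * 1ℚ + 0ℚ ≡ x
  r = solve-∀ ℚ-ring
appell-sum a y (suc n) = begin
  (∑[ k ≤ suc n ] c (suc n) k * y ^ (suc n ∸ k))
    ≡⟨⟩
  c (suc n) 0 * y ^ suc n + (∑[ k ≤ n ] c (suc n) (suc k) * y ^ (n ∸ k))
    ≡⟨ cong (_+_ (c (suc n) 0 * y ^ suc n)) (trans
         (sumBelow-cong (suc n) (λ k k<n → pascal k))
         (sumBelow-+ (suc n) (λ k → c n (suc k) * y ^ (n ∸ k)) (λ k → fromℕ (n C k) * a (suc k) * y ^ (n ∸ k)))) ⟩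
  c (suc n) 0 * y ^ suc n + ((∑[ k ≤ n ] c n (suc k) * y ^ (n ∸ k)) + (∑[ k ≤ n ] fromℕ (n C k) * a (suc k) * y ^ (n ∸ k)))
    ≡⟨ ℚₚ.+-assoc (c (suc n) 0 * y ^ suc n) _ _ ⟨
  (c (suc n) 0 * y ^ suc n + (∑[ k ≤ n ] c n (suc k) * y ^ (n ∸ k))) + (∑[ k ≤ n ] fromℕ (n C k) * a (suc k) * y ^ (n ∸ k))
    ≡⟨ cong₂ _+_ low (appell-sum (a ∘ suc) y n) ⟩
  y * translate y a n + translate y (a ∘ suc) n ∎
  where
  c : ℕ → ℕ → ℚ
  c m k = fromℕ (m C k) * a k

  pascal : ∀ k → c (suc n) (suc k) * y ^ (n ∸ k) ≡
                 c n (suc k) * y ^ (n ∸ k) + fromℕ (n C k) * a (suc k) * y ^ (n ∸ k)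
  pascal k = trans
    (cong (λ m → m * a (suc k) * y ^ (n ∸ k))
      (trans (cong fromℕ (sym (nCk+nC[k+1]≡[n+1]C[k+1] n k))) (fromℕ-+ (n C k) (n C suc k))))
    (r (fromℕ (n C k)) (fromℕ (n C suc k)) (a (suc k)) (y ^ (n ∸ k)))
    where
    r : ∀ u v x z → (u + v) * x * z ≡ v * x * z + u * x * z
    r = solve-∀ ℚ-ring

  -- After the index shift the sum runs one place too far; that last term has coefficient C(n,n+1) =
  -- 0.
  top : c n (suc n) * y ^ (n ∸ n) ≡ 0ℚ
  top = trans (cong (λ m → fromℕ m * a (suc n) * y ^ (n ∸ n)) (k>n⇒nCk≡0 {n} {suc n} ℕₚ.≤-refl))
              (r (a (suc n)) (y ^ (n ∸ n)))
    where
    r : ∀ x z → 0ℚ * x * z ≡ 0ℚ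
    r = solve-∀ ℚ-ring

  low : c (suc n) 0 * y ^ suc n + (∑[ k ≤ n ] c n (suc k) * y ^ (n ∸ k)) ≡ y * translate y a n
  low = begin
    c (suc n) 0 * y ^ suc n + (∑[ k ≤ n ] c n (suc k) * y ^ (n ∸ k))
      ≡⟨ cong (_+_ (c (suc n) 0 * y ^ suc n)) (sumBelow-suc n (λ k → c n (suc k) * y ^ (n ∸ k))) ⟩
    c (suc n) 0 * y ^ suc n + ((∑[ k < n ] c n (suc k) * y ^ (n ∸ k)) + c n (suc n) * y ^ (n ∸ n))
      ≡⟨ cong₂ (λ u v → c n 0 * y ^ suc n + (u + v))
           (trans (sumBelow-cong n shift) (sumBelow-* n y (λ k → c n (suc k) * y ^ (n ∸ suc k)))) top ⟩
    c n 0 * (y * y ^ n) + (y * (∑[ k < n ] c n (suc k) * y ^ (n ∸ suc k)) + 0ℚ)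
      ≡⟨ r (c n 0) y (y ^ n) (∑[ k < n ] c n (suc k) * y ^ (n ∸ suc k)) ⟩
    y * (c n 0 * y ^ n + (∑[ k < n ] c n (suc k) * y ^ (n ∸ suc k)))
      ≡⟨ cong (y *_) (appell-sum a y n) ⟩
    y * translate y a n ∎
    where
    shift : ∀ k → k ℕ.< n → c n (suc k) * y ^ (n ∸ k) ≡ y * (c n (suc k) * y ^ (n ∸ suc k))
    shift k k<n = trans (cong (λ m → c n (suc k) * y ^ m) (ℕₚ.+-∸-assoc 1 k<n))
                        (r (c n (suc k)) y (y ^ (n ∸ suc k)))
      where
      r : ∀ u y z → u * (y * z) ≡ y * (u * z)
      r = solve-∀ ℚ-ring
    r : ∀ u y z s → u * (y * z) + (y * s + 0ℚ) ≡ y * (u * z + s)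
    r = solve-∀ ℚ-ring

translate-cong : ∀ y {a b} → a ≗ b → translate y a ≗ translate y b
translate-cong y a≗b zero    = a≗b 0
translate-cong y a≗b (suc n) =
  cong₂ (λ u v → y * u + v) (translate-cong y a≗b n) (translate-cong y (a≗b ∘ suc) n)

translate-⊞ : ∀ y a b → translate y (a ⊞ b) ≗ translate y a ⊞ translate y b
translate-⊞ y a b zero    = refl
translate-⊞ y a b (suc n) =
  trans (cong₂ (λ u v → y * u + v) (translate-⊞ y a b n) (translate-⊞ y (a ∘ suc) (b ∘ suc) n))
        (r y (translate y a n) (translate y b n) (translate y (a ∘ suc) n) (translate y (b ∘ suc) n))
  where
  r : ∀ y s t u v → y * (s + t) + (u + v) ≡ (y * s + u) + (y * t + v)
  r = solve-∀ ℚ-ring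

translate-⊡ : ∀ y c a → translate y (c ⊡ a) ≗ c ⊡ translate y a
translate-⊡ y c a zero    = refl
translate-⊡ y c a (suc n) =
  trans (cong₂ (λ u v → y * u + v) (translate-⊡ y c a n) (translate-⊡ y c (a ∘ suc) n))
        (r y c (translate y a n) (translate y (a ∘ suc) n))
  where
  r : ∀ y c s u → y * (c * s) + c * u ≡ c * (y * s + u)
  r = solve-∀ ℚ-ring

translate-translate : ∀ y z a → translate z (translate y a) ≗ translate (y + z) a
translate-translate y z a zero    = refl
translate-translate y z a (suc n) = begin
  z * translate z (translate y a) n + translate z (y ⊡ translate y a ⊞ translate y (a ∘ suc)) n
    ≡⟨ cong (_+_ (z * translate z (translate y a) n)) (trans
         (translate-⊞ z (y ⊡ translate y a) (translate y (a ∘ suc)) n)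
         (cong (_+ translate z (translate y (a ∘ suc)) n) (translate-⊡ z y (translate y a) n))) ⟩
  z * translate z (translate y a) n + (y * translate z (translate y a) n + translate z (translate y (a ∘ suc)) n)
    ≡⟨ cong₂ (λ u v → z * u + (y * u + v)) (translate-translate y z a n) (translate-translate y z (a ∘ suc) n) ⟩
  z * translate (y + z) a n + (y * translate (y + z) a n + translate (y + z) (a ∘ suc) n)
    ≡⟨ r y z (translate (y + z) a n) (translate (y + z) (a ∘ suc) n) ⟩
  (y + z) * translate (y + z) a n + translate (y + z) (a ∘ suc) n ∎
  where
  r : ∀ y z u v → z * u + (y * u + v) ≡ (y + z) * u + v
  r = solve-∀ ℚ-ring

translate-0 : ∀ a → translate 0ℚ a ≗ a
translate-0 a zero    = refl
translate-0 a (suc n) = trans (cong (_+_ (0ℚ * translate 0ℚ a n)) (translate-0 (a ∘ suc) n)) (r (translate 0ℚ a n) (a (suc n)))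
  where
  r : ∀ s t → 0ℚ * s + t ≡ t
  r = solve-∀ ℚ-ring

translate-dilate : ∀ c y a → translate (c * y) (dilate c a) ≗ dilate c (translate y a)
translate-dilate c y a zero    = refl
translate-dilate c y a (suc n) = begin
  c * y * translate (c * y) (dilate c a) n + translate (c * y) (dilate c a ∘ suc) n
    ≡⟨ cong (_+_ (c * y * translate (c * y) (dilate c a) n)) (trans
         (translate-cong (c * y) (λ k → ℚₚ.*-assoc c (c ^ k) (a (suc k))) n)
         (translate-⊡ (c * y) c (dilate c (a ∘ suc)) n)) ⟩
  c * y * translate (c * y) (dilate c a) n + c * translate (c * y) (dilate c (a ∘ suc)) n
    ≡⟨ cong₂ (λ u v → c * y * u + c * v) (translate-dilate c y a n) (translate-dilate c y (a ∘ suc) n) ⟩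
  c * y * (c ^ n * translate y a n) + c * (c ^ n * translate y (a ∘ suc) n)
    ≡⟨ r c y (c ^ n) (translate y a n) (translate y (a ∘ suc) n) ⟩
  c * c ^ n * (y * translate y a n + translate y (a ∘ suc) n) ∎
  where
  r : ∀ c y d u v → c * y * (d * u) + c * (d * v) ≡ c * d * (y * u + v)
  r = solve-∀ ℚ-ring

dilate-⊞ : ∀ c a b → dilate c (a ⊞ b) ≗ dilate c a ⊞ dilate c b
dilate-⊞ c a b n = ℚₚ.*-distribˡ-+ (c ^ n) (a n) (b n)

dilate-cong : ∀ c {a b} → a ≗ b → dilate c a ≗ dilate c b
dilate-cong c a≗b n = cong (c ^ n *_) (a≗b n)

powers : ℚ → Seq
powers x n = x ^ n

translate-powers : ∀ x y → translate y (powers x) ≗ powers (x + y)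
translate-powers x y zero    = refl
translate-powers x y (suc n) = begin
  y * translate y (powers x) n + translate y (x ⊡ powers x) n
    ≡⟨ cong (_+_ (y * translate y (powers x) n)) (translate-⊡ y x (powers x) n) ⟩
  y * translate y (powers x) n + x * translate y (powers x) n
    ≡⟨ cong (λ u → y * u + x * u) (translate-powers x y n) ⟩
  y * (x + y) ^ n + x * (x + y) ^ n
    ≡⟨ r x y ((x + y) ^ n) ⟩
  (x + y) * (x + y) ^ n ∎
  where
  r : ∀ x y s → y * s + x * s ≡ (x + y) * s
  r = solve-∀ ℚ-ring

translate-leading : ∀ y a n → (∀ k → k ℕ.< n → a k ≡ 0ℚ) → translate y a n ≡ a n
translate-leading y a zero    a≡0 = refl
translate-leading y a (suc n) a≡0 = begin
  y * translate y a n + translate y (a ∘ suc) n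
    ≡⟨ cong₂ (λ u v → y * u + v)
         (trans (translate-leading y a n (λ k k<n → a≡0 k (ℕₚ.m<n⇒m<1+n k<n))) (a≡0 n ℕₚ.≤-refl))
         (translate-leading y (a ∘ suc) n (λ k k<n → a≡0 (suc k) (s≤s k<n))) ⟩
  y * 0ℚ + a (suc n)
    ≡⟨ r y (a (suc n)) ⟩
  a (suc n) ∎
  where
  r : ∀ y s → y * 0ℚ + s ≡ s
  r = solve-∀ ℚ-ring

-- If A(t) starts in degree n, then e^(yt) A(t) gains y t times its leading term in degree n + 1;
-- the factor n + 1 is the ratio (n+1)!/n!.
translate-subleading : ∀ y a n → (∀ k → k ℕ.< n → a k ≡ 0ℚ) →
  translate y a (suc n) ≡ a (suc n) + fromℕ (suc n) * y * a n
translate-subleading y a zero    a≡0 = r y (a 0) (a 1)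
  where
  r : ∀ y s t → y * s + t ≡ t + 1ℚ * y * s
  r = solve-∀ ℚ-ring
translate-subleading y a (suc n) a≡0 = begin
  y * translate y a (suc n) + translate y (a ∘ suc) (suc n)
    ≡⟨ cong₂ (λ u v → y * u + v) (translate-leading y a (suc n) a≡0)
         (translate-subleading y (a ∘ suc) n (λ k k<n → a≡0 (suc k) (s≤s k<n))) ⟩
  y * a (suc n) + (a (suc (suc n)) + fromℕ (suc n) * y * a (suc n))
    ≡⟨ r y (a (suc n)) (a (suc (suc n))) (fromℕ (suc n)) ⟩
  a (suc (suc n)) + (fromℕ (suc n) + 1ℚ) * y * a (suc n)
    ≡⟨ cong (λ m → a (suc (suc n)) + m * y * a (suc n)) (fromℕ-suc (suc n)) ⟨
  a (suc (suc n)) + fromℕ (suc (suc n)) * y * a (suc n) ∎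
  where
  r : ∀ y s t m → y * s + (t + m * y * s) ≡ t + (m + 1ℚ) * y * s
  r = solve-∀ ℚ-ring

-- The series e^(yt) + 1 has constant term 2, so the first nonzero coefficient of a would survive
-- doubled.
translate-kernel₊ : ∀ y a → translate y a ⊞ a ≗ (λ _ → 0ℚ) → a ≗ (λ _ → 0ℚ)
translate-kernel₊ y a eq = <-rec _ step
  where
  step : ∀ n → (∀ {k} → k ℕ.< n → a k ≡ 0ℚ) → a n ≡ 0ℚ
  step n IH = *-cancelʳ-fromℕ 2 (begin
    a n * fromℕ 2          ≡⟨ r (a n) ⟩
    a n + a n              ≡⟨ cong (_+ a n) (translate-leading y a n (λ k → IH)) ⟨
    translate y a n + a n  ≡⟨ eq n ⟩
    0ℚ                     ∎)
    where
    r : ∀ x → x * fromℕ 2 ≡ x + x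
    r = solve-∀ ℚ-ring

-- The series e^t - 1 starts with t, so the first nonzero coefficient, in degree n, is detected in
-- degree n + 1 with the factor n + 1.
translate-kernel₋ : ∀ a → translate 1ℚ a ≗ a → a ≗ (λ _ → 0ℚ)
translate-kernel₋ a eq = <-rec _ step
  where
  step : ∀ n → (∀ {k} → k ℕ.< n → a k ≡ 0ℚ) → a n ≡ 0ℚ
  step n IH = *-cancelʳ-fromℕ (suc n) (begin
    a n * fromℕ (suc n)
      ≡⟨ r (a n) (fromℕ (suc n)) (a (suc n)) ⟩
    (a (suc n) + fromℕ (suc n) * 1ℚ * a n) - a (suc n)
      ≡⟨ cong (_- a (suc n)) (trans (sym (translate-subleading 1ℚ a n (λ k → IH))) (eq (suc n))) ⟩
    a (suc n) - a (suc n)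
      ≡⟨ r′ (a (suc n)) (fromℕ (suc n)) ⟩
    0ℚ * fromℕ (suc n) ∎)
    where
    r : ∀ x m z → x * m ≡ (z + m * 1ℚ * x) - z
    r = solve-∀ ℚ-ring
    r′ : ∀ z m → z - z ≡ 0ℚ * m
    r′ = solve-∀ ℚ-ring

-1ℚ : ℚ
-1ℚ = - 1ℚ

-- Multiplication of the generating function by t. On the associated Appell polynomials Aₙ(y) it
-- yields n Aₙ₋₁(y), the derivative of Aₙ.
derive : Seq → Seq
derive a zero    = 0ℚ
derive a (suc n) = fromℕ (suc n) * a n

derive-cong : ∀ {a b} → a ≗ b → derive a ≗ derive b
derive-cong a≗b zero    = refl
derive-cong a≗b (suc n) = cong (fromℕ (suc n) *_) (a≗b n)

translate-derive : ∀ y a → translate y (derive a) ≗ derive (translate y a)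
translate-derive y a zero    = refl
translate-derive y a (suc n) = begin
  y * translate y (derive a) n + translate y (derive a ∘ suc) n
    ≡⟨ cong₂ (λ u v → y * u + v) (translate-derive y a n) (trans
         (translate-cong y shift n) (translate-⊞ y a (derive (a ∘ suc)) n)) ⟩
  y * derive (translate y a) n + (translate y a n + translate y (derive (a ∘ suc)) n)
    ≡⟨ cong (λ u → y * derive (translate y a) n + (translate y a n + u)) (translate-derive y (a ∘ suc) n) ⟩
  y * derive (translate y a) n + (translate y a n + derive (translate y (a ∘ suc)) n)
    ≡⟨ last n ⟩
  fromℕ (suc n) * translate y a n ∎
  where
  shift : derive a ∘ suc ≗ a ⊞ derive (a ∘ suc)
  shift zero    = r (a 0)
    where
    r : ∀ x → 1ℚ * x ≡ x + 0ℚ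
    r = solve-∀ ℚ-ring
  shift (suc k) = trans (cong (_* a (suc k)) (fromℕ-suc (suc k))) (r (fromℕ (suc k)) (a (suc k)))
    where
    r : ∀ m x → (m + 1ℚ) * x ≡ x + m * x
    r = solve-∀ ℚ-ring
  last : ∀ n → y * derive (translate y a) n + (translate y a n + derive (translate y (a ∘ suc)) n) ≡
               fromℕ (suc n) * translate y a n
  last zero    = r y (a 0)
    where
    r : ∀ y x → y * 0ℚ + (x + 0ℚ) ≡ 1ℚ * x
    r = solve-∀ ℚ-ring
  last (suc k) = trans (r y (fromℕ (suc k)) (translate y a k) (translate y (a ∘ suc) k))
                       (cong (_* translate y a (suc k)) (sym (fromℕ-suc (suc k))))
    where
    r : ∀ y m u v → y * (m * u) + ((y * u + v) + m * v) ≡ (m + 1ℚ) * (y * u + v)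
    r = solve-∀ ℚ-ring

-- Cancels the factor e^(yt) + 1, as `translate-unique₋` cancels e^t - 1. An identity between Euler
-- or Bernoulli series is thus proved by multiplying both sides until they become explicit.
translate-unique₊ : ∀ y a b → translate y a ⊞ a ≗ translate y b ⊞ b → a ≗ b
translate-unique₊ y a b eq n = begin
  a n                     ≡⟨ r (a n) (b n) ⟩
  (a n + -1ℚ * b n) + b n ≡⟨ cong (_+ b n) (translate-kernel₊ y (a ⊞ -1ℚ ⊡ b) kernel n) ⟩
  0ℚ + b n                ≡⟨ ℚₚ.+-identityˡ (b n) ⟩
  b n                     ∎
  where
  r : ∀ x y → x ≡ (x + - 1ℚ * y) + y
  r = solve-∀ ℚ-ring
  kernel : translate y (a ⊞ -1ℚ ⊡ b) ⊞ (a ⊞ -1ℚ ⊡ b) ≗ (λ _ → 0ℚ)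
  kernel m = begin
    translate y (a ⊞ -1ℚ ⊡ b) m + (a m + -1ℚ * b m)
      ≡⟨ cong (_+ (a m + -1ℚ * b m)) (trans (translate-⊞ y a (-1ℚ ⊡ b) m) (cong (_+_ (translate y a m)) (translate-⊡ y -1ℚ b m))) ⟩
    (translate y a m + -1ℚ * translate y b m) + (a m + -1ℚ * b m)
      ≡⟨ r′ (translate y a m) (translate y b m) (a m) (b m) ⟩
    (translate y a m + a m) - (translate y b m + b m)
      ≡⟨ cong (_- (translate y b m + b m)) (eq m) ⟩
    (translate y b m + b m) - (translate y b m + b m)
      ≡⟨ ℚₚ.+-inverseʳ (translate y b m + b m) ⟩
    0ℚ ∎
    where
    r′ : ∀ u v x y → (u + - 1ℚ * v) + (x + - 1ℚ * y) ≡ (u + x) - (v + y)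
    r′ = solve-∀ ℚ-ring

translate-unique₋ : ∀ a b → (∀ n → translate 1ℚ a n - a n ≡ translate 1ℚ b n - b n) → a ≗ b
translate-unique₋ a b eq n = begin
  a n                     ≡⟨ r (a n) (b n) ⟩
  (a n + -1ℚ * b n) + b n ≡⟨ cong (_+ b n) (translate-kernel₋ (a ⊞ -1ℚ ⊡ b) kernel n) ⟩
  0ℚ + b n                ≡⟨ ℚₚ.+-identityˡ (b n) ⟩
  b n                     ∎
  where
  r : ∀ x y → x ≡ (x + - 1ℚ * y) + y
  r = solve-∀ ℚ-ring
  kernel : translate 1ℚ (a ⊞ -1ℚ ⊡ b) ≗ a ⊞ -1ℚ ⊡ b
  kernel m = begin
    translate 1ℚ (a ⊞ -1ℚ ⊡ b) m
      ≡⟨ trans (translate-⊞ 1ℚ a (-1ℚ ⊡ b) m) (cong (_+_ (translate 1ℚ a m)) (translate-⊡ 1ℚ -1ℚ b m)) ⟩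
    translate 1ℚ a m + -1ℚ * translate 1ℚ b m
      ≡⟨ r′ (translate 1ℚ a m) (translate 1ℚ b m) (a m) ⟩
    (translate 1ℚ a m - a m) + (a m + -1ℚ * translate 1ℚ b m)
      ≡⟨ cong (_+ (a m + -1ℚ * translate 1ℚ b m)) (eq m) ⟩
    (translate 1ℚ b m - b m) + (a m + -1ℚ * translate 1ℚ b m)
      ≡⟨ r″ (translate 1ℚ b m) (a m) (b m) ⟩
    a m + -1ℚ * b m ∎
    where
    r′ : ∀ u v x → u + - 1ℚ * v ≡ (u - x) + (x + - 1ℚ * v)
    r′ = solve-∀ ℚ-ring
    r″ : ∀ v x y → (v - y) + (x + - 1ℚ * v) ≡ x + - 1ℚ * y
    r″ = solve-∀ ℚ-ring

-- Bernoulli numbers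

bernoulli-unfold : ∀ n → bernoulli n ≡ bernoulliStep n (λ {k} _ → bernoulli k)
bernoulli-unfold n = FixPoint.unfold-wfRec <-wellFounded (λ _ → ℚ) bernoulliStep ext {n}
  where
  ext : ∀ n {B B′ : ∀ {k} → k ℕ.< n → ℚ} → (∀ {k} (k<n : k ℕ.< n) → B k<n ≡ B′ k<n) →
        bernoulliStep n B ≡ bernoulliStep n B′
  ext zero    eq = refl
  ext (suc n) eq = cong (λ s → - ((1ℤ / suc n′) * s))
    (sum-cong-≗ {suc n} (λ i → cong (fromℕ (suc n′ C toℕ i) *_) (eq (toℕ<n i))))
    where n′ = suc n

[1+n]Cn≡1+n : ∀ n → suc n C n ≡ suc n
[1+n]Cn≡1+n n = trans (nCk≡nC[n∸k] (ℕₚ.n≤1+n n)) (trans (cong (suc n C_) (ℕₚ.m+n∸n≡m 1 n)) (nC1≡n (suc n)))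

bernoulli-sum : ∀ n → (∑[ k ≤ suc n ] fromℕ (suc (suc n) C k) * bernoulli k) ≡ 0ℚ
bernoulli-sum n = begin
  (∑[ k ≤ suc n ] fromℕ (suc (suc n) C k) * bernoulli k)
    ≡⟨ sumBelow-suc (suc n) (λ k → fromℕ (suc (suc n) C k) * bernoulli k) ⟩
  s + fromℕ (suc (suc n) C suc n) * bernoulli (suc n)
    ≡⟨ cong₂ (λ m b → s + fromℕ m * b) ([1+n]Cn≡1+n (suc n)) (bernoulli-unfold (suc n)) ⟩
  s + fromℕ (suc (suc n)) * - ((1ℤ / suc (suc n)) * s)
    ≡⟨ r s (fromℕ (suc (suc n))) (1ℤ / suc (suc n)) ⟩
  s - ((1ℤ / suc (suc n)) * fromℕ (suc (suc n))) * s
    ≡⟨ cong (λ u → s - u * s) (/-*-cancel 1ℤ (suc (suc n))) ⟩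
  s - 1ℚ * s
    ≡⟨ r′ s ⟩
  0ℚ ∎
  where
  s = ∑[ k ≤ n ] fromℕ (suc (suc n) C k) * bernoulli k
  r : ∀ s m u → s + m * - (u * s) ≡ s - (u * m) * s
  r = solve-∀ ℚ-ring
  r′ : ∀ s → s - 1ℚ * s ≡ 0ℚ
  r′ = solve-∀ ℚ-ring

-- That is, B(t) e^t = B(t) + t. In degree m ≥ 2 the recurrence makes all terms but the top one, Bₘ,
-- sum to zero; degrees 0 and 1 are computed.
bernoulli-difference : translate 1ℚ bernoulli ≗ bernoulli ⊞ derive (powers 0ℚ)
bernoulli-difference zero          = refl
bernoulli-difference (suc zero)    = refl
bernoulli-difference (suc (suc n)) = begin
  translate 1ℚ bernoulli m
    ≡⟨ appell-sum bernoulli 1ℚ m ⟨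
  (∑[ k ≤ m ] c k * 1ℚ ^ (m ∸ k))
    ≡⟨ sumBelow-cong (suc m) (λ k _ → trans (cong (c k *_) (1^n≡1 (m ∸ k))) (ℚₚ.*-identityʳ (c k))) ⟩
  (∑[ k ≤ m ] c k)
    ≡⟨ sumBelow-suc m c ⟩
  (∑[ k < m ] c k) + fromℕ (m C m) * bernoulli m
    ≡⟨ cong₂ (λ u v → u + fromℕ v * bernoulli m) (bernoulli-sum n) (nCn≡1 m) ⟩
  0ℚ + 1ℚ * bernoulli m
    ≡⟨ r (bernoulli m) (fromℕ m) (0ℚ ^ n) ⟩
  bernoulli m + fromℕ m * (0ℚ * 0ℚ ^ n) ∎
  where
  m = suc (suc n)
  c : ℕ → ℚ
  c k = fromℕ (m C k) * bernoulli k
  r : ∀ b m z → 0ℚ + 1ℚ * b ≡ b + m * (0ℚ * z)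
  r = solve-∀ ℚ-ring

-- Euler numbers

euler-unfold : ∀ n → euler n ≡ eulerStep n (λ {k} _ → euler k)
euler-unfold n = FixPoint.unfold-wfRec <-wellFounded (λ _ → ℤ) eulerStep ext {n}
  where
  ext : ∀ n {E E′ : ∀ {k} → k ℕ.< n → ℤ} → (∀ {k} (k<n : k ℕ.< n) → E k<n ≡ E′ k<n) →
        eulerStep n E ≡ eulerStep n E′
  ext zero    eq = refl
  ext (suc n) eq = cong ℤ.-_ (ℤ-sum-cong-≗ {⌊ suc n /2⌋}
    (λ i → cong (+ (suc n C (2 ℕ.* suc (toℕ i))) ℤ.*_) (eq (s≤s (ℕₚ.m∸n≤m n (ℕ.pred (2 ℕ.* suc (toℕ i))))))))

fromℤ-sum : ∀ n (f : ℕ → ℤ) → fromℤ (sumℤ {n} (f ∘ toℕ)) ≡ sumBelow n (fromℤ ∘ f)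
fromℤ-sum zero    f = refl
fromℤ-sum (suc n) f = trans (fromℤ-+ (f 0) (sumℤ {n} (f ∘ suc ∘ toℕ))) (cong (_+_ (fromℤ (f 0))) (fromℤ-sum n (f ∘ suc)))

sumUpTo-reverse : ∀ n (f : Seq) → sumUpTo n f ≡ (∑[ k ≤ n ] f (n ∸ k))
sumUpTo-reverse zero    f = refl
sumUpTo-reverse (suc n) f = begin
  f 0 + (∑[ k ≤ n ] f (suc k))
    ≡⟨ cong (_+_ (f 0)) (trans (sumUpTo-reverse n (f ∘ suc))
         (sumBelow-cong (suc n) (λ k k≤n → cong f (sym (ℕₚ.+-∸-assoc 1 (ℕₚ.≤-pred k≤n)))))) ⟩
  f 0 + (∑[ k ≤ n ] f (suc n ∸ k))
    ≡⟨ ℚₚ.+-comm (f 0) _ ⟩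
  (∑[ k ≤ n ] f (suc n ∸ k)) + f 0
    ≡⟨ cong (λ m → (∑[ k ≤ n ] f (suc n ∸ k)) + f m) (ℕₚ.n∸n≡0 (suc n)) ⟨
  (∑[ k ≤ n ] f (suc n ∸ k)) + f (suc n ∸ suc n)
    ≡⟨ sumBelow-suc (suc n) (λ k → f (suc n ∸ k)) ⟨
  (∑[ k ≤ suc n ] f (suc n ∸ k)) ∎

-- The weight 1 + (-1)ᵏ is 2 at even k and 0 at odd k, so the induction removes two terms at a time.
sum-even : ∀ n (g : Seq) → (∑[ k < n ] g k * (1ℚ + -1ℚ ^ k)) ≡ fromℕ 2 * (∑[ j < ⌊ suc n /2⌋ ] g (2 ℕ.* j))
sum-even zero          g = refl
sum-even (suc zero)    g = r (g 0)
  where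
  r : ∀ x → x * (1ℚ + 1ℚ) + 0ℚ ≡ fromℕ 2 * (x + 0ℚ)
  r = solve-∀ ℚ-ring
sum-even (suc (suc n)) g = begin
  g 0 * (1ℚ + 1ℚ) + (g 1 * (1ℚ + -1ℚ * 1ℚ) + (∑[ k < n ] g (suc (suc k)) * (1ℚ + -1ℚ * (-1ℚ * -1ℚ ^ k))))
    ≡⟨ r (g 0) (g 1) _ ⟩
  fromℕ 2 * g 0 + (∑[ k < n ] g (suc (suc k)) * (1ℚ + -1ℚ * (-1ℚ * -1ℚ ^ k)))
    ≡⟨ cong (_+_ (fromℕ 2 * g 0)) (trans
         (sumBelow-cong n (λ k _ → r′ (g (suc (suc k))) (-1ℚ ^ k)))
         (sum-even n (g ∘ suc ∘ suc))) ⟩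
  fromℕ 2 * g 0 + fromℕ 2 * (∑[ j < ⌊ suc n /2⌋ ] g (suc (suc (2 ℕ.* j))))
    ≡⟨ cong (λ s → fromℕ 2 * g 0 + fromℕ 2 * s) (sumBelow-cong ⌊ suc n /2⌋ (λ j _ → cong g (sym (ℕₚ.*-suc 2 j)))) ⟩
  fromℕ 2 * g 0 + fromℕ 2 * (∑[ j < ⌊ suc n /2⌋ ] g (2 ℕ.* suc j))
    ≡⟨ ℚₚ.*-distribˡ-+ (fromℕ 2) (g 0) _ ⟨
  fromℕ 2 * (g 0 + (∑[ j < ⌊ suc n /2⌋ ] g (2 ℕ.* suc j))) ∎
  where
  r : ∀ x y s → x * (1ℚ + 1ℚ) + (y * (1ℚ + - 1ℚ * 1ℚ) + s) ≡ fromℕ 2 * x + s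
  r = solve-∀ ℚ-ring
  r′ : ∀ x z → x * (1ℚ + - 1ℚ * (- 1ℚ * z)) ≡ x * (1ℚ + z)
  r′ = solve-∀ ℚ-ring

eulerℚ : Seq
eulerℚ = fromℤ ∘ euler

-- The defining property E(t)(e^t + e^(-t)) = 2 of the Euler numbers.
euler-cosh : translate 1ℚ eulerℚ ⊞ translate -1ℚ eulerℚ ≗ fromℕ 2 ⊡ powers 0ℚ
euler-cosh zero    = refl
euler-cosh (suc n) = begin
  translate 1ℚ eulerℚ m + translate -1ℚ eulerℚ m
    ≡⟨ cong₂ _+_ (appell-sum eulerℚ 1ℚ m) (appell-sum eulerℚ -1ℚ m) ⟨
  (∑[ k ≤ m ] c k * 1ℚ ^ (m ∸ k)) + (∑[ k ≤ m ] c k * -1ℚ ^ (m ∸ k))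
    ≡⟨ sumBelow-+ (suc m) (λ k → c k * 1ℚ ^ (m ∸ k)) (λ k → c k * -1ℚ ^ (m ∸ k)) ⟨
  (∑[ k ≤ m ] c k * 1ℚ ^ (m ∸ k) + c k * -1ℚ ^ (m ∸ k))
    -- The recurrence of `eulerStep` evaluates E at m - 2j, so the even index has to be the
    -- complementary one.
    ≡⟨ sumUpTo-reverse m (λ k → c k * 1ℚ ^ (m ∸ k) + c k * -1ℚ ^ (m ∸ k)) ⟩
  (∑[ k ≤ m ] c (m ∸ k) * 1ℚ ^ (m ∸ (m ∸ k)) + c (m ∸ k) * -1ℚ ^ (m ∸ (m ∸ k)))
    ≡⟨ sumBelow-cong (suc m) term ⟩
  (∑[ k ≤ m ] g k * (1ℚ + -1ℚ ^ k))
    ≡⟨ sum-even (suc m) g ⟩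
  fromℕ 2 * (g 0 + (∑[ j < ⌊ m /2⌋ ] g (2 ℕ.* suc j)))
    ≡⟨ cong (λ x → fromℕ 2 * (1ℚ * x + s)) E≡ ⟩
  fromℕ 2 * (1ℚ * - s + s)
    ≡⟨ r s (0ℚ ^ n) ⟩
  fromℕ 2 * (0ℚ * 0ℚ ^ n) ∎
  where
  m = suc n
  c g : ℕ → ℚ
  c k = fromℕ (m C k) * eulerℚ k
  g k = fromℕ (m C k) * eulerℚ (m ∸ k)
  s = ∑[ j < ⌊ m /2⌋ ] g (2 ℕ.* suc j)

  term : ∀ k → k ℕ.< suc m → c (m ∸ k) * 1ℚ ^ (m ∸ (m ∸ k)) + c (m ∸ k) * -1ℚ ^ (m ∸ (m ∸ k)) ≡ g k * (1ℚ + -1ℚ ^ k)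
  term k k<1+m = begin
    c (m ∸ k) * 1ℚ ^ (m ∸ (m ∸ k)) + c (m ∸ k) * -1ℚ ^ (m ∸ (m ∸ k))
      ≡⟨ cong₂ (λ u i → fromℕ u * eulerℚ (m ∸ k) * 1ℚ ^ i + fromℕ u * eulerℚ (m ∸ k) * -1ℚ ^ i)
           (sym (nCk≡nC[n∸k] k≤m)) (ℕₚ.m∸[m∸n]≡n k≤m) ⟩
    g k * 1ℚ ^ k + g k * -1ℚ ^ k
      ≡⟨ cong (λ u → g k * u + g k * -1ℚ ^ k) (1^n≡1 k) ⟩
    g k * 1ℚ + g k * -1ℚ ^ k
      ≡⟨ ℚₚ.*-distribˡ-+ (g k) 1ℚ (-1ℚ ^ k) ⟨
    g k * (1ℚ + -1ℚ ^ k) ∎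
    where k≤m = ℕₚ.≤-pred k<1+m

  E≡ : eulerℚ m ≡ - s
  E≡ = begin
    fromℤ (euler m)                               ≡⟨ cong fromℤ (euler-unfold m) ⟩
    fromℤ (ℤ.- sumℤ {⌊ m /2⌋} (h ∘ toℕ))          ≡⟨ fromℤ-neg (sumℤ {⌊ m /2⌋} (h ∘ toℕ)) ⟩
    - fromℤ (sumℤ {⌊ m /2⌋} (h ∘ toℕ))            ≡⟨ cong (-_) (fromℤ-sum ⌊ m /2⌋ h) ⟩
    - sumBelow ⌊ m /2⌋ (fromℤ ∘ h)                ≡⟨ cong (-_) (sumBelow-cong ⌊ m /2⌋ (λ j _ → fromℤ-* (+ (m C (2 ℕ.* suc j))) (euler (m ∸ 2 ℕ.* suc j)))) ⟩
    - s                                           ∎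
    where
    h : ℕ → ℤ
    h j = + (m C (2 ℕ.* suc j)) ℤ.* euler (m ∸ 2 ℕ.* suc j)

  r : ∀ s z → fromℕ 2 * (1ℚ * - s + s) ≡ fromℕ 2 * (0ℚ * z)
  r = solve-∀ ℚ-ring

-- Euler and Bernoulli polynomials

eulerHalf : Seq
eulerHalf n = euler n ÷ 2 ^ n

eulerHalf-dilate : eulerHalf ≗ dilate ½ eulerℚ
eulerHalf-dilate n = *-cancelʳ-fromℕ (2 ℕ.^ n) {{ℕₚ.m^n≢0 2 n}} (begin
  eulerHalf n * fromℕ (2 ℕ.^ n)
    ≡⟨ /-*-cancel (euler n) (2 ℕ.^ n) {{ℕₚ.m^n≢0 2 n}} ⟩
  eulerℚ n
    ≡⟨ ℚₚ.*-identityˡ (eulerℚ n) ⟨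
  1ℚ * eulerℚ n
    ≡⟨ cong (_* eulerℚ n) (trans (sym (1^n≡1 n)) (^-distrib-* ½ (fromℕ 2) n)) ⟩
  ½ ^ n * fromℕ 2 ^ n * eulerℚ n
    ≡⟨ r (½ ^ n) (fromℕ 2 ^ n) (eulerℚ n) ⟩
  ½ ^ n * eulerℚ n * fromℕ 2 ^ n
    ≡⟨ cong (½ ^ n * eulerℚ n *_) (fromℕ-^ 2 n) ⟨
  ½ ^ n * eulerℚ n * fromℕ (2 ℕ.^ n) ∎)
  where
  r : ∀ a b c → a * b * c ≡ a * c * b
  r = solve-∀ ℚ-ring

-- The values Eₙ(0), with generating function 2/(e^t + 1). The shift by -1/2 appears because Euler
-- polynomials are defined by expansion around 1/2.
ε : Seq
ε = translate (- ½) eulerHalf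

eulerPoly-translate : ∀ n x → eulerPoly n x ≡ translate x ε n
eulerPoly-translate n x = trans (appell-sum eulerHalf (x - ½) n)
  (trans (cong (λ y → translate y eulerHalf n) (ℚₚ.+-comm x (- ½)))
         (sym (translate-translate (- ½) x eulerHalf n)))

bernoulliPoly-translate : ∀ n x → bernoulliPoly n x ≡ translate x bernoulli n
bernoulliPoly-translate n x = appell-sum bernoulli x n

dilate-powers-0 : ∀ c → dilate c (powers 0ℚ) ≗ powers 0ℚ
dilate-powers-0 c zero    = refl
dilate-powers-0 c (suc n) = r (c * c ^ n) (0ℚ ^ n)
  where
  r : ∀ c z → c * (0ℚ * z) ≡ 0ℚ * z
  r = solve-∀ ℚ-ring

dilate-⊡ : ∀ c b a → dilate c (b ⊡ a) ≗ b ⊡ dilate c a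
dilate-⊡ c b a n = r (c ^ n) b (a n)
  where
  r : ∀ c b a → c * (b * a) ≡ b * (c * a)
  r = solve-∀ ℚ-ring

dilate-2·0^ : ∀ c {a} → a ≗ fromℕ 2 ⊡ powers 0ℚ → dilate c a ≗ fromℕ 2 ⊡ powers 0ℚ
dilate-2·0^ c {a} a≗ n = begin
  c ^ n * a n                    ≡⟨ dilate-cong c a≗ n ⟩
  c ^ n * (fromℕ 2 * 0ℚ ^ n)     ≡⟨ dilate-⊡ c (fromℕ 2) (powers 0ℚ) n ⟩
  fromℕ 2 * (c ^ n * 0ℚ ^ n)     ≡⟨ cong (fromℕ 2 *_) (dilate-powers-0 c n) ⟩
  fromℕ 2 * 0ℚ ^ n               ∎

eulerHalf-cosh : translate ½ eulerHalf ⊞ translate (- ½) eulerHalf ≗ fromℕ 2 ⊡ powers 0ℚ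
eulerHalf-cosh n = begin
  translate ½ eulerHalf n + translate (- ½) eulerHalf n
    ≡⟨ cong₂ _+_ (lem 1ℚ) (lem -1ℚ) ⟩
  ½ ^ n * translate 1ℚ eulerℚ n + ½ ^ n * translate -1ℚ eulerℚ n
    ≡⟨ dilate-⊞ ½ (translate 1ℚ eulerℚ) (translate -1ℚ eulerℚ) n ⟨
  ½ ^ n * (translate 1ℚ eulerℚ n + translate -1ℚ eulerℚ n)
    ≡⟨ dilate-2·0^ ½ euler-cosh n ⟩
  fromℕ 2 * 0ℚ ^ n ∎
  where
  lem : ∀ y → translate (½ * y) eulerHalf n ≡ ½ ^ n * translate y eulerℚ n
  lem y = trans (translate-cong (½ * y) eulerHalf-dilate n) (translate-dilate ½ y eulerℚ n)

ε-difference : translate 1ℚ ε ⊞ ε ≗ fromℕ 2 ⊡ powers 0ℚ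
ε-difference n = trans (cong (_+ ε n) (translate-translate (- ½) 1ℚ eulerHalf n)) (eulerHalf-cosh n)

eulerPoly-recurrence : ∀ n x → eulerPoly n (1ℚ + x) + eulerPoly n x ≡ fromℕ 2 * x ^ n
eulerPoly-recurrence n x = begin
  eulerPoly n (1ℚ + x) + eulerPoly n x
    ≡⟨ cong₂ _+_ (eulerPoly-translate n (1ℚ + x)) (eulerPoly-translate n x) ⟩
  translate (1ℚ + x) ε n + translate x ε n
    ≡⟨ cong (_+ translate x ε n) (translate-translate 1ℚ x ε n) ⟨
  translate x (translate 1ℚ ε) n + translate x ε n
    ≡⟨ translate-⊞ x (translate 1ℚ ε) ε n ⟨
  translate x (translate 1ℚ ε ⊞ ε) n
    ≡⟨ translate-cong x ε-difference n ⟩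
  translate x (fromℕ 2 ⊡ powers 0ℚ) n
    ≡⟨ trans (translate-⊡ x (fromℕ 2) (powers 0ℚ) n) (cong (fromℕ 2 *_) (translate-powers 0ℚ x n)) ⟩
  fromℕ 2 * (0ℚ + x) ^ n
    ≡⟨ cong (λ y → fromℕ 2 * y ^ n) (ℚₚ.+-identityˡ x) ⟩
  fromℕ 2 * x ^ n ∎

-- Multiplying 2/(e^(-t) + 1) and 2e^t/(e^t + 1) by e^t + 1 gives 2e^t in both cases.
ε-reflection : dilate -1ℚ ε ≗ translate 1ℚ ε
ε-reflection = translate-unique₊ 1ℚ (dilate -1ℚ ε) (translate 1ℚ ε) (λ n → trans (lhs n) (sym (rhs n)))
  where
  lhs : ∀ n → translate 1ℚ (dilate -1ℚ ε) n + dilate -1ℚ ε n ≡ fromℕ 2 * 1ℚ ^ n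
  lhs n = begin
    translate 1ℚ (dilate -1ℚ ε) n + dilate -1ℚ ε n
      ≡⟨ cong (_+ dilate -1ℚ ε n) (translate-dilate -1ℚ -1ℚ ε n) ⟩
    -1ℚ ^ n * translate -1ℚ ε n + -1ℚ ^ n * ε n
      ≡⟨ ℚₚ.*-distribˡ-+ (-1ℚ ^ n) (translate -1ℚ ε n) (ε n) ⟨
    -1ℚ ^ n * (translate -1ℚ ε n + ε n)
      ≡⟨ cong (-1ℚ ^ n *_) (begin
           translate -1ℚ ε n + ε n                        ≡⟨ ℚₚ.+-comm (translate -1ℚ ε n) (ε n) ⟩
           ε n + translate -1ℚ ε n                        ≡⟨ cong₂ _+_ (eulerPoly-translate n 0ℚ ∙ translate-0 ε n) (eulerPoly-translate n -1ℚ) ⟨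
           eulerPoly n 0ℚ + eulerPoly n -1ℚ               ≡⟨ eulerPoly-recurrence n -1ℚ ⟩
           fromℕ 2 * -1ℚ ^ n                              ∎) ⟩
    -1ℚ ^ n * (fromℕ 2 * -1ℚ ^ n)
      ≡⟨ r (-1ℚ ^ n) ⟩
    fromℕ 2 * (-1ℚ ^ n * -1ℚ ^ n)
      ≡⟨ cong (fromℕ 2 *_) (^-distrib-* -1ℚ -1ℚ n) ⟨
    fromℕ 2 * 1ℚ ^ n ∎
    where
    _∙_ = trans
    r : ∀ s → s * (fromℕ 2 * s) ≡ fromℕ 2 * (s * s)
    r = solve-∀ ℚ-ring
  rhs : ∀ n → translate 1ℚ (translate 1ℚ ε) n + translate 1ℚ ε n ≡ fromℕ 2 * 1ℚ ^ n
  rhs n = begin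
    translate 1ℚ (translate 1ℚ ε) n + translate 1ℚ ε n   ≡⟨ translate-⊞ 1ℚ (translate 1ℚ ε) ε n ⟨
    translate 1ℚ (translate 1ℚ ε ⊞ ε) n                  ≡⟨ translate-cong 1ℚ ε-difference n ⟩
    translate 1ℚ (fromℕ 2 ⊡ powers 0ℚ) n                 ≡⟨ translate-⊡ 1ℚ (fromℕ 2) (powers 0ℚ) n ⟩
    fromℕ 2 * translate 1ℚ (powers 0ℚ) n                 ≡⟨ cong (fromℕ 2 *_) (translate-powers 0ℚ 1ℚ n) ⟩
    fromℕ 2 * 1ℚ ^ n                                     ∎

eulerPoly-reflection : ∀ n x → eulerPoly n (1ℚ - x) ≡ -1ℚ ^ n * eulerPoly n x
eulerPoly-reflection n x = begin
  eulerPoly n (1ℚ - x)                 ≡⟨ eulerPoly-translate n (1ℚ - x) ⟩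
  translate (1ℚ - x) ε n               ≡⟨ translate-translate 1ℚ (- x) ε n ⟨
  translate (- x) (translate 1ℚ ε) n   ≡⟨ translate-cong (- x) ε-reflection n ⟨
  translate (- x) (dilate -1ℚ ε) n     ≡⟨ cong (λ y → translate y (dilate -1ℚ ε) n) (r x) ⟩
  translate (-1ℚ * x) (dilate -1ℚ ε) n ≡⟨ translate-dilate -1ℚ x ε n ⟩
  -1ℚ ^ n * translate x ε n            ≡⟨ cong (-1ℚ ^ n *_) (eulerPoly-translate n x) ⟨
  -1ℚ ^ n * eulerPoly n x              ∎
  where
  r : ∀ x → - x ≡ - 1ℚ * x
  r = solve-∀ ℚ-ring

eulerPoly-½ : ∀ n → eulerPoly n ½ ≡ ½ ^ n * eulerℚ n
eulerPoly-½ n = trans (appell-sum eulerHalf 0ℚ n) (trans (translate-0 eulerHalf n) (eulerHalf-dilate n))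

-- From (1 - e^t + e^(2t))(1 + e^t) = 1 + e^(3t), whose right side cancels the denominator of ε(3t).
ε-multiplication : dilate (fromℕ 3) ε ⊞ -1ℚ ⊡ translate 1ℚ (dilate (fromℕ 3) ε) ⊞ translate (fromℕ 2) (dilate (fromℕ 3) ε) ≗ ε
ε-multiplication = translate-unique₊ 1ℚ _ ε (λ n → trans (lem n) (sym (ε-difference n)))
  where
  δ = dilate (fromℕ 3) ε
  lem : ∀ n → translate 1ℚ (δ ⊞ -1ℚ ⊡ translate 1ℚ δ ⊞ translate (fromℕ 2) δ) n +
              (δ n + -1ℚ * translate 1ℚ δ n + translate (fromℕ 2) δ n) ≡ fromℕ 2 * 0ℚ ^ n
  lem n = begin
    translate 1ℚ (δ ⊞ -1ℚ ⊡ translate 1ℚ δ ⊞ translate (fromℕ 2) δ) n +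
      (δ n + -1ℚ * translate 1ℚ δ n + translate (fromℕ 2) δ n)
      ≡⟨ cong (_+ (δ n + -1ℚ * translate 1ℚ δ n + translate (fromℕ 2) δ n)) (begin
           translate 1ℚ (δ ⊞ -1ℚ ⊡ translate 1ℚ δ ⊞ translate (fromℕ 2) δ) n
             ≡⟨ trans (translate-⊞ 1ℚ (δ ⊞ -1ℚ ⊡ translate 1ℚ δ) (translate (fromℕ 2) δ) n)
                  (cong (_+ translate 1ℚ (translate (fromℕ 2) δ) n) (translate-⊞ 1ℚ δ (-1ℚ ⊡ translate 1ℚ δ) n)) ⟩
           translate 1ℚ δ n + translate 1ℚ (-1ℚ ⊡ translate 1ℚ δ) n + translate 1ℚ (translate (fromℕ 2) δ) n
             ≡⟨ cong₂ (λ u v → translate 1ℚ δ n + u + v)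
                  (trans (translate-⊡ 1ℚ -1ℚ (translate 1ℚ δ) n) (cong (-1ℚ *_) (translate-translate 1ℚ 1ℚ δ n)))
                  (translate-translate (fromℕ 2) 1ℚ δ n) ⟩
           translate 1ℚ δ n + -1ℚ * translate (fromℕ 2) δ n + translate (fromℕ 3) δ n ∎) ⟩
    (translate 1ℚ δ n + -1ℚ * translate (fromℕ 2) δ n + translate (fromℕ 3) δ n) +
      (δ n + -1ℚ * translate 1ℚ δ n + translate (fromℕ 2) δ n)
      ≡⟨ r (δ n) (translate 1ℚ δ n) (translate (fromℕ 2) δ n) (translate (fromℕ 3) δ n) ⟩
    translate (fromℕ 3) δ n + δ n
      ≡⟨ cong (_+ δ n) (translate-dilate (fromℕ 3) 1ℚ ε n) ⟩
    fromℕ 3 ^ n * translate 1ℚ ε n + fromℕ 3 ^ n * ε n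
      ≡⟨ dilate-⊞ (fromℕ 3) (translate 1ℚ ε) ε n ⟨
    fromℕ 3 ^ n * (translate 1ℚ ε n + ε n)
      ≡⟨ dilate-2·0^ (fromℕ 3) ε-difference n ⟩
    fromℕ 2 * 0ℚ ^ n ∎
    where
    r : ∀ a b c d → (b + - 1ℚ * c + d) + (a + - 1ℚ * b + c) ≡ d + a
    r = solve-∀ ℚ-ring

eulerPoly-multiplication : ∀ n x → eulerPoly n (fromℕ 3 * x) ≡
  fromℕ 3 ^ n * (eulerPoly n x - eulerPoly n (x + + 1 / 3) + eulerPoly n (x + + 2 / 3))
eulerPoly-multiplication n x = begin
  eulerPoly n (fromℕ 3 * x)
    ≡⟨ eulerPoly-translate n (fromℕ 3 * x) ⟩
  translate (fromℕ 3 * x) ε n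
    ≡⟨ translate-cong (fromℕ 3 * x) ε-multiplication n ⟨
  translate (fromℕ 3 * x) (δ ⊞ -1ℚ ⊡ translate 1ℚ δ ⊞ translate (fromℕ 2) δ) n
    ≡⟨ trans (translate-⊞ (fromℕ 3 * x) (δ ⊞ -1ℚ ⊡ translate 1ℚ δ) (translate (fromℕ 2) δ) n)
         (cong (_+ translate (fromℕ 3 * x) (translate (fromℕ 2) δ) n)
           (trans (translate-⊞ (fromℕ 3 * x) δ (-1ℚ ⊡ translate 1ℚ δ) n)
                  (cong (_+_ (translate (fromℕ 3 * x) δ n)) (translate-⊡ (fromℕ 3 * x) -1ℚ (translate 1ℚ δ) n)))) ⟩
  translate (fromℕ 3 * x) δ n + -1ℚ * translate (fromℕ 3 * x) (translate 1ℚ δ) n + translate (fromℕ 3 * x) (translate (fromℕ 2) δ) n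
    ≡⟨ cong₂ _+_ (cong₂ (λ u v → u + -1ℚ * v) (translate-dilate (fromℕ 3) x ε n) (at (+ 1 / 3))) (at (+ 2 / 3)) ⟩
  fromℕ 3 ^ n * translate x ε n + -1ℚ * (fromℕ 3 ^ n * translate (x + + 1 / 3) ε n) + fromℕ 3 ^ n * translate (x + + 2 / 3) ε n
    ≡⟨ r (fromℕ 3 ^ n) (translate x ε n) (translate (x + + 1 / 3) ε n) (translate (x + + 2 / 3) ε n) ⟩
  fromℕ 3 ^ n * (translate x ε n - translate (x + + 1 / 3) ε n + translate (x + + 2 / 3) ε n)
    ≡⟨ cong (fromℕ 3 ^ n *_) (cong₂ _+_ (cong₂ _-_ (eulerPoly-translate n x) (eulerPoly-translate n (x + + 1 / 3))) (eulerPoly-translate n (x + + 2 / 3))) ⟨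
  fromℕ 3 ^ n * (eulerPoly n x - eulerPoly n (x + + 1 / 3) + eulerPoly n (x + + 2 / 3)) ∎
  where
  δ = dilate (fromℕ 3) ε
  at : ∀ y → translate (fromℕ 3 * x) (translate (fromℕ 3 * y) δ) n ≡ fromℕ 3 ^ n * translate (x + y) ε n
  at y = trans (translate-translate (fromℕ 3 * y) (fromℕ 3 * x) δ n)
           (trans (cong (λ z → translate z δ n) (trans (sym (ℚₚ.*-distribˡ-+ (fromℕ 3) y x)) (cong (fromℕ 3 *_) (ℚₚ.+-comm y x))))
                  (translate-dilate (fromℕ 3) (x + y) ε n))
  r : ∀ t a b c → t * a + - 1ℚ * (t * b) + t * c ≡ t * (a - b + c)
  r = solve-∀ ℚ-ring

-- Triplication at x = 1/6 involves 3x = 1/2, x + 1/3 = 1/2 and x + 2/3 = 5/6, and reflection takes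
-- 5/6 back to 1/6 for even n.
eulerPoly-1/6 : ∀ n → -1ℚ ^ n ≡ 1ℚ →
  fromℕ 3 ^ n * (fromℕ 2 * eulerPoly n (+ 1 / 6)) ≡ (1ℚ + fromℕ 3 ^ n) * eulerPoly n ½
eulerPoly-1/6 n even = begin
  fromℕ 3 ^ n * (fromℕ 2 * e)                       ≡⟨ r (fromℕ 3 ^ n) e f ⟩
  fromℕ 3 ^ n * (e - f + e) + fromℕ 3 ^ n * f       ≡⟨ cong (λ u → fromℕ 3 ^ n * (e - f + u) + fromℕ 3 ^ n * f) refl-5/6 ⟨
  fromℕ 3 ^ n * (e - f + eulerPoly n (+ 5 / 6)) + fromℕ 3 ^ n * f
                                                    ≡⟨ cong (_+ fromℕ 3 ^ n * f) (eulerPoly-multiplication n (+ 1 / 6)) ⟨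
  f + fromℕ 3 ^ n * f                               ≡⟨ r′ (fromℕ 3 ^ n) f ⟩
  (1ℚ + fromℕ 3 ^ n) * f                            ∎
  where
  e = eulerPoly n (+ 1 / 6)
  f = eulerPoly n ½
  refl-5/6 : eulerPoly n (+ 5 / 6) ≡ e
  refl-5/6 = trans (eulerPoly-reflection n (+ 1 / 6)) (trans (cong (_* e) even) (ℚₚ.*-identityˡ e))
  r : ∀ t e f → t * (fromℕ 2 * e) ≡ t * (e - f + e) + t * f
  r = solve-∀ ℚ-ring
  r′ : ∀ t f → f + t * f ≡ (1ℚ + t) * f
  r′ = solve-∀ ℚ-ring

e₁ : Seq
e₁ = derive (powers 0ℚ)

-- Both e^t B(t) and B(-t) become t e^t after multiplication by e^t - 1.
bernoulli-reflection : translate 1ℚ bernoulli ≗ dilate -1ℚ bernoulli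
bernoulli-reflection = translate-unique₋ (translate 1ℚ bernoulli) (dilate -1ℚ bernoulli) (λ n → trans (lhs n) (sym (rhs n)))
  where
  lhs : ∀ n → translate 1ℚ (translate 1ℚ bernoulli) n - translate 1ℚ bernoulli n ≡ derive (powers 1ℚ) n
  lhs n = begin
    translate 1ℚ (translate 1ℚ bernoulli) n - translate 1ℚ bernoulli n
      ≡⟨ cong (_- translate 1ℚ bernoulli n) (trans (translate-cong 1ℚ bernoulli-difference n) (translate-⊞ 1ℚ bernoulli e₁ n)) ⟩
    (translate 1ℚ bernoulli n + translate 1ℚ e₁ n) - translate 1ℚ bernoulli n
      ≡⟨ r (translate 1ℚ bernoulli n) (translate 1ℚ e₁ n) ⟩
    translate 1ℚ e₁ n
      ≡⟨ trans (translate-derive 1ℚ (powers 0ℚ) n) (derive-cong (translate-powers 0ℚ 1ℚ) n) ⟩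
    derive (powers 1ℚ) n ∎
    where
    r : ∀ a b → (a + b) - a ≡ b
    r = solve-∀ ℚ-ring
  signs : ∀ n → -1ℚ ^ n * - derive (powers -1ℚ) n ≡ derive (powers 1ℚ) n
  signs zero    = refl
  signs (suc n) = begin
    (-1ℚ * -1ℚ ^ n) * - (fromℕ (suc n) * -1ℚ ^ n)   ≡⟨ r (fromℕ (suc n)) (-1ℚ ^ n) ⟩
    fromℕ (suc n) * (-1ℚ ^ n * -1ℚ ^ n)             ≡⟨ cong (fromℕ (suc n) *_) (^-distrib-* -1ℚ -1ℚ n) ⟨
    fromℕ (suc n) * 1ℚ ^ n                          ∎
    where
    r : ∀ m s → (- 1ℚ * s) * - (m * s) ≡ m * (s * s)
    r = solve-∀ ℚ-ring
  rhs : ∀ n → translate 1ℚ (dilate -1ℚ bernoulli) n - dilate -1ℚ bernoulli n ≡ derive (powers 1ℚ) n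
  rhs n = begin
    translate 1ℚ (dilate -1ℚ bernoulli) n - dilate -1ℚ bernoulli n
      ≡⟨ cong (_- dilate -1ℚ bernoulli n) (translate-dilate -1ℚ -1ℚ bernoulli n) ⟩
    -1ℚ ^ n * translate -1ℚ bernoulli n - -1ℚ ^ n * bernoulli n
      ≡⟨ cong (λ b → -1ℚ ^ n * translate -1ℚ bernoulli n - -1ℚ ^ n * b) B≡ ⟩
    -1ℚ ^ n * translate -1ℚ bernoulli n - -1ℚ ^ n * (translate -1ℚ bernoulli n + derive (powers -1ℚ) n)
      ≡⟨ r (-1ℚ ^ n) (translate -1ℚ bernoulli n) (derive (powers -1ℚ) n) ⟩
    -1ℚ ^ n * - derive (powers -1ℚ) n
      ≡⟨ signs n ⟩
    derive (powers 1ℚ) n ∎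
    where
    B≡ : bernoulli n ≡ translate -1ℚ bernoulli n + derive (powers -1ℚ) n
    B≡ = begin
      bernoulli n                                            ≡⟨ translate-0 bernoulli n ⟨
      translate 0ℚ bernoulli n                               ≡⟨ translate-translate 1ℚ -1ℚ bernoulli n ⟨
      translate -1ℚ (translate 1ℚ bernoulli) n               ≡⟨ translate-cong -1ℚ bernoulli-difference n ⟩
      translate -1ℚ (bernoulli ⊞ e₁) n                       ≡⟨ translate-⊞ -1ℚ bernoulli e₁ n ⟩
      translate -1ℚ bernoulli n + translate -1ℚ e₁ n         ≡⟨ cong (_+_ (translate -1ℚ bernoulli n)) (trans
                                                                  (translate-derive -1ℚ (powers 0ℚ) n)
                                                                  (derive-cong (translate-powers 0ℚ -1ℚ) n)) ⟩
      translate -1ℚ bernoulli n + derive (powers -1ℚ) n      ∎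
    r : ∀ s a b → s * a - s * (a + b) ≡ s * - b
    r = solve-∀ ℚ-ring

dilate-e₁ : ∀ c → dilate c e₁ ≗ c ⊡ e₁
dilate-e₁ c zero          = r c
  where
  r : ∀ c → 1ℚ * 0ℚ ≡ c * 0ℚ
  r = solve-∀ ℚ-ring
dilate-e₁ c (suc zero)    = r c
  where
  r : ∀ c → (c * 1ℚ) * (1ℚ * 1ℚ) ≡ c * (1ℚ * 1ℚ)
  r = solve-∀ ℚ-ring
dilate-e₁ c (suc (suc n)) = r c (c ^ suc n) (fromℕ (suc (suc n))) (0ℚ ^ n)
  where
  r : ∀ c d m z → (c * d) * (m * (0ℚ * z)) ≡ c * (m * (0ℚ * z))
  r = solve-∀ ℚ-ring

-- As series, 2B(t) = (1 + e^t) B(2t), because e^(2t) - 1 = (e^t - 1)(e^t + 1).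
bernoulli-duplication : fromℕ 2 ⊡ bernoulli ≗ dilate (fromℕ 2) bernoulli ⊞ translate 1ℚ (dilate (fromℕ 2) bernoulli)
bernoulli-duplication = translate-unique₋ _ _ (λ n → trans (lhs n) (sym (rhs n)))
  where
  δ = dilate (fromℕ 2) bernoulli
  lhs : ∀ n → translate 1ℚ (fromℕ 2 ⊡ bernoulli) n - fromℕ 2 * bernoulli n ≡ fromℕ 2 * e₁ n
  lhs n = trans (cong (_- fromℕ 2 * bernoulli n)
                  (trans (translate-⊡ 1ℚ (fromℕ 2) bernoulli n) (cong (fromℕ 2 *_) (bernoulli-difference n))))
                (r (bernoulli n) (e₁ n))
    where
    r : ∀ b e → fromℕ 2 * (b + e) - fromℕ 2 * b ≡ fromℕ 2 * e
    r = solve-∀ ℚ-ring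
  rhs : ∀ n → translate 1ℚ (δ ⊞ translate 1ℚ δ) n - (δ n + translate 1ℚ δ n) ≡ fromℕ 2 * e₁ n
  rhs n = begin
    translate 1ℚ (δ ⊞ translate 1ℚ δ) n - (δ n + translate 1ℚ δ n)
      ≡⟨ cong (_- (δ n + translate 1ℚ δ n)) (trans (translate-⊞ 1ℚ δ (translate 1ℚ δ) n)
           (cong (_+_ (translate 1ℚ δ n)) (trans (translate-translate 1ℚ 1ℚ δ n)
             (trans (translate-dilate (fromℕ 2) 1ℚ bernoulli n) (cong (fromℕ 2 ^ n *_) (bernoulli-difference n)))))) ⟩
    (translate 1ℚ δ n + fromℕ 2 ^ n * (bernoulli n + e₁ n)) - (δ n + translate 1ℚ δ n)
      ≡⟨ r (translate 1ℚ δ n) (fromℕ 2 ^ n) (bernoulli n) (e₁ n) ⟩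
    fromℕ 2 ^ n * e₁ n
      ≡⟨ dilate-e₁ (fromℕ 2) n ⟩
    fromℕ 2 * e₁ n ∎
    where
    r : ∀ t s b e → (t + s * (b + e)) - (s * b + t) ≡ s * e
    r = solve-∀ ℚ-ring

-- As series, 2t/(e^t + 1) = 2(B(t) - B(2t)); in degree n + 1 this expresses (n + 1) Eₙ(x) through
-- Bₙ₊₁(x) and Bₙ₊₁(x/2).
derive-ε : derive ε ≗ fromℕ 2 ⊡ (bernoulli ⊞ -1ℚ ⊡ dilate (fromℕ 2) bernoulli)
derive-ε = translate-unique₊ 1ℚ (derive ε) (fromℕ 2 ⊡ (bernoulli ⊞ -1ℚ ⊡ δ)) (λ n → trans (lhs n) (sym (rhs n)))
  where
  δ = dilate (fromℕ 2) bernoulli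
  lhs : ∀ n → translate 1ℚ (derive ε) n + derive ε n ≡ fromℕ 2 * e₁ n
  lhs n = trans (cong (_+ derive ε n) (translate-derive 1ℚ ε n)) (lem n)
    where
    lem : ∀ n → derive (translate 1ℚ ε) n + derive ε n ≡ fromℕ 2 * e₁ n
    lem zero    = refl
    lem (suc n) = begin
      fromℕ (suc n) * translate 1ℚ ε n + fromℕ (suc n) * ε n  ≡⟨ ℚₚ.*-distribˡ-+ (fromℕ (suc n)) (translate 1ℚ ε n) (ε n) ⟨
      fromℕ (suc n) * (translate 1ℚ ε n + ε n)                ≡⟨ cong (fromℕ (suc n) *_) (ε-difference n) ⟩
      fromℕ (suc n) * (fromℕ 2 * 0ℚ ^ n)                      ≡⟨ r (fromℕ (suc n)) (0ℚ ^ n) ⟩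
      fromℕ 2 * (fromℕ (suc n) * 0ℚ ^ n)                      ∎
      where
      r : ∀ m z → m * (fromℕ 2 * z) ≡ fromℕ 2 * (m * z)
      r = solve-∀ ℚ-ring
  rhs : ∀ n → translate 1ℚ (fromℕ 2 ⊡ (bernoulli ⊞ -1ℚ ⊡ δ)) n + fromℕ 2 * (bernoulli n + -1ℚ * δ n) ≡ fromℕ 2 * e₁ n
  rhs n = begin
    translate 1ℚ (fromℕ 2 ⊡ (bernoulli ⊞ -1ℚ ⊡ δ)) n + fromℕ 2 * (bernoulli n + -1ℚ * δ n)
      ≡⟨ cong (_+ fromℕ 2 * (bernoulli n + -1ℚ * δ n)) (trans (translate-⊡ 1ℚ (fromℕ 2) (bernoulli ⊞ -1ℚ ⊡ δ) n)
           (cong (fromℕ 2 *_) (trans (translate-⊞ 1ℚ bernoulli (-1ℚ ⊡ δ) n)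
             (cong₂ _+_ (bernoulli-difference n) (translate-⊡ 1ℚ -1ℚ δ n))))) ⟩
    fromℕ 2 * ((bernoulli n + e₁ n) + -1ℚ * translate 1ℚ δ n) + fromℕ 2 * (bernoulli n + -1ℚ * δ n)
      ≡⟨ r (bernoulli n) (e₁ n) (translate 1ℚ δ n) (δ n) ⟩
    fromℕ 2 * e₁ n + fromℕ 2 * (fromℕ 2 * bernoulli n - (δ n + translate 1ℚ δ n))
      ≡⟨ cong (λ s → fromℕ 2 * e₁ n + fromℕ 2 * (s - (δ n + translate 1ℚ δ n))) (bernoulli-duplication n) ⟩
    fromℕ 2 * e₁ n + fromℕ 2 * ((δ n + translate 1ℚ δ n) - (δ n + translate 1ℚ δ n))
      ≡⟨ r′ (e₁ n) (δ n + translate 1ℚ δ n) ⟩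
    fromℕ 2 * e₁ n ∎
    where
    r : ∀ b e t d → fromℕ 2 * ((b + e) + - 1ℚ * t) + fromℕ 2 * (b + - 1ℚ * d) ≡ fromℕ 2 * e + fromℕ 2 * (fromℕ 2 * b - (d + t))
    r = solve-∀ ℚ-ring
    r′ : ∀ e s → fromℕ 2 * e + fromℕ 2 * (s - s) ≡ fromℕ 2 * e
    r′ = solve-∀ ℚ-ring

-- `derive-ε` at 1/3 brings in Bₙ₊₁(1/6). Duplication trades this for Bₙ₊₁(1/3) and Bₙ₊₁(2/3), and
-- the latter is -Bₙ₊₁(1/3) because n + 1 is odd.
eulerPoly-1/3 : ∀ n → -1ℚ ^ n ≡ 1ℚ →
  fromℕ (suc n) * eulerPoly n (+ 1 / 3) ≡ - (fromℕ 2 * (fromℕ 2 ^ suc n + 1ℚ) * bernoulliPoly (suc n) (+ 1 / 3))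
eulerPoly-1/3 n even = begin
  fromℕ N * eulerPoly n (+ 1 / 3)
    ≡⟨ cong (fromℕ N *_) (eulerPoly-translate n (+ 1 / 3)) ⟩
  derive (translate (+ 1 / 3) ε) N
    ≡⟨ translate-derive (+ 1 / 3) ε N ⟨
  translate (+ 1 / 3) (derive ε) N
    ≡⟨ translate-cong (+ 1 / 3) derive-ε N ⟩
  translate (+ 1 / 3) (fromℕ 2 ⊡ (bernoulli ⊞ -1ℚ ⊡ δ)) N
    ≡⟨ trans (translate-⊡ (+ 1 / 3) (fromℕ 2) (bernoulli ⊞ -1ℚ ⊡ δ) N)
         (cong (fromℕ 2 *_) (trans (translate-⊞ (+ 1 / 3) bernoulli (-1ℚ ⊡ δ) N)
           (cong (_+_ b) (translate-⊡ (+ 1 / 3) -1ℚ δ N)))) ⟩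
  fromℕ 2 * (b + -1ℚ * translate (+ 1 / 3) δ N)
    ≡⟨ r b (translate (+ 1 / 3) δ N) (fromℕ 2 ^ N) ⟩
  fromℕ 2 * (b + -1ℚ * ((translate (+ 1 / 3) δ N + fromℕ 2 ^ N * - b) + fromℕ 2 ^ N * b))
    ≡⟨ cong (λ s → fromℕ 2 * (b + -1ℚ * (s + fromℕ 2 ^ N * b))) dup ⟨
  fromℕ 2 * (b + -1ℚ * (fromℕ 2 * b + fromℕ 2 ^ N * b))
    ≡⟨ r′ b (fromℕ 2 ^ N) ⟩
  - (fromℕ 2 * (fromℕ 2 ^ N + 1ℚ) * b)
    ≡⟨ cong (λ x → - (fromℕ 2 * (fromℕ 2 ^ N + 1ℚ) * x)) (bernoulliPoly-translate N (+ 1 / 3)) ⟨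
  - (fromℕ 2 * (fromℕ 2 ^ N + 1ℚ) * bernoulliPoly N (+ 1 / 3)) ∎
  where
  N = suc n
  δ = dilate (fromℕ 2) bernoulli
  b = translate (+ 1 / 3) bernoulli N

  b-2/3 : translate (+ 2 / 3) bernoulli N ≡ - b
  b-2/3 = begin
    translate (+ 2 / 3) bernoulli N                       ≡⟨ translate-translate 1ℚ (- (+ 1 / 3)) bernoulli N ⟨
    translate (- (+ 1 / 3)) (translate 1ℚ bernoulli) N    ≡⟨ translate-cong (- (+ 1 / 3)) bernoulli-reflection N ⟩
    translate (-1ℚ * (+ 1 / 3)) (dilate -1ℚ bernoulli) N  ≡⟨ translate-dilate -1ℚ (+ 1 / 3) bernoulli N ⟩
    (-1ℚ * -1ℚ ^ n) * b                                   ≡⟨ cong (λ s → (-1ℚ * s) * b) even ⟩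
    (-1ℚ * 1ℚ) * b                                        ≡⟨ r b ⟩
    - b                                                   ∎
    where
    r : ∀ x → (- 1ℚ * 1ℚ) * x ≡ - x
    r = solve-∀ ℚ-ring

  -- Translating `δ` by 4/3 gives 2ᴺ times the Bernoulli polynomial at half of 4/3, that is at 2/3.
  dup : fromℕ 2 * b ≡ translate (+ 1 / 3) δ N + fromℕ 2 ^ N * - b
  dup = begin
    fromℕ 2 * b                                                   ≡⟨ translate-⊡ (+ 1 / 3) (fromℕ 2) bernoulli N ⟨
    translate (+ 1 / 3) (fromℕ 2 ⊡ bernoulli) N                   ≡⟨ translate-cong (+ 1 / 3) bernoulli-duplication N ⟩
    translate (+ 1 / 3) (δ ⊞ translate 1ℚ δ) N                    ≡⟨ translate-⊞ (+ 1 / 3) δ (translate 1ℚ δ) N ⟩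
    translate (+ 1 / 3) δ N + translate (+ 1 / 3) (translate 1ℚ δ) N
      ≡⟨ cong (_+_ (translate (+ 1 / 3) δ N)) (begin
           translate (+ 1 / 3) (translate 1ℚ δ) N   ≡⟨ translate-translate 1ℚ (+ 1 / 3) δ N ⟩
           translate (+ 4 / 3) δ N                  ≡⟨ translate-dilate (fromℕ 2) (+ 2 / 3) bernoulli N ⟩
           fromℕ 2 ^ N * translate (+ 2 / 3) bernoulli N ≡⟨ cong (fromℕ 2 ^ N *_) b-2/3 ⟩
           fromℕ 2 ^ N * - b                        ∎) ⟩
    translate (+ 1 / 3) δ N + fromℕ 2 ^ N * - b ∎

  r : ∀ b t s → fromℕ 2 * (b + - 1ℚ * t) ≡ fromℕ 2 * (b + - 1ℚ * ((t + s * - b) + s * b))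
  r = solve-∀ ℚ-ring
  r′ : ∀ b s → fromℕ 2 * (b + - 1ℚ * (fromℕ 2 * b + s * b)) ≡ - (fromℕ 2 * (s + 1ℚ) * b)
  r′ = solve-∀ ℚ-ring

-- The polynomials tₖ(x) = ∏_{1 ≤ j ≤ k} (j − 1 − x)(x + j)/j² = (−1)ᵏ C(x,k) C(x+k,k)

q : ℕ → ℚ
q k = 1ℤ / (suc k ℕ.* suc k)

q-inverse : ∀ k → q k * ((fromℕ k + 1ℚ) * (fromℕ k + 1ℚ)) ≡ 1ℚ
q-inverse k = trans (cong (q k *_) (trans (cong₂ _*_ (sym (fromℕ-suc k)) (sym (fromℕ-suc k))) (sym (fromℕ-* (suc k) (suc k)))))
                    (/-*-cancel 1ℤ (suc k ℕ.* suc k))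

H-suc : ∀ k → H⁽²⁾ (suc k) ≡ H⁽²⁾ k + q k
H-suc k = sumBelow-suc k q

t : ℕ → ℚ → ℚ
t zero    x = 1ℚ
t (suc k) x = t k x * ((fromℕ k - x) * (x + (fromℕ k + 1ℚ))) * q k

t-reflection : ∀ k x → t k (- 1ℚ - x) ≡ t k x
t-reflection zero    x = refl
t-reflection (suc k) x = trans (cong (λ u → u * ((fromℕ k - (- 1ℚ - x)) * ((- 1ℚ - x) + (fromℕ k + 1ℚ))) * q k) (t-reflection k x))
                               (r (t k x) (fromℕ k) x (q k))
  where
  r : ∀ u k x q → u * ((k - (- 1ℚ - x)) * ((- 1ℚ - x) + (k + 1ℚ))) * q ≡ u * ((k - x) * (x + (k + 1ℚ))) * q
  r = solve-∀ ℚ-ring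

w : ℕ → ℚ → ℚ
w zero    x = 1ℚ
w (suc k) x = w k x * (1ℚ - x * x * q k)

-- In the product defining t the factors j - x and j + x with 1 ≤ j ≤ k pair up to j² - x², which is
-- `w`; the factors -x and x + k + 1 are left over.
t≡w : ∀ k x → t (suc k) x ≡ - (w k x * (x * (x + (fromℕ k + 1ℚ))) * q k)
t≡w zero    x = r x (q 0)
  where
  r : ∀ x q → 1ℚ * ((0ℚ - x) * (x + (0ℚ + 1ℚ))) * q ≡ - (1ℚ * (x * (x + (0ℚ + 1ℚ))) * q)
  r = solve-∀ ℚ-ring
t≡w (suc k) x = begin
  t (suc k) x * ((fromℕ (suc k) - x) * (x + (fromℕ (suc k) + 1ℚ))) * q (suc k)
    ≡⟨ cong₂ (λ u m → u * ((m - x) * (x + (fromℕ (suc k) + 1ℚ))) * q (suc k)) (t≡w k x) (fromℕ-suc k) ⟩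
  - (w k x * (x * (x + (fromℕ k + 1ℚ))) * q k) * (((fromℕ k + 1ℚ) - x) * (x + (fromℕ (suc k) + 1ℚ))) * q (suc k)
    ≡⟨ r (w k x) x (fromℕ k) (q k) (fromℕ (suc k)) (q (suc k)) ⟩
  - (w k x * (q k * ((fromℕ k + 1ℚ) * (fromℕ k + 1ℚ)) - x * x * q k) * (x * (x + (fromℕ (suc k) + 1ℚ))) * q (suc k))
    ≡⟨ cong (λ u → - (w k x * (u - x * x * q k) * (x * (x + (fromℕ (suc k) + 1ℚ))) * q (suc k))) (q-inverse k) ⟩
  - (w k x * (1ℚ - x * x * q k) * (x * (x + (fromℕ (suc k) + 1ℚ))) * q (suc k)) ∎
  where
  r : ∀ w x k q m q′ → - (w * (x * (x + (k + 1ℚ))) * q) * (((k + 1ℚ) - x) * (x + (m + 1ℚ))) * q′ ≡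
      - (w * (q * ((k + 1ℚ) * (k + 1ℚ)) - x * x * q) * (x * (x + (m + 1ℚ))) * q′)
  r = solve-∀ ℚ-ring

-- Reflection turns x - 1 into -x and `w` is even, so against `t≡w` only x + (k + 1) changes, into x
-- - (k + 1). The combinations of t(x) and t(x - 1) needed below therefore keep `w` as a common
-- factor.
t-pred≡w : ∀ k x → t (suc k) (x - 1ℚ) ≡ - (w k x * (x * (x - (fromℕ k + 1ℚ))) * q k)
t-pred≡w k x = begin
  t (suc k) (x - 1ℚ)                                   ≡⟨ cong (t (suc k)) (r x) ⟩
  t (suc k) (- 1ℚ - - x)                               ≡⟨ t-reflection (suc k) (- x) ⟩
  t (suc k) (- x)                                      ≡⟨ t≡w k (- x) ⟩
  - (w k (- x) * (- x * (- x + (fromℕ k + 1ℚ))) * q k) ≡⟨ cong (λ u → - (u * (- x * (- x + (fromℕ k + 1ℚ))) * q k)) (w-even k x) ⟩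
  - (w k x * (- x * (- x + (fromℕ k + 1ℚ))) * q k)     ≡⟨ r′ (w k x) x (fromℕ k) (q k) ⟩
  - (w k x * (x * (x - (fromℕ k + 1ℚ))) * q k)         ∎
  where
  r : ∀ x → x - 1ℚ ≡ - 1ℚ - - x
  r = solve-∀ ℚ-ring
  r′ : ∀ w x k q → - (w * (- x * (- x + (k + 1ℚ))) * q) ≡ - (w * (x * (x - (k + 1ℚ))) * q)
  r′ = solve-∀ ℚ-ring
  w-even : ∀ k x → w k (- x) ≡ w k x
  w-even zero    x = refl
  w-even (suc k) x = trans (cong (_* (1ℚ - - x * - x * q k)) (w-even k x)) (r″ (w k x) x (q k))
    where
    r″ : ∀ w x q → w * (1ℚ - - x * - x * q) ≡ w * (1ℚ - x * x * q)
    r″ = solve-∀ ℚ-ring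

-- Recurrences and symmetries of the sums S and U

S : ℕ → ℚ → ℚ
S n x = ∑[ k < n ] t k x * H⁽²⁾ k

-- The factor 2x + 1 makes U(x) − U(x − 1) equal to S(x) + S(x − 1).
U : ℕ → ℚ → ℚ
U n x = (fromℕ 2 * x + 1ℚ) * (∑[ k < n ] t k x * (1ℤ / suc (2 ℕ.* k)) * H⁽²⁾ k)

S-reflection : ∀ n x → S n (- 1ℚ - x) ≡ S n x
S-reflection n x = sumBelow-cong n (λ k _ → cong (_* H⁽²⁾ k) (t-reflection k x))

U-reflection : ∀ n x → U n (- 1ℚ - x) ≡ - U n x
U-reflection n x = trans
  (cong ((fromℕ 2 * (- 1ℚ - x) + 1ℚ) *_) (sumBelow-cong n (λ k _ → cong (λ u → u * (1ℤ / suc (2 ℕ.* k)) * H⁽²⁾ k) (t-reflection k x))))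
  (r x (∑[ k < n ] t k x * (1ℤ / suc (2 ℕ.* k)) * H⁽²⁾ k))
  where
  r : ∀ x s → (fromℕ 2 * (- 1ℚ - x) + 1ℚ) * s ≡ - ((fromℕ 2 * x + 1ℚ) * s)
  r = solve-∀ ℚ-ring

S-at-0 : ∀ n → S n 0ℚ ≡ 0ℚ
S-at-0 n = trans (sumBelow-cong n term) (trans (sumBelow-* n 0ℚ (λ _ → 0ℚ)) (ℚₚ.*-zeroˡ (sumBelow n (λ _ → 0ℚ))))
  where
  term : ∀ k → k ℕ.< n → t k 0ℚ * H⁽²⁾ k ≡ 0ℚ * 0ℚ
  term zero    _ = refl
  term (suc k) _ = trans (cong (_* H⁽²⁾ (suc k)) (t≡w k 0ℚ)) (r (w k 0ℚ) (fromℕ k) (q k) (H⁽²⁾ (suc k)))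
    where
    r : ∀ w k q h → - (w * (0ℚ * (0ℚ + (k + 1ℚ))) * q) * h ≡ 0ℚ * 0ℚ
    r = solve-∀ ℚ-ring

U-at-0 : ∀ n → U n 0ℚ ≡ 0ℚ
U-at-0 n = trans (cong (1ℚ *_) (trans (sumBelow-cong n term) (trans (sumBelow-* n 0ℚ (λ _ → 0ℚ)) (ℚₚ.*-zeroˡ (sumBelow n (λ _ → 0ℚ))))))
                 (ℚₚ.*-zeroʳ 1ℚ)
  where
  term : ∀ k → k ℕ.< n → t k 0ℚ * (1ℤ / suc (2 ℕ.* k)) * H⁽²⁾ k ≡ 0ℚ * 0ℚ
  term zero    _ = refl
  term (suc k) _ = trans (cong (λ u → u * (1ℤ / suc (2 ℕ.* suc k)) * H⁽²⁾ (suc k)) (t≡w k 0ℚ)) (r (w k 0ℚ) (fromℕ k) (q k) _ (H⁽²⁾ (suc k)))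
    where
    r : ∀ w k q i h → - (w * (0ℚ * (0ℚ + (k + 1ℚ))) * q) * i * h ≡ 0ℚ * 0ℚ
    r = solve-∀ ℚ-ring

U-at-−½ : ∀ n → U n (- ½) ≡ 0ℚ
U-at-−½ n = ℚₚ.*-zeroˡ (∑[ k < n ] t k (- ½) * (1ℤ / suc (2 ℕ.* k)) * H⁽²⁾ k)

-- By `t≡w` and `t-pred≡w`, tₖ₊₁(x) + tₖ₊₁(x - 1) = -2x² wₖ qₖ = 2(wₖ₊₁ - wₖ). Summation by parts
-- against H⁽²⁾ leaves ∑ wₖ qₖ, which telescopes again after multiplication by x².
S-recurrence : ∀ n x → x * x * (S (suc n) x + S (suc n) (x - 1ℚ)) ≡ fromℕ 2 * w n x * (1ℚ + x * x * H⁽²⁾ n) - fromℕ 2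
S-recurrence zero    x = r x
  where
  r : ∀ x → x * x * ((1ℚ * 0ℚ + 0ℚ) + (1ℚ * 0ℚ + 0ℚ)) ≡ fromℕ 2 * 1ℚ * (1ℚ + x * x * 0ℚ) - fromℕ 2
  r = solve-∀ ℚ-ring
S-recurrence (suc n) x = begin
  x * x * (S (suc (suc n)) x + S (suc (suc n)) (x - 1ℚ))
    ≡⟨ cong₂ (λ u v → x * x * (u + v)) (sumBelow-suc (suc n) (λ k → t k x * H⁽²⁾ k)) (sumBelow-suc (suc n) (λ k → t k (x - 1ℚ) * H⁽²⁾ k)) ⟩
  x * x * ((s + t (suc n) x * h′) + (s′ + t (suc n) (x - 1ℚ) * h′))
    ≡⟨ cong₂ (λ u v → x * x * ((s + u * h′) + (s′ + v * h′))) (t≡w n x) (t-pred≡w n x) ⟩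
  x * x * ((s + - (w n x * (x * (x + (fromℕ n + 1ℚ))) * q n) * h′) + (s′ + - (w n x * (x * (x - (fromℕ n + 1ℚ))) * q n) * h′))
    ≡⟨ r₁ x s s′ (w n x) (fromℕ n) (q n) h′ ⟩
  x * x * (s + s′) - fromℕ 2 * (x * x * x * x) * w n x * q n * h′
    ≡⟨ cong₂ (λ u v → u - fromℕ 2 * (x * x * x * x) * w n x * q n * v) (S-recurrence n x) (H-suc n) ⟩
  (fromℕ 2 * w n x * (1ℚ + x * x * h) - fromℕ 2) - fromℕ 2 * (x * x * x * x) * w n x * q n * (h + q n)
    ≡⟨ r₂ x (w n x) (q n) h ⟩
  fromℕ 2 * (w n x * (1ℚ - x * x * q n)) * (1ℚ + x * x * (h + q n)) - fromℕ 2
    ≡⟨ cong (λ v → fromℕ 2 * w (suc n) x * (1ℚ + x * x * v) - fromℕ 2) (H-suc n) ⟨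
  fromℕ 2 * w (suc n) x * (1ℚ + x * x * h′) - fromℕ 2 ∎
  where
  h = H⁽²⁾ n
  h′ = H⁽²⁾ (suc n)
  s = S (suc n) x
  s′ = S (suc n) (x - 1ℚ)
  r₁ : ∀ x s s′ w n q h → x * x * ((s + - (w * (x * (x + (n + 1ℚ))) * q) * h) + (s′ + - (w * (x * (x - (n + 1ℚ))) * q) * h)) ≡
       x * x * (s + s′) - fromℕ 2 * (x * x * x * x) * w * q * h
  r₁ = solve-∀ ℚ-ring
  r₂ : ∀ x w q h → (fromℕ 2 * w * (1ℚ + x * x * h) - fromℕ 2) - fromℕ 2 * (x * x * x * x) * w * q * (h + q) ≡
       fromℕ 2 * (w * (1ℚ - x * x * q)) * (1ℚ + x * x * (h + q)) - fromℕ 2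
  r₂ = solve-∀ ℚ-ring

1+2k-inverse : ∀ k → (1ℤ / suc (2 ℕ.* k)) * (fromℕ 2 * fromℕ k + 1ℚ) ≡ 1ℚ
1+2k-inverse k = trans (cong ((1ℤ / suc (2 ℕ.* k)) *_) (sym (trans (fromℕ-suc (2 ℕ.* k)) (cong (_+ 1ℚ) (fromℕ-* 2 k)))))
                       (/-*-cancel 1ℤ (suc (2 ℕ.* k)))

-- Holds term by term: with m = k + 1, (2x + 1)(x + m) - (2x - 1)(x - m) = 2x(2m + 1), so the
-- denominator cancels, and 2x = (x + m) + (x - m).
U-difference : ∀ n x → U n x - U n (x - 1ℚ) ≡ S n x + S n (x - 1ℚ)
U-difference n x = begin
  U n x - U n (x - 1ℚ)
    ≡⟨ r₀ (fromℕ 2 * x + 1ℚ) (fromℕ 2 * (x - 1ℚ) + 1ℚ) (sumBelow n f) (sumBelow n g) ⟩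
  (fromℕ 2 * x + 1ℚ) * sumBelow n f + - (fromℕ 2 * (x - 1ℚ) + 1ℚ) * sumBelow n g
    ≡⟨ cong₂ _+_ (sumBelow-* n (fromℕ 2 * x + 1ℚ) f) (sumBelow-* n (- (fromℕ 2 * (x - 1ℚ) + 1ℚ)) g) ⟨
  (∑[ k < n ] (fromℕ 2 * x + 1ℚ) * f k) + (∑[ k < n ] - (fromℕ 2 * (x - 1ℚ) + 1ℚ) * g k)
    ≡⟨ sumBelow-+ n (λ k → (fromℕ 2 * x + 1ℚ) * f k) (λ k → - (fromℕ 2 * (x - 1ℚ) + 1ℚ) * g k) ⟨
  (∑[ k < n ] (fromℕ 2 * x + 1ℚ) * f k + - (fromℕ 2 * (x - 1ℚ) + 1ℚ) * g k)
    ≡⟨ sumBelow-cong n (λ k _ → term k) ⟩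
  (∑[ k < n ] t k x * H⁽²⁾ k + t k (x - 1ℚ) * H⁽²⁾ k)
    ≡⟨ sumBelow-+ n (λ k → t k x * H⁽²⁾ k) (λ k → t k (x - 1ℚ) * H⁽²⁾ k) ⟩
  S n x + S n (x - 1ℚ) ∎
  where
  f g : ℕ → ℚ
  f k = t k x * (1ℤ / suc (2 ℕ.* k)) * H⁽²⁾ k
  g k = t k (x - 1ℚ) * (1ℤ / suc (2 ℕ.* k)) * H⁽²⁾ k
  r₀ : ∀ a b u v → a * u - b * v ≡ a * u + - b * v
  r₀ = solve-∀ ℚ-ring
  term : ∀ k → (fromℕ 2 * x + 1ℚ) * f k + - (fromℕ 2 * (x - 1ℚ) + 1ℚ) * g k ≡ t k x * H⁽²⁾ k + t k (x - 1ℚ) * H⁽²⁾ k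
  term zero    = r x
    where
    r : ∀ x → (fromℕ 2 * x + 1ℚ) * (1ℚ * 1ℚ * 0ℚ) + - (fromℕ 2 * (x - 1ℚ) + 1ℚ) * (1ℚ * 1ℚ * 0ℚ) ≡ 1ℚ * 0ℚ + 1ℚ * 0ℚ
    r = solve-∀ ℚ-ring
  term (suc k) = begin
    (fromℕ 2 * x + 1ℚ) * (t (suc k) x * i * h) + - (fromℕ 2 * (x - 1ℚ) + 1ℚ) * (t (suc k) (x - 1ℚ) * i * h)
      ≡⟨ cong₂ (λ u v → (fromℕ 2 * x + 1ℚ) * (u * i * h) + - (fromℕ 2 * (x - 1ℚ) + 1ℚ) * (v * i * h)) t≡ t′≡ ⟩
    (fromℕ 2 * x + 1ℚ) * (- (c * (x * (x + m)) * q k) * i * h) + - (fromℕ 2 * (x - 1ℚ) + 1ℚ) * (- (c * (x * (x - m)) * q k) * i * h)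
      ≡⟨ r₁ x m c (q k) i h ⟩
    - (c * (fromℕ 2 * x * x) * q k) * (i * (fromℕ 2 * m + 1ℚ)) * h
      ≡⟨ cong (λ u → - (c * (fromℕ 2 * x * x) * q k) * u * h) (1+2k-inverse (suc k)) ⟩
    - (c * (fromℕ 2 * x * x) * q k) * 1ℚ * h
      ≡⟨ r₂ x m c (q k) h ⟩
    - (c * (x * (x + m)) * q k) * h + - (c * (x * (x - m)) * q k) * h
      ≡⟨ cong₂ (λ u v → u * h + v * h) t≡ t′≡ ⟨
    t (suc k) x * h + t (suc k) (x - 1ℚ) * h ∎
    where
    i = 1ℤ / suc (2 ℕ.* suc k)
    h = H⁽²⁾ (suc k)
    c = w k x
    m = fromℕ (suc k)
    t≡ : t (suc k) x ≡ - (c * (x * (x + m)) * q k)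
    t≡ = trans (t≡w k x) (cong (λ m → - (c * (x * (x + m)) * q k)) (sym (fromℕ-suc k)))
    t′≡ : t (suc k) (x - 1ℚ) ≡ - (c * (x * (x - m)) * q k)
    t′≡ = trans (t-pred≡w k x) (cong (λ m → - (c * (x * (x - m)) * q k)) (sym (fromℕ-suc k)))
    r₁ : ∀ x m c q i h → (fromℕ 2 * x + 1ℚ) * (- (c * (x * (x + m)) * q) * i * h) + - (fromℕ 2 * (x - 1ℚ) + 1ℚ) * (- (c * (x * (x - m)) * q) * i * h) ≡
         - (c * (fromℕ 2 * x * x) * q) * (i * (fromℕ 2 * m + 1ℚ)) * h
    r₁ = solve-∀ ℚ-ring
    r₂ : ∀ x m c q h → - (c * (fromℕ 2 * x * x) * q) * 1ℚ * h ≡ - (c * (x * (x + m)) * q) * h + - (c * (x * (x - m)) * q) * h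
    r₂ = solve-∀ ℚ-ring

-- Products of binomial coefficients as values of tₖ

C-! : ∀ {n} m l → n ≡ m ℕ.+ l → (n C m) ℕ.* (m ! ℕ.* l !) ≡ n !
C-! {n} m l refl = begin
  (n C m) ℕ.* (m ! ℕ.* l !)          ≡⟨ cong (λ i → (n C m) ℕ.* (m ! ℕ.* i !)) (ℕₚ.m+n∸m≡n m l) ⟨
  (n C m) ℕ.* (m ! ℕ.* (n ∸ m) !)    ≡⟨ cong (ℕ._* (m ! ℕ.* (n ∸ m) !)) (nCk≡n!/k![n-k]! m≤n) ⟩
  _                                  ≡⟨ m/n*n≡m {{m !* (n ∸ m) !≢0}} (k![n∸k]!∣n! m≤n) ⟩
  n !                                ∎
  where m≤n = ℕₚ.m≤m+n m l

-- a = g/f, where the common factor ψ of the quotients of f and g cancels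
ratio-recurrence : ∀ (a f g c ψ : ℕ → ℕ) → (∀ k → a k ℕ.* f k ≡ g k) → (∀ k → NonZero (f k)) → (∀ k → NonZero (ψ k)) →
  (∀ k → f (suc k) ≡ f k ℕ.* (suc k ℕ.* suc k ℕ.* ψ k)) → (∀ k → g (suc k) ≡ g k ℕ.* (c k ℕ.* ψ k)) →
  ∀ k → a (suc k) ℕ.* (suc k ℕ.* suc k) ≡ a k ℕ.* c k
ratio-recurrence a f g c ψ af≡g f≢0 ψ≢0 f-suc g-suc k =
  ℕₚ.*-cancelʳ-≡ _ _ (f k ℕ.* ψ k) {{ℕₚ.m*n≢0 (f k) (ψ k) {{f≢0 k}} {{ψ≢0 k}}}} (begin
    a (suc k) ℕ.* (suc k ℕ.* suc k) ℕ.* (f k ℕ.* ψ k)     ≡⟨ r (a (suc k)) (suc k) (f k) (ψ k) ⟩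
    a (suc k) ℕ.* (f k ℕ.* (suc k ℕ.* suc k ℕ.* ψ k))     ≡⟨ cong (a (suc k) ℕ.*_) (f-suc k) ⟨
    a (suc k) ℕ.* f (suc k)                               ≡⟨ af≡g (suc k) ⟩
    g (suc k)                                             ≡⟨ g-suc k ⟩
    g k ℕ.* (c k ℕ.* ψ k)                                 ≡⟨ cong (ℕ._* (c k ℕ.* ψ k)) (af≡g k) ⟨
    a k ℕ.* f k ℕ.* (c k ℕ.* ψ k)                         ≡⟨ r′ (a k) (f k) (c k) (ψ k) ⟩
    a k ℕ.* c k ℕ.* (f k ℕ.* ψ k)                         ∎)
  where
  r : ∀ a m f ψ → a ℕ.* (m ℕ.* m) ℕ.* (f ℕ.* ψ) ≡ a ℕ.* (f ℕ.* (m ℕ.* m ℕ.* ψ))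
  r = ℕ-solve-∀
  r′ : ∀ a f c ψ → a ℕ.* f ℕ.* (c ℕ.* ψ) ≡ a ℕ.* c ℕ.* (f ℕ.* ψ)
  r′ = ℕ-solve-∀

-- The pattern is x = -i/m with i + j = m and d = e m². Then d(k - x)(x + k + 1) = e(mk + i)(mk +
-- j), and aₖ/dᵏ has the same term ratio as tₖ(x).
module _ (a : ℕ → ℕ) (e d m i j : ℕ) .{{_ : NonZero d}} (x : ℚ) (a-0 : a 0 ≡ 1)
  (a-suc : ∀ k → a (suc k) ℕ.* (suc k ℕ.* suc k) ≡ a k ℕ.* (e ℕ.* ((m ℕ.* k ℕ.+ i) ℕ.* (m ℕ.* k ℕ.+ j))))
  (factor : ∀ k → fromℕ e * ((fromℕ m * k + fromℕ i) * (fromℕ m * k + fromℕ j)) ≡ fromℕ d * ((k - x) * (x + (k + 1ℚ))))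
  where

  t-recurrence : ∀ k → fromℕ (a k) ≡ t k x * fromℕ d ^ k
  t-recurrence zero    = cong fromℕ a-0
  t-recurrence (suc k) = *-cancelʳ-fromℕ (suc k ℕ.* suc k) (begin
    fromℕ (a (suc k)) * fromℕ (suc k ℕ.* suc k)
      ≡⟨ trans (sym (fromℕ-* (a (suc k)) (suc k ℕ.* suc k))) (cong fromℕ (a-suc k)) ⟩
    fromℕ (a k ℕ.* (e ℕ.* ((m ℕ.* k ℕ.+ i) ℕ.* (m ℕ.* k ℕ.+ j))))
      ≡⟨ trans (fromℕ-* (a k) _) (cong₂ _*_ (t-recurrence k) cast) ⟩
    t k x * fromℕ d ^ k * (fromℕ e * ((fromℕ m * fromℕ k + fromℕ i) * (fromℕ m * fromℕ k + fromℕ j)))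
      ≡⟨ cong (t k x * fromℕ d ^ k *_) (factor (fromℕ k)) ⟩
    t k x * fromℕ d ^ k * (fromℕ d * ((fromℕ k - x) * (x + (fromℕ k + 1ℚ))))
      ≡⟨ r (t k x) (fromℕ d ^ k) (fromℕ d) ((fromℕ k - x) * (x + (fromℕ k + 1ℚ))) ⟩
    t k x * ((fromℕ k - x) * (x + (fromℕ k + 1ℚ))) * 1ℚ * (fromℕ d * fromℕ d ^ k)
      ≡⟨ cong (λ u → t k x * ((fromℕ k - x) * (x + (fromℕ k + 1ℚ))) * u * (fromℕ d * fromℕ d ^ k)) (/-*-cancel 1ℤ (suc k ℕ.* suc k)) ⟨
    t k x * ((fromℕ k - x) * (x + (fromℕ k + 1ℚ))) * (q k * fromℕ (suc k ℕ.* suc k)) * (fromℕ d * fromℕ d ^ k)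
      ≡⟨ r′ (t k x * ((fromℕ k - x) * (x + (fromℕ k + 1ℚ)))) (q k) (fromℕ (suc k ℕ.* suc k)) (fromℕ d * fromℕ d ^ k) ⟩
    t (suc k) x * (fromℕ d * fromℕ d ^ k) * fromℕ (suc k ℕ.* suc k) ∎)
    where
    cast : fromℕ (e ℕ.* ((m ℕ.* k ℕ.+ i) ℕ.* (m ℕ.* k ℕ.+ j))) ≡ fromℕ e * ((fromℕ m * fromℕ k + fromℕ i) * (fromℕ m * fromℕ k + fromℕ j))
    cast = trans (fromℕ-* e _) (cong (fromℕ e *_) (trans (fromℕ-* (m ℕ.* k ℕ.+ i) (m ℕ.* k ℕ.+ j)) (cong₂ _*_ (lin i) (lin j))))
      where
      lin : ∀ i → fromℕ (m ℕ.* k ℕ.+ i) ≡ fromℕ m * fromℕ k + fromℕ i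
      lin i = trans (fromℕ-+ (m ℕ.* k) i) (cong (_+ fromℕ i) (fromℕ-* m k))
    r : ∀ t D d c → t * D * (d * c) ≡ t * c * 1ℚ * (d * D)
    r = solve-∀ ℚ-ring
    r′ : ∀ t q m D → t * (q * m) * D ≡ t * q * D * m
    r′ = solve-∀ ℚ-ring

  t-quotient : ∀ k → + a k ÷ d ^ k ≡ t k x
  t-quotient k = *-cancelʳ-fromℕ (d ℕ.^ k) {{ℕₚ.m^n≢0 d k}} (begin
    (+ a k ÷ d ^ k) * fromℕ (d ℕ.^ k)   ≡⟨ /-*-cancel (+ a k) (d ℕ.^ k) {{ℕₚ.m^n≢0 d k}} ⟩
    fromℕ (a k)                         ≡⟨ t-recurrence k ⟩
    t k x * fromℕ d ^ k                 ≡⟨ cong (t k x *_) (fromℕ-^ d k) ⟨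
    t k x * fromℕ (d ℕ.^ k)             ∎)

  t-quotient-odd : ∀ k → + a k ÷ suc (2 ℕ.* k) · d ^ k ≡ t k x * (1ℤ / suc (2 ℕ.* k))
  t-quotient-odd k = *-cancelʳ-fromℕ (s ℕ.* d ℕ.^ k) {{s*dᵏ≢0}} (begin
    (+ a k ÷ s · d ^ k) * fromℕ (s ℕ.* d ℕ.^ k)               ≡⟨ /-*-cancel (+ a k) (s ℕ.* d ℕ.^ k) {{s*dᵏ≢0}} ⟩
    fromℕ (a k)                                               ≡⟨ t-recurrence k ⟩
    t k x * fromℕ d ^ k                                       ≡⟨ r (t k x) (fromℕ d ^ k) ⟩
    t k x * 1ℚ * fromℕ d ^ k                                  ≡⟨ cong (λ u → t k x * u * fromℕ d ^ k) (/-*-cancel 1ℤ s) ⟨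
    t k x * ((1ℤ / s) * fromℕ s) * fromℕ d ^ k                ≡⟨ r′ (t k x) (1ℤ / s) (fromℕ s) (fromℕ d ^ k) ⟩
    t k x * (1ℤ / s) * (fromℕ s * fromℕ d ^ k)                ≡⟨ cong (t k x * (1ℤ / s) *_) (trans (fromℕ-* s (d ℕ.^ k)) (cong (fromℕ s *_) (fromℕ-^ d k))) ⟨
    t k x * (1ℤ / s) * fromℕ (s ℕ.* d ℕ.^ k)                  ∎)
    where
    s = suc (2 ℕ.* k)
    s*dᵏ≢0 : NonZero (s ℕ.* d ℕ.^ k)
    s*dᵏ≢0 = ℕₚ.m*n≢0 s (d ℕ.^ k) {{it}} {{ℕₚ.m^n≢0 d k}}
    r : ∀ t D → t * D ≡ t * 1ℚ * D
    r = solve-∀ ℚ-ring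
    r′ : ∀ t i s D → t * (i * s) * D ≡ t * i * (s * D)
    r′ = solve-∀ ℚ-ring

  S≡sum : ∀ n → (∑[ k < n ] + a k ÷ d ^ k * H⁽²⁾ k) ≡ S n x
  S≡sum n = sumBelow-cong n (λ k _ → cong (_* H⁽²⁾ k) (t-quotient k))

  U≡sum : ∀ n → (fromℕ 2 * x + 1ℚ) * (∑[ k < n ] + a k ÷ suc (2 ℕ.* k) · d ^ k * H⁽²⁾ k) ≡ U n x
  U≡sum n = cong ((fromℕ 2 * x + 1ℚ) *_) (sumBelow-cong n (λ k _ → cong (_* H⁽²⁾ k) (t-quotient-odd k)))

[2+2k]! : ∀ k → (2 ℕ.* suc k) ! ≡ suc (suc (2 ℕ.* k)) ℕ.* (suc (2 ℕ.* k) ℕ.* (2 ℕ.* k) !)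
[2+2k]! k = cong _! (ℕₚ.*-suc 2 k)

[3+3k]! : ∀ k → (3 ℕ.* suc k) ! ≡ (3 ℕ.+ 3 ℕ.* k) ℕ.* ((2 ℕ.+ 3 ℕ.* k) ℕ.* ((1 ℕ.+ 3 ℕ.* k) ℕ.* (3 ℕ.* k) !))
[3+3k]! k = cong _! (ℕₚ.*-suc 3 k)

[4+4k]! : ∀ k → (4 ℕ.* suc k) ! ≡ (4 ℕ.+ 4 ℕ.* k) ℕ.* ((3 ℕ.+ 4 ℕ.* k) ℕ.* ((2 ℕ.+ 4 ℕ.* k) ℕ.* ((1 ℕ.+ 4 ℕ.* k) ℕ.* (4 ℕ.* k) !)))
[4+4k]! k = cong _! (ℕₚ.*-suc 4 k)

[6+6k]! : ∀ k → (6 ℕ.* suc k) ! ≡ (6 ℕ.+ 6 ℕ.* k) ℕ.* ((5 ℕ.+ 6 ℕ.* k) ℕ.* ((4 ℕ.+ 6 ℕ.* k) ℕ.*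
  ((3 ℕ.+ 6 ℕ.* k) ℕ.* ((2 ℕ.+ 6 ℕ.* k) ℕ.* ((1 ℕ.+ 6 ℕ.* k) ℕ.* (6 ℕ.* k) !)))))
[6+6k]! k = cong _! (ℕₚ.*-suc 6 k)

2k≡k+k : ∀ k → 2 ℕ.* k ≡ k ℕ.+ k
2k≡k+k = ℕ-solve-∀

-- The subscript r marks the point x = -1/r at which tₖ takes the value aₖ/dᵏ.
a₂ a₃ a₄ a₆ : ℕ → ℕ
a₂ k = (2 ℕ.* k C k) ℕ.^ 2
a₃ k = (2 ℕ.* k C k) ℕ.* (3 ℕ.* k C k)
a₄ k = (4 ℕ.* k C 2 ℕ.* k) ℕ.* (2 ℕ.* k C k)
a₆ k = (6 ℕ.* k C 3 ℕ.* k) ℕ.* (3 ℕ.* k C k)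

a₂-suc : ∀ k → a₂ (suc k) ℕ.* (suc k ℕ.* suc k) ≡ a₂ k ℕ.* (4 ℕ.* ((2 ℕ.* k ℕ.+ 1) ℕ.* (2 ℕ.* k ℕ.+ 1)))
a₂-suc = ratio-recurrence a₂ f g _ (λ k → suc k ℕ.* suc k) af≡g f≢0 (λ k → it)
  (λ k → f-suc k (k !)) (λ k → trans (cong (λ u → u ℕ.* u) ([2+2k]! k)) (g-suc k ((2 ℕ.* k) !)))
  where
  f g : ℕ → ℕ
  f k = (k ! ℕ.* k !) ℕ.* (k ! ℕ.* k !)
  g k = (2 ℕ.* k) ! ℕ.* (2 ℕ.* k) !
  f≢0 : ∀ k → NonZero (f k)
  f≢0 k = ℕₚ.m*n≢0 (k ! ℕ.* k !) (k ! ℕ.* k !) {{k !* k !≢0}} {{k !* k !≢0}}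
  af≡g : ∀ k → a₂ k ℕ.* f k ≡ g k
  af≡g k = trans (r (2 ℕ.* k C k) (k ! ℕ.* k !)) (cong₂ ℕ._*_ (C-! k k (2k≡k+k k)) (C-! k k (2k≡k+k k)))
    where
    r : ∀ c s → (c ℕ.* (c ℕ.* 1)) ℕ.* (s ℕ.* s) ≡ (c ℕ.* s) ℕ.* (c ℕ.* s)
    r = ℕ-solve-∀
  f-suc : ∀ k s → (suc k ℕ.* s ℕ.* (suc k ℕ.* s)) ℕ.* (suc k ℕ.* s ℕ.* (suc k ℕ.* s)) ≡
                  (s ℕ.* s) ℕ.* (s ℕ.* s) ℕ.* (suc k ℕ.* suc k ℕ.* (suc k ℕ.* suc k))
  f-suc = ℕ-solve-∀
  g-suc : ∀ k s → (suc (suc (2 ℕ.* k)) ℕ.* (suc (2 ℕ.* k) ℕ.* s)) ℕ.* (suc (suc (2 ℕ.* k)) ℕ.* (suc (2 ℕ.* k) ℕ.* s)) ≡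
                  s ℕ.* s ℕ.* (4 ℕ.* ((2 ℕ.* k ℕ.+ 1) ℕ.* (2 ℕ.* k ℕ.+ 1)) ℕ.* (suc k ℕ.* suc k))
  g-suc = ℕ-solve-∀

a₃-suc : ∀ k → a₃ (suc k) ℕ.* (suc k ℕ.* suc k) ≡ a₃ k ℕ.* (3 ℕ.* ((3 ℕ.* k ℕ.+ 1) ℕ.* (3 ℕ.* k ℕ.+ 2)))
a₃-suc = ratio-recurrence a₃ f (λ k → (3 ℕ.* k) !) _ suc af≡g f≢0 (λ k → it)
  (λ k → f-suc k (k !)) (λ k → trans ([3+3k]! k) (g-suc k ((3 ℕ.* k) !)))
  where
  f : ℕ → ℕ
  f k = k ! ℕ.* (k ! ℕ.* k !)
  f≢0 : ∀ k → NonZero (f k)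
  f≢0 k = ℕₚ.m*n≢0 (k !) (k ! ℕ.* k !) {{k !≢0}} {{k !* k !≢0}}
  af≡g : ∀ k → a₃ k ℕ.* f k ≡ (3 ℕ.* k) !
  af≡g k = trans (r (2 ℕ.* k C k) (3 ℕ.* k C k) (k !))
    (trans (cong (λ u → (3 ℕ.* k C k) ℕ.* (k ! ℕ.* u)) (C-! k k (2k≡k+k k))) (C-! k (2 ℕ.* k) refl))
    where
    r : ∀ c d s → c ℕ.* d ℕ.* (s ℕ.* (s ℕ.* s)) ≡ d ℕ.* (s ℕ.* (c ℕ.* (s ℕ.* s)))
    r = ℕ-solve-∀
  f-suc : ∀ k s → suc k ℕ.* s ℕ.* (suc k ℕ.* s ℕ.* (suc k ℕ.* s)) ≡ s ℕ.* (s ℕ.* s) ℕ.* (suc k ℕ.* suc k ℕ.* suc k)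
  f-suc = ℕ-solve-∀
  g-suc : ∀ k s → (3 ℕ.+ 3 ℕ.* k) ℕ.* ((2 ℕ.+ 3 ℕ.* k) ℕ.* ((1 ℕ.+ 3 ℕ.* k) ℕ.* s)) ≡
                  s ℕ.* (3 ℕ.* ((3 ℕ.* k ℕ.+ 1) ℕ.* (3 ℕ.* k ℕ.+ 2)) ℕ.* suc k)
  g-suc = ℕ-solve-∀

a₄-suc : ∀ k → a₄ (suc k) ℕ.* (suc k ℕ.* suc k) ≡ a₄ k ℕ.* (4 ℕ.* ((4 ℕ.* k ℕ.+ 1) ℕ.* (4 ℕ.* k ℕ.+ 3)))
a₄-suc = ratio-recurrence a₄ f (λ k → (4 ℕ.* k) !) _ (λ k → suc (suc (2 ℕ.* k)) ℕ.* suc (2 ℕ.* k)) af≡g f≢0 (λ k → it)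
  (λ k → trans (cong (ℕ._* ((suc k) ! ℕ.* (suc k) !)) ([2+2k]! k)) (f-suc k (k !) ((2 ℕ.* k) !)))
  (λ k → trans ([4+4k]! k) (g-suc k ((4 ℕ.* k) !)))
  where
  f : ℕ → ℕ
  f k = (2 ℕ.* k) ! ℕ.* (k ! ℕ.* k !)
  f≢0 : ∀ k → NonZero (f k)
  f≢0 k = ℕₚ.m*n≢0 ((2 ℕ.* k) !) (k ! ℕ.* k !) {{(2 ℕ.* k) !≢0}} {{k !* k !≢0}}
  4k≡2k+2k : ∀ k → 4 ℕ.* k ≡ 2 ℕ.* k ℕ.+ 2 ℕ.* k
  4k≡2k+2k = ℕ-solve-∀
  af≡g : ∀ k → a₄ k ℕ.* f k ≡ (4 ℕ.* k) !
  af≡g k = trans (r (4 ℕ.* k C 2 ℕ.* k) (2 ℕ.* k C k) ((2 ℕ.* k) !) (k !))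
    (trans (cong (λ u → (4 ℕ.* k C 2 ℕ.* k) ℕ.* ((2 ℕ.* k) ! ℕ.* u)) (C-! k k (2k≡k+k k))) (C-! (2 ℕ.* k) (2 ℕ.* k) (4k≡2k+2k k)))
    where
    r : ∀ c d u s → c ℕ.* d ℕ.* (u ℕ.* (s ℕ.* s)) ≡ c ℕ.* (u ℕ.* (d ℕ.* (s ℕ.* s)))
    r = ℕ-solve-∀
  f-suc : ∀ k s u → (suc (suc (2 ℕ.* k)) ℕ.* (suc (2 ℕ.* k) ℕ.* u)) ℕ.* (suc k ℕ.* s ℕ.* (suc k ℕ.* s)) ≡
                    u ℕ.* (s ℕ.* s) ℕ.* (suc k ℕ.* suc k ℕ.* (suc (suc (2 ℕ.* k)) ℕ.* suc (2 ℕ.* k)))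
  f-suc = ℕ-solve-∀
  g-suc : ∀ k s → (4 ℕ.+ 4 ℕ.* k) ℕ.* ((3 ℕ.+ 4 ℕ.* k) ℕ.* ((2 ℕ.+ 4 ℕ.* k) ℕ.* ((1 ℕ.+ 4 ℕ.* k) ℕ.* s))) ≡
                  s ℕ.* (4 ℕ.* ((4 ℕ.* k ℕ.+ 1) ℕ.* (4 ℕ.* k ℕ.+ 3)) ℕ.* (suc (suc (2 ℕ.* k)) ℕ.* suc (2 ℕ.* k)))
  g-suc = ℕ-solve-∀

a₆-suc : ∀ k → a₆ (suc k) ℕ.* (suc k ℕ.* suc k) ≡ a₆ k ℕ.* (12 ℕ.* ((6 ℕ.* k ℕ.+ 1) ℕ.* (6 ℕ.* k ℕ.+ 5)))
a₆-suc = ratio-recurrence a₆ f (λ k → (6 ℕ.* k) !) _ ψ af≡g f≢0 (λ k → it)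
  (λ k → trans (cong₂ (λ u v → u ℕ.* ((suc k) ! ℕ.* v)) ([3+3k]! k) ([2+2k]! k)) (f-suc k (k !) ((2 ℕ.* k) !) ((3 ℕ.* k) !)))
  (λ k → trans ([6+6k]! k) (g-suc k ((6 ℕ.* k) !)))
  where
  f ψ : ℕ → ℕ
  f k = (3 ℕ.* k) ! ℕ.* (k ! ℕ.* (2 ℕ.* k) !)
  -- The final 3 comes from 3k + 3 = 3(k + 1), whose factor k + 1 is needed for (k + 1)².
  ψ k = suc (1 ℕ.+ 3 ℕ.* k) ℕ.* suc (3 ℕ.* k) ℕ.* (suc (suc (2 ℕ.* k)) ℕ.* (suc (2 ℕ.* k) ℕ.* 3))
  f≢0 : ∀ k → NonZero (f k)
  f≢0 k = ℕₚ.m*n≢0 ((3 ℕ.* k) !) (k ! ℕ.* (2 ℕ.* k) !) {{(3 ℕ.* k) !≢0}} {{k !* (2 ℕ.* k) !≢0}}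
  6k≡3k+3k : ∀ k → 6 ℕ.* k ≡ 3 ℕ.* k ℕ.+ 3 ℕ.* k
  6k≡3k+3k = ℕ-solve-∀
  af≡g : ∀ k → a₆ k ℕ.* f k ≡ (6 ℕ.* k) !
  af≡g k = trans (r (6 ℕ.* k C 3 ℕ.* k) (3 ℕ.* k C k) ((3 ℕ.* k) !) (k ! ℕ.* (2 ℕ.* k) !))
    (trans (cong (λ u → (6 ℕ.* k C 3 ℕ.* k) ℕ.* ((3 ℕ.* k) ! ℕ.* u)) (C-! k (2 ℕ.* k) refl)) (C-! (3 ℕ.* k) (3 ℕ.* k) (6k≡3k+3k k)))
    where
    r : ∀ c d u s → c ℕ.* d ℕ.* (u ℕ.* s) ≡ c ℕ.* (u ℕ.* (d ℕ.* s))
    r = ℕ-solve-∀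
  f-suc : ∀ k s u v → ((3 ℕ.+ 3 ℕ.* k) ℕ.* ((2 ℕ.+ 3 ℕ.* k) ℕ.* ((1 ℕ.+ 3 ℕ.* k) ℕ.* v))) ℕ.* (suc k ℕ.* s ℕ.* (suc (suc (2 ℕ.* k)) ℕ.* (suc (2 ℕ.* k) ℕ.* u))) ≡
                    v ℕ.* (s ℕ.* u) ℕ.* (suc k ℕ.* suc k ℕ.* (suc (1 ℕ.+ 3 ℕ.* k) ℕ.* suc (3 ℕ.* k) ℕ.* (suc (suc (2 ℕ.* k)) ℕ.* (suc (2 ℕ.* k) ℕ.* 3))))
  f-suc = ℕ-solve-∀
  g-suc : ∀ k s → (6 ℕ.+ 6 ℕ.* k) ℕ.* ((5 ℕ.+ 6 ℕ.* k) ℕ.* ((4 ℕ.+ 6 ℕ.* k) ℕ.* ((3 ℕ.+ 6 ℕ.* k) ℕ.* ((2 ℕ.+ 6 ℕ.* k) ℕ.* ((1 ℕ.+ 6 ℕ.* k) ℕ.* s))))) ≡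
                  s ℕ.* (12 ℕ.* ((6 ℕ.* k ℕ.+ 1) ℕ.* (6 ℕ.* k ℕ.+ 5)) ℕ.* (suc (1 ℕ.+ 3 ℕ.* k) ℕ.* suc (3 ℕ.* k) ℕ.* (suc (suc (2 ℕ.* k)) ℕ.* (suc (2 ℕ.* k) ℕ.* 3))))
  g-suc = ℕ-solve-∀

factor₂ : ∀ k → fromℕ 4 * ((fromℕ 2 * k + fromℕ 1) * (fromℕ 2 * k + fromℕ 1)) ≡ fromℕ 16 * ((k - - (+ 1 / 2)) * (- (+ 1 / 2) + (k + 1ℚ)))
factor₂ = solve-∀ ℚ-ring

factor₃ : ∀ k → fromℕ 3 * ((fromℕ 3 * k + fromℕ 1) * (fromℕ 3 * k + fromℕ 2)) ≡ fromℕ 27 * ((k - - (+ 1 / 3)) * (- (+ 1 / 3) + (k + 1ℚ)))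
factor₃ = solve-∀ ℚ-ring

factor₄ : ∀ k → fromℕ 4 * ((fromℕ 4 * k + fromℕ 1) * (fromℕ 4 * k + fromℕ 3)) ≡ fromℕ 64 * ((k - - (+ 1 / 4)) * (- (+ 1 / 4) + (k + 1ℚ)))
factor₄ = solve-∀ ℚ-ring

factor₆ : ∀ k → fromℕ 12 * ((fromℕ 6 * k + fromℕ 1) * (fromℕ 6 * k + fromℕ 5)) ≡ fromℕ 432 * ((k - - (+ 1 / 6)) * (- (+ 1 / 6) + (k + 1ℚ)))
factor₆ = solve-∀ ℚ-ring

S₂ : ∀ n → (∑[ k < n ] + a₂ k ÷ 16 ^ k * H⁽²⁾ k) ≡ S n (- (+ 1 / 2))
S₂ = S≡sum a₂ 4 16 2 1 1 (- (+ 1 / 2)) refl a₂-suc factor₂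

S₃ : ∀ n → (∑[ k < n ] + a₃ k ÷ 27 ^ k * H⁽²⁾ k) ≡ S n (- (+ 1 / 3))
S₃ = S≡sum a₃ 3 27 3 1 2 (- (+ 1 / 3)) refl a₃-suc factor₃

S₄ : ∀ n → (∑[ k < n ] + a₄ k ÷ 64 ^ k * H⁽²⁾ k) ≡ S n (- (+ 1 / 4))
S₄ = S≡sum a₄ 4 64 4 1 3 (- (+ 1 / 4)) refl a₄-suc factor₄

S₆ : ∀ n → (∑[ k < n ] + a₆ k ÷ 432 ^ k * H⁽²⁾ k) ≡ S n (- (+ 1 / 6))
S₆ = S≡sum a₆ 12 432 6 1 5 (- (+ 1 / 6)) refl a₆-suc factor₆

-- The constants 1/3, 1/2 and 2/3 here and in the next two lemmas are the values of 2x + 1.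
U₃ : ∀ n → (+ 1 / 3) * (∑[ k < n ] + a₃ k ÷ suc (2 ℕ.* k) · 27 ^ k * H⁽²⁾ k) ≡ U n (- (+ 1 / 3))
U₃ = U≡sum a₃ 3 27 3 1 2 (- (+ 1 / 3)) refl a₃-suc factor₃

U₄ : ∀ n → (+ 1 / 2) * (∑[ k < n ] + a₄ k ÷ suc (2 ℕ.* k) · 64 ^ k * H⁽²⁾ k) ≡ U n (- (+ 1 / 4))
U₄ = U≡sum a₄ 4 64 4 1 3 (- (+ 1 / 4)) refl a₄-suc factor₄

U₆ : ∀ n → (+ 2 / 3) * (∑[ k < n ] + a₆ k ÷ suc (2 ℕ.* k) · 432 ^ k * H⁽²⁾ k) ≡ U n (- (+ 1 / 6))
U₆ = U≡sum a₆ 12 432 6 1 5 (- (+ 1 / 6)) refl a₆-suc factor₆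

-- Congruences in ℤ₍ₚ₎

module Congruence (p : ℕ) (p-prime : Prime p) where

  open Local p p-prime public

  <⇒∤ : ∀ k → suc k ℕ.< p → p ∤ suc k
  <⇒∤ k = ∣.>⇒∤

  sum-∣ᵖ : ∀ {j} n {f : Seq} → (∀ k → k ℕ.< n → j ∣ᵖ f k) → j ∣ᵖ sumBelow n f
  sum-∣ᵖ zero    df = ∣ᵖ-0
  sum-∣ᵖ (suc n) df = ∣ᵖ-+ (df 0 (s≤s z≤n)) (sum-∣ᵖ n (λ k k<n → df (suc k) (s≤s k<n)))

  ∣⇒∣ᵖ : ∀ {m} → p ∣ m → 1 ∣ᵖ fromℕ m
  ∣⇒∣ᵖ (divides c refl) = subst (1 ∣ᵖ_) (sym (fromℕ-* c p)) (∣ᵖ-*ˡ (fromℕ-integral c) p∣ᵖ)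

  ∣ᵖ⇒∣ : ∀ m → 1 ∣ᵖ fromℕ m → p ∣ m
  ∣ᵖ⇒∣ m (divisible {c} (integral {d} {i} p∤d c≡) m≡) =
    [ (λ p∣m → p∣m) , (λ p∣d → contradiction p∣d p∤d) ]′ (euclidsLemma m d p-prime p∣md)
    where
    eq : + m ℤ.* + d ≡ i ℤ.* + p
    eq = fromℤ-injective (begin
      fromℤ (+ m ℤ.* + d)                 ≡⟨ fromℤ-* (+ m) (+ d) ⟩
      fromℕ m * fromℕ d                   ≡⟨ cong (_* fromℕ d) m≡ ⟩
      fromℕ (p ℕ.* 1) * c * fromℕ d       ≡⟨ cong (λ u → fromℕ u * c * fromℕ d) (ℕₚ.*-identityʳ p) ⟩
      fromℕ p * c * fromℕ d               ≡⟨ r (fromℕ p) c (fromℕ d) ⟩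
      c * fromℕ d * fromℕ p               ≡⟨ cong (_* fromℕ p) c≡ ⟩
      fromℤ i * fromℕ p                   ≡⟨ fromℤ-* i (+ p) ⟨
      fromℤ (i ℤ.* + p)                   ∎)
      where
      r : ∀ x y z → x * y * z ≡ y * z * x
      r = solve-∀ ℚ-ring
    p∣md : p ∣ m ℕ.* d
    p∣md = divides ℤ.∣ i ∣ (trans (sym (ℤₚ.abs-* (+ m) (+ d))) (trans (cong ℤ.∣_∣ eq) (ℤₚ.abs-* i (+ p))))

  ∣ᵖ-cancel : ∀ {j x} m → p ∤ m → j ∣ᵖ (fromℕ m * x) → j ∣ᵖ x
  ∣ᵖ-cancel         zero    p∤m _ = contradiction (p ∣.∣0) p∤m
  ∣ᵖ-cancel {j} {x} m@(suc _) p∤m h = subst (j ∣ᵖ_) eq (∣ᵖ-*ˡ (/-integral 1ℤ m p∤m) h)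
    where
    eq : (1ℤ / m) * (fromℕ m * x) ≡ x
    eq = trans (sym (ℚₚ.*-assoc (1ℤ / m) (fromℕ m) x)) (trans (cong (_* x) (/-*-cancel 1ℤ m)) (ℚₚ.*-identityˡ x))

  ≈-cancel : ∀ {j x y} m → p ∤ m → fromℕ m * x ≈ fromℕ m * y mod j → x ≈ y mod j
  ≈-cancel {j} {x} {y} m p∤m (diff h) = diff (∣ᵖ-cancel m p∤m (subst (j ∣ᵖ_) (r (fromℕ m) x y) h))
    where
    r : ∀ m x y → m * x - m * y ≡ m * (x - y)
    r = solve-∀ ℚ-ring

  ∣ᵖ-cancel-p : ∀ {j x} → suc j ∣ᵖ (fromℕ p * x) → j ∣ᵖ x
  ∣ᵖ-cancel-p {j} {x} (divisible {c} Ic eq) = divisible Ic (*-cancelʳ-fromℕ p (begin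
    x * fromℕ p                       ≡⟨ ℚₚ.*-comm x (fromℕ p) ⟩
    fromℕ p * x                       ≡⟨ eq ⟩
    fromℕ (p ℕ.* p ℕ.^ j) * c         ≡⟨ cong (_* c) (fromℕ-* p (p ℕ.^ j)) ⟩
    fromℕ p * fromℕ (p ℕ.^ j) * c     ≡⟨ r (fromℕ p) (fromℕ (p ℕ.^ j)) c ⟩
    fromℕ (p ℕ.^ j) * c * fromℕ p     ∎))
    where
    r : ∀ x y z → x * y * z ≡ y * z * x
    r = solve-∀ ℚ-ring

  ≈-weaken : ∀ {i j x y} → i ℕ.≤ j → x ≈ y mod j → x ≈ y mod i
  ≈-weaken i≤j (diff h) = diff (∣ᵖ-weaken i≤j h)

  ≈-resp-∣ᵖ : ∀ {j x y} → x ≈ y mod j → j ∣ᵖ y → j ∣ᵖ x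
  ≈-resp-∣ᵖ x≈y dy = ≈0⇒∣ᵖ (≈-trans x≈y (∣ᵖ⇒≈0 dy))

  infixr 6 _⊕_
  infixr 7 _⊗_
  infix 8 ⊖_

  -- Polynomial functions with coefficients in ℤ₍ₚ₎

  data Polynomial : (ℚ → ℚ) → Set where
    constant : ∀ {c} → Integral c → Polynomial (λ _ → c)
    identity : Polynomial (λ x → x)
    ⊖_       : ∀ {f} → Polynomial f → Polynomial (λ x → - f x)
    _⊕_      : ∀ {f g} → Polynomial f → Polynomial g → Polynomial (λ x → f x + g x)
    _⊗_      : ∀ {f g} → Polynomial f → Polynomial g → Polynomial (λ x → f x * g x)

  Polynomial-sum : ∀ n {f : ℕ → ℚ → ℚ} → (∀ k → k ℕ.< n → Polynomial (f k)) → Polynomial (λ x → ∑[ k < n ] f k x)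
  Polynomial-sum zero    Pf = constant (fromℕ-integral 0)
  Polynomial-sum (suc n) Pf = Pf 0 (s≤s z≤n) ⊕ Polynomial-sum n (λ k k<n → Pf (suc k) (s≤s k<n))

  Polynomial-^ : ∀ n {f} → Polynomial f → Polynomial (λ x → f x ^ n)
  Polynomial-^ zero    Pf = constant (fromℕ-integral 1)
  Polynomial-^ (suc n) Pf = Pf ⊗ Polynomial-^ n Pf

  Polynomial-integral : ∀ {f x} → Polynomial f → Integral x → Integral (f x)
  Polynomial-integral (constant Ic) Ix = Ic
  Polynomial-integral identity      Ix = Ix
  Polynomial-integral (⊖ Pf)        Ix = neg-integral (Polynomial-integral Pf Ix)
  Polynomial-integral (Pf ⊕ Pg)     Ix = +-integral (Polynomial-integral Pf Ix) (Polynomial-integral Pg Ix)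
  Polynomial-integral (Pf ⊗ Pg)     Ix = *-integral (Polynomial-integral Pf Ix) (Polynomial-integral Pg Ix)

  Polynomial-cong : ∀ {f j x y} → Polynomial f → Integral x → Integral y → x ≈ y mod j → f x ≈ f y mod j
  Polynomial-cong (constant Ic) Ix Iy x≈y = ≈-refl
  Polynomial-cong identity      Ix Iy x≈y = x≈y
  Polynomial-cong (⊖ Pf)        Ix Iy x≈y = ≈-neg (Polynomial-cong Pf Ix Iy x≈y)
  Polynomial-cong (Pf ⊕ Pg)     Ix Iy x≈y = ≈-+ (Polynomial-cong Pf Ix Iy x≈y) (Polynomial-cong Pg Ix Iy x≈y)
  Polynomial-cong (Pf ⊗ Pg)     Ix Iy x≈y =
    ≈-* (Polynomial-integral Pg Ix) (Polynomial-integral Pf Iy) (Polynomial-cong Pf Ix Iy x≈y) (Polynomial-cong Pg Ix Iy x≈y)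

  -- First-order Taylor expansion at 0 on pℤ₍ₚ₎, with the slope in the role of f′(0); second-order
  -- terms vanish modulo p².
  record Linear (f : ℚ → ℚ) : Set where
    constructor linear
    field
      {slope}   : ℚ
      slope-int : Integral slope
      linear-≈  : ∀ h → Integral h → f (fromℕ p * h) ≈ f 0ℚ + slope * (fromℕ p * h) mod 2

  Linear-neg : ∀ {f} → Linear f → Linear (λ x → - f x)
  Linear-neg {f} (linear {b} Ib f≈) = linear (neg-integral Ib) λ h Ih →
    ≈-trans (≈-neg (f≈ h Ih)) (≈-reflexive (r (f 0ℚ) b (fromℕ p * h)))
    where
    r : ∀ u b x → - (u + b * x) ≡ - u + - b * x
    r = solve-∀ ℚ-ring

  Linear-+ : ∀ {f g} → Linear f → Linear g → Linear (λ x → f x + g x)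
  Linear-+ {f} {g} (linear {b} Ib f≈) (linear {c} Ic g≈) = linear (+-integral Ib Ic) λ h Ih →
    ≈-trans (≈-+ (f≈ h Ih) (g≈ h Ih)) (≈-reflexive (r (f 0ℚ) (g 0ℚ) b c (fromℕ p * h)))
    where
    r : ∀ u v b c x → (u + b * x) + (v + c * x) ≡ (u + v) + (b + c) * x
    r = solve-∀ ℚ-ring

  Linear-* : ∀ {f g} → Polynomial f → Polynomial g → Linear f → Linear g → Linear (λ x → f x * g x)
  Linear-* {f} {g} Pf Pg (linear {b} Ib f≈) (linear {c} Ic g≈) =
    linear (+-integral (*-integral If Ic) (*-integral Ig Ib)) λ h Ih →
      ≈-trans (≈-* (Polynomial-integral Pg (*-integral Ip Ih)) (+-integral If (*-integral Ib (*-integral Ip Ih))) (f≈ h Ih) (g≈ h Ih))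
        -- The product of two linear expansions exceeds a linear one by bc(ph)², a multiple of p².
        (diff (subst (2 ∣ᵖ_) (r (f 0ℚ) (g 0ℚ) b c (fromℕ p * h)) (∣ᵖ-*ˡ (*-integral Ib Ic) (∣ᵖ-* (∣ᵖ-*ʳ p∣ᵖ Ih) (∣ᵖ-*ʳ p∣ᵖ Ih)))))
    where
    Ip = fromℕ-integral p
    If = Polynomial-integral Pf (fromℕ-integral 0)
    Ig = Polynomial-integral Pg (fromℕ-integral 0)
    r : ∀ u v b c x → b * c * (x * x) ≡ (u + b * x) * (v + c * x) - (u * v + (u * c + v * b) * x)
    r = solve-∀ ℚ-ring

  Polynomial-linear : ∀ {f} → Polynomial f → Linear f
  Polynomial-linear (constant {c} Ic) = linear (fromℕ-integral 0) λ h Ih → ≈-reflexive (r c (fromℕ p * h))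
    where
    r : ∀ c x → c ≡ c + 0ℚ * x
    r = solve-∀ ℚ-ring
  Polynomial-linear identity = linear (fromℕ-integral 1) λ h Ih → ≈-reflexive (r (fromℕ p * h))
    where
    r : ∀ x → x ≡ 0ℚ + 1ℚ * x
    r = solve-∀ ℚ-ring
  Polynomial-linear (⊖ Pf)    = Linear-neg (Polynomial-linear Pf)
  Polynomial-linear (Pf ⊕ Pg) = Linear-+ (Polynomial-linear Pf) (Polynomial-linear Pg)
  Polynomial-linear (Pf ⊗ Pg) = Linear-* Pf Pg (Polynomial-linear Pf) (Polynomial-linear Pg)

  -- Fermat's little theorem

  ∤-! : ∀ k → k ℕ.< p → p ∤ k !
  ∤-! zero    k<p = p∤1
  ∤-! (suc k) k<p = ∤-* (suc k) (k !) (<⇒∤ k k<p) (∤-! k (ℕₚ.<-trans (ℕₚ.n<1+n k) k<p))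

  n∣n! : ∀ n .{{_ : NonZero n}} → n ∣ n !
  n∣n! (suc n) = ∣.m∣m*n (n !)

  -- The prime p divides p! = C(p,k+1) (k+1)! (p-k-1)! but neither factorial on the right.
  p∣pCk : ∀ k → suc k ℕ.< p → p ∣ p C suc k
  p∣pCk k k<p = [ (λ p∣C → p∣C) , (λ p∣f → contradiction p∣f p∤f) ]′
    (euclidsLemma (p C suc k) (suc k ! ℕ.* (p ∸ suc k) !) p-prime p∣Cf)
    where
    p∣Cf : p ∣ (p C suc k) ℕ.* (suc k ! ℕ.* (p ∸ suc k) !)
    p∣Cf = subst (p ∣_) (sym (C-! (suc k) (p ∸ suc k) (sym (ℕₚ.m+[n∸m]≡n (ℕₚ.<⇒≤ k<p))))) (n∣n! p)
    p∤f : p ∤ suc k ! ℕ.* (p ∸ suc k) !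
    p∤f = ∤-* (suc k !) ((p ∸ suc k) !) (∤-! (suc k) k<p) (∤-! (p ∸ suc k) (ℕₚ.∸-monoʳ-< (s≤s z≤n) (ℕₚ.<⇒≤ k<p)))

  freshman : ∀ x → Integral x → (x + 1ℚ) ^ p ≈ x ^ p + 1ℚ mod 1
  freshman x Ix = diff (subst (1 ∣ᵖ_) eq (sum-∣ᵖ (ℕ.pred p) mid))
    where
    f : ℕ → ℚ
    f k = fromℕ (p C k) * x ^ k * 1ℚ ^ (p ∸ k)
    p≡ : suc (ℕ.pred p) ≡ p
    p≡ = ℕₚ.suc-pred p
    mid : ∀ k → k ℕ.< ℕ.pred p → 1 ∣ᵖ f (suc k)
    mid k k<p = ∣ᵖ-*ʳ (∣ᵖ-*ʳ (∣⇒∣ᵖ (p∣pCk k (subst (suc k ℕ.<_) p≡ (s≤s k<p)))) (^-integral (suc k) Ix))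
                      (^-integral (p ∸ suc k) (fromℕ-integral 1))
    f-0 : f 0 ≡ 1ℚ
    f-0 = trans (cong (1ℚ * 1ℚ *_) (1^n≡1 p)) refl
    f-p : f p ≡ x ^ p
    f-p = trans (cong₂ (λ u v → fromℕ u * x ^ p * v) (nCn≡1 p) (1^n≡1 (p ∸ p))) (r (x ^ p))
      where
      r : ∀ y → 1ℚ * y * 1ℚ ≡ y
      r = solve-∀ ℚ-ring
    expand : (x + 1ℚ) ^ p ≡ f 0 + sumBelow (ℕ.pred p) (f ∘ suc) + f p
    expand = begin
      (x + 1ℚ) ^ p                                 ≡⟨ translate-powers x 1ℚ p ⟨
      translate 1ℚ (powers x) p                    ≡⟨ appell-sum (powers x) 1ℚ p ⟨
      sumUpTo p f                                  ≡⟨ sumBelow-suc p f ⟩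
      sumBelow p f + f p                           ≡⟨ cong (λ n → sumBelow n f + f p) p≡ ⟨
      sumBelow (suc (ℕ.pred p)) f + f p            ∎
    eq : sumBelow (ℕ.pred p) (f ∘ suc) ≡ (x + 1ℚ) ^ p - (x ^ p + 1ℚ)
    eq = trans (r (sumBelow (ℕ.pred p) (f ∘ suc)) (x ^ p))
      (cong (_- (x ^ p + 1ℚ)) (sym (trans expand (cong₂ (λ u v → u + sumBelow (ℕ.pred p) (f ∘ suc) + v) f-0 f-p))))
      where
      r : ∀ s y → s ≡ (1ℚ + s + y) - (y + 1ℚ)
      r = solve-∀ ℚ-ring

  fermat : ∀ m → fromℕ m ^ p ≈ fromℕ m mod 1
  fermat zero    = ≈-reflexive (subst (λ n → 0ℚ ^ n ≡ 0ℚ) (ℕₚ.suc-pred p) (ℚₚ.*-zeroˡ (0ℚ ^ ℕ.pred p)))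
  fermat (suc m) = subst (λ x → x ^ p ≈ x mod 1) (sym (fromℕ-suc m))
    (≈-trans (freshman (fromℕ m) (fromℕ-integral m)) (≈-+ (fermat m) ≈-refl))

  geometric : ∀ x n → (x - 1ℚ) * (∑[ i < n ] x ^ i) ≡ x ^ n - 1ℚ
  geometric x zero    = r (x - 1ℚ)
    where
    r : ∀ y → y * 0ℚ ≡ 1ℚ - 1ℚ
    r = solve-∀ ℚ-ring
  geometric x (suc n) = begin
    (x - 1ℚ) * (∑[ i < suc n ] x ^ i)                ≡⟨ cong ((x - 1ℚ) *_) (sumBelow-suc n (x ^_)) ⟩
    (x - 1ℚ) * ((∑[ i < n ] x ^ i) + x ^ n)          ≡⟨ ℚₚ.*-distribˡ-+ (x - 1ℚ) _ (x ^ n) ⟩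
    (x - 1ℚ) * (∑[ i < n ] x ^ i) + (x - 1ℚ) * x ^ n ≡⟨ cong (_+ (x - 1ℚ) * x ^ n) (geometric x n) ⟩
    (x ^ n - 1ℚ) + (x - 1ℚ) * x ^ n                  ≡⟨ r x (x ^ n) ⟩
    x * x ^ n - 1ℚ                                   ∎
    where
    r : ∀ x y → (y - 1ℚ) + (x - 1ℚ) * y ≡ x * y - 1ℚ
    r = solve-∀ ℚ-ring

  ^-≈1 : ∀ {j x} n → Integral x → x ≈ 1ℚ mod j → x ^ n ≈ 1ℚ mod j
  ^-≈1 zero    Ix x≈1 = ≈-refl
  ^-≈1 (suc n) Ix x≈1 = ≈-* (^-integral n Ix) (fromℕ-integral 1) x≈1 (^-≈1 n Ix x≈1)

  -- In xᵖ - 1 = (x - 1) ∑ xⁱ over i < p, each xⁱ is 1 modulo p, so the sum is ≡ p ≡ 0 and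
  -- contributes one more power of p.
  ^p-≈1 : ∀ {j x} → Integral x → x ≈ 1ℚ mod suc j → x ^ p ≈ 1ℚ mod suc (suc j)
  ^p-≈1 {j} {x} Ix x≈1@(diff h) = diff (subst (_∣ᵖ (x ^ p - 1ℚ)) (ℕₚ.+-comm (suc j) 1)
    (subst ((suc j ℕ.+ 1) ∣ᵖ_) (geometric x p) (∣ᵖ-* h sum-div)))
    where
    1-sum : ∀ n → (∑[ i < n ] 1ℚ) ≡ fromℕ n
    1-sum zero    = refl
    1-sum (suc n) = trans (cong (_+_ 1ℚ) (1-sum n)) (sym (fromℕ-+ 1 n))
    sum-≈ : ∀ n → (∑[ i < n ] x ^ i) ≈ fromℕ n mod 1
    sum-≈ n = ≈-trans (go n (λ i → ^-≈1 i Ix (≈-weaken (s≤s z≤n) x≈1))) (≈-reflexive (1-sum n))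
      where
      go : ∀ n {f : Seq} → (∀ i → f i ≈ 1ℚ mod 1) → sumBelow n f ≈ sumBelow n (λ _ → 1ℚ) mod 1
      go zero    f≈ = ≈-refl
      go (suc n) f≈ = ≈-+ (f≈ 0) (go n (f≈ ∘ suc))
    sum-div : 1 ∣ᵖ (∑[ i < p ] x ^ i)
    sum-div = ≈-resp-∣ᵖ (sum-≈ p) p∣ᵖ

  -- The exponent is φ(pʲ⁺¹) = (p - 1)pʲ. Fermat's theorem is the case j = 0, and each further p-th
  -- power raises the modulus by `^p-≈1`.
  euler-theorem : ∀ m j → p ∤ m → fromℕ m ^ (ℕ.pred p ℕ.* p ℕ.^ j) ≈ 1ℚ mod suc j
  euler-theorem m zero    p∤m = subst (λ k → fromℕ m ^ k ≈ 1ℚ mod 1) (sym (ℕₚ.*-identityʳ (ℕ.pred p)))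
    (≈-cancel m p∤m (subst (λ k → fromℕ m ^ k ≈ fromℕ m * 1ℚ mod 1) (sym (ℕₚ.suc-pred p))
      (≈-trans (fermat m) (≈-reflexive (sym (ℚₚ.*-identityʳ (fromℕ m)))))))
  euler-theorem m (suc j) p∤m = subst (_≈ 1ℚ mod suc (suc j))
    (trans (^-assocʳ (fromℕ m) (ℕ.pred p ℕ.* p ℕ.^ j) p) (cong (fromℕ m ^_) (r (ℕ.pred p) (p ℕ.^ j) p)))
    (^p-≈1 (^-integral (ℕ.pred p ℕ.* p ℕ.^ j) (fromℕ-integral m)) (euler-theorem m j p∤m))
    where
    r : ∀ a b c → a ℕ.* b ℕ.* c ≡ a ℕ.* (c ℕ.* b)
    r = ℕ-solve-∀

  -- A natural number inverse of d is d^(φ − 1), and −1 ≡ pʲ − 1.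
  dense : ∀ j {x} → Integral x → ∃ λ m → x ≈ fromℕ m mod suc j
  dense j {x} (integral {d} {i} p∤d x≡) = from-sign i x≡
    where
    φ = ℕ.pred p ℕ.* p ℕ.^ j
    instance
      φ≢0 : NonZero φ
      φ≢0 = ℕₚ.m*n≢0 (ℕ.pred p) (p ℕ.^ j) {{pred≢0}} {{ℕₚ.m^n≢0 p j}}
        where
        pred≢0 : NonZero (ℕ.pred p)
        pred≢0 = ℕ.>-nonZero (ℕₚ.≤-pred (subst (1 ℕ.<_) (sym (ℕₚ.suc-pred p)) (ℕ.nonTrivial⇒n>1 p {{prime⇒nonTrivial p-prime}})))
    e = d ℕ.^ ℕ.pred φ
    Ix : Integral x
    Ix = integral {num = i} p∤d x≡
    de≈1 : fromℕ d * fromℕ e ≈ 1ℚ mod suc j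
    de≈1 = subst (_≈ 1ℚ mod suc j)
      (trans (cong (fromℕ d ^_) (sym (ℕₚ.suc-pred φ))) (cong (fromℕ d *_) (sym (fromℕ-^ d (ℕ.pred φ)))))
      (euler-theorem d j p∤d)
    xde≈ : x ≈ x * fromℕ d * fromℕ e mod suc j
    xde≈ = ≈-trans (≈-reflexive (sym (ℚₚ.*-identityʳ x)))
      (≈-trans (≈-*ˡ x Ix (≈-sym de≈1)) (≈-reflexive (sym (ℚₚ.*-assoc x (fromℕ d) (fromℕ e)))))
    from-sign : ∀ i → x * fromℕ d ≡ fromℤ i → ∃ λ m → x ≈ fromℕ m mod suc j
    from-sign (+ a) x≡ = a ℕ.* e , ≈-trans xde≈ (≈-reflexive (trans (cong (_* fromℕ e) x≡) (sym (fromℕ-* a e))))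
    from-sign ℤ.-[1+ a ] x≡ = suc a ℕ.* e ℕ.* ℕ.pred (p ℕ.^ suc j) , ≈-trans xde≈
      (diff (divisible {quot = - (fromℕ (suc a) * fromℕ e)} (neg-integral (*-integral (fromℕ-integral (suc a)) (fromℕ-integral e))) (begin
        x * fromℕ d * fromℕ e - fromℕ (suc a ℕ.* e ℕ.* P-1)
          ≡⟨ cong₂ (λ u v → u * fromℕ e - v) (trans x≡ (fromℤ-neg (+ suc a)))
               (trans (fromℕ-* (suc a ℕ.* e) P-1) (cong (_* fromℕ P-1) (fromℕ-* (suc a) e))) ⟩
        - fromℕ (suc a) * fromℕ e - fromℕ (suc a) * fromℕ e * fromℕ P-1
          ≡⟨ r (fromℕ (suc a)) (fromℕ e) (fromℕ P-1) ⟩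
        (fromℕ P-1 + 1ℚ) * - (fromℕ (suc a) * fromℕ e)
          ≡⟨ cong (_* - (fromℕ (suc a) * fromℕ e)) (trans (sym (fromℕ-suc P-1)) (cong fromℕ (ℕₚ.suc-pred (p ℕ.^ suc j) {{ℕₚ.m^n≢0 p (suc j)}}))) ⟩
        fromℕ (p ℕ.^ suc j) * - (fromℕ (suc a) * fromℕ e) ∎)))
      where
      P-1 = ℕ.pred (p ℕ.^ suc j)
      r : ∀ a e P → - a * e - a * e * P ≡ (P + 1ℚ) * - (a * e)
      r = solve-∀ ℚ-ring

-- Factorization of w into two products of linear factors

v : ℚ → ℕ → ℚ
v y zero    = 1ℚ
v y (suc k) = v y k * (1ℚ + y * (1ℤ / suc k))

-- Splits 1 - x²/j² as (1 + x/j)(1 - x/j). Divisibility of `w` by p² then amounts to one factor p in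
-- each half.
w≡v*v : ∀ k x → w k x ≡ v x k * v (- x) k
w≡v*v zero    x = refl
w≡v*v (suc k) x = trans (cong₂ (λ a b → a * (1ℚ - x * x * b)) (w≡v*v k x) q≡) (r (v x k) (v (- x) k) x (1ℤ / suc k))
  where
  q≡ : q k ≡ (1ℤ / suc k) * (1ℤ / suc k)
  q≡ = *-cancelʳ-fromℕ (suc k ℕ.* suc k) (begin
    q k * fromℕ (suc k ℕ.* suc k)
      ≡⟨ /-*-cancel 1ℤ (suc k ℕ.* suc k) ⟩
    1ℚ * 1ℚ
      ≡⟨ cong₂ _*_ (/-*-cancel 1ℤ (suc k)) (/-*-cancel 1ℤ (suc k)) ⟨
    ((1ℤ / suc k) * fromℕ (suc k)) * ((1ℤ / suc k) * fromℕ (suc k))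
      ≡⟨ r′ (1ℤ / suc k) (fromℕ (suc k)) ⟩
    (1ℤ / suc k) * (1ℤ / suc k) * (fromℕ (suc k) * fromℕ (suc k))
      ≡⟨ cong ((1ℤ / suc k) * (1ℤ / suc k) *_) (fromℕ-* (suc k) (suc k)) ⟨
    (1ℤ / suc k) * (1ℤ / suc k) * fromℕ (suc k ℕ.* suc k) ∎)
    where
    r′ : ∀ i m → (i * m) * (i * m) ≡ i * i * (m * m)
    r′ = solve-∀ ℚ-ring
  r : ∀ a b x i → a * b * (1ℚ - x * x * (i * i)) ≡ a * (1ℚ + x * i) * (b * (1ℚ + - x * i))
  r = solve-∀ ℚ-ring

-- Integrality of S, U and Eₙ, and divisibility of w by p²

module Sums (p : ℕ) (p-prime : Prime p) (3<p : 3 ℕ.< p) where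

  open Congruence p p-prime public

  p∤2 : p ∤ 2
  p∤2 = <⇒∤ 1 (ℕₚ.<-trans (ℕₚ.n<1+n 2) 3<p)

  p∤3 : p ∤ 3
  p∤3 = <⇒∤ 2 3<p

  ∤-^ : ∀ m k → p ∤ m → p ∤ m ℕ.^ k
  ∤-^ m zero    p∤m = p∤1
  ∤-^ m (suc k) p∤m = ∤-* m (m ℕ.^ k) p∤m (∤-^ m k p∤m)

  q-integral : ∀ k → suc k ℕ.< p → Integral (q k)
  q-integral k k<p = /-integral 1ℤ (suc k ℕ.* suc k) (∤-* (suc k) (suc k) (<⇒∤ k k<p) (<⇒∤ k k<p))

  H-integral : ∀ k → k ℕ.< p → Integral (H⁽²⁾ k)
  H-integral k k<p = sum-integral k {q} (λ i i<k → q-integral i (ℕₚ.≤-trans (s≤s i<k) k<p))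

  t-polynomial : ∀ k → k ℕ.< p → Polynomial (t k)
  t-polynomial zero    k<p = constant (fromℕ-integral 1)
  t-polynomial (suc k) k<p =
    (t-polynomial k (ℕₚ.<-trans (ℕₚ.n<1+n k) k<p)
      ⊗ ((constant (fromℕ-integral k) ⊕ ⊖ identity) ⊗ (identity ⊕ constant (+-integral (fromℕ-integral k) (fromℕ-integral 1)))))
    ⊗ constant (q-integral k k<p)

  S-polynomial : Polynomial (S p)
  S-polynomial = Polynomial-sum p {λ k x → t k x * H⁽²⁾ k} (λ k k<p → t-polynomial k k<p ⊗ constant (H-integral k k<p))

  -- Since 2k + 1 < 2p, the prime p can divide 2k + 1 only if the two are equal, and then the
  -- quotient is 1.
  p/[1+2k]-integral : ∀ k → k ℕ.< p → Integral (fromℕ p * (1ℤ / suc (2 ℕ.* k)))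
  p/[1+2k]-integral k k<p = [ divisible-case , coprime-case ]′ (toSum (p ∣.∣? suc (2 ℕ.* k)))
    where
    coprime-case : p ∤ suc (2 ℕ.* k) → Integral (fromℕ p * (1ℤ / suc (2 ℕ.* k)))
    coprime-case p∤ = *-integral (fromℕ-integral p) (/-integral 1ℤ (suc (2 ℕ.* k)) p∤)
    equal-case : suc (2 ℕ.* k) ≡ p → Integral (fromℕ p * (1ℤ / suc (2 ℕ.* k)))
    equal-case eq = subst Integral (sym (trans (cong (λ m → fromℕ m * (1ℤ / suc (2 ℕ.* k))) (sym eq))
      (trans (ℚₚ.*-comm (fromℕ (suc (2 ℕ.* k))) (1ℤ / suc (2 ℕ.* k))) (/-*-cancel 1ℤ (suc (2 ℕ.* k)))))) (fromℕ-integral 1)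
    1+2k<2p : suc (2 ℕ.* k) ℕ.< 2 ℕ.* p
    1+2k<2p = subst (ℕ._≤ 2 ℕ.* p) (ℕₚ.*-suc 2 k) (ℕₚ.*-monoʳ-≤ 2 k<p)
    divisible-case : p ∣ suc (2 ℕ.* k) → Integral (fromℕ p * (1ℤ / suc (2 ℕ.* k)))
    divisible-case (divides (suc zero)    eq) = equal-case (trans eq (ℕₚ.*-identityˡ p))
    divisible-case (divides (suc (suc c)) eq) = contradiction
      (ℕₚ.≤-trans (ℕₚ.*-monoˡ-≤ p {2} {suc (suc c)} (s≤s (s≤s z≤n))) (ℕₚ.≤-reflexive (sym eq))) (ℕₚ.<⇒≱ 1+2k<2p)

  -- The factor p is moved into the sum to absorb the one denominator 2k + 1 = p, which makes the
  -- coefficients integral.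
  pU : ℚ → ℚ
  pU x = (fromℕ 2 * x + 1ℚ) * (∑[ k < p ] t k x * (fromℕ p * (1ℤ / suc (2 ℕ.* k)) * H⁽²⁾ k))

  pU-polynomial : Polynomial pU
  pU-polynomial = (constant (fromℕ-integral 2) ⊗ identity ⊕ constant (fromℕ-integral 1))
    ⊗ Polynomial-sum p {λ k x → t k x * (fromℕ p * (1ℤ / suc (2 ℕ.* k)) * H⁽²⁾ k)}
        (λ k k<p → t-polynomial k k<p ⊗ constant (*-integral (p/[1+2k]-integral k k<p) (H-integral k k<p)))

  p*U≡pU : ∀ x → fromℕ p * U p x ≡ pU x
  p*U≡pU x = begin
    fromℕ p * ((fromℕ 2 * x + 1ℚ) * sumBelow p f)        ≡⟨ r (fromℕ p) (fromℕ 2 * x + 1ℚ) (sumBelow p f) ⟩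
    (fromℕ 2 * x + 1ℚ) * (fromℕ p * sumBelow p f)        ≡⟨ cong ((fromℕ 2 * x + 1ℚ) *_) (sumBelow-* p (fromℕ p) f) ⟨
    (fromℕ 2 * x + 1ℚ) * (∑[ k < p ] fromℕ p * f k)      ≡⟨ cong ((fromℕ 2 * x + 1ℚ) *_) (sumBelow-cong p (λ k _ → r′ (fromℕ p) (t k x) (1ℤ / suc (2 ℕ.* k)) (H⁽²⁾ k))) ⟩
    pU x                                                 ∎
    where
    f : ℕ → ℚ
    f k = t k x * (1ℤ / suc (2 ℕ.* k)) * H⁽²⁾ k
    r : ∀ p a s → p * (a * s) ≡ a * (p * s)
    r = solve-∀ ℚ-ring
    r′ : ∀ p t i h → p * (t * i * h) ≡ t * (p * i * h)
    r′ = solve-∀ ℚ-ring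

  -- Dividing the congruence for p·U by p costs one power of p, hence modulus p³ for the arguments.
  U-cong : ∀ {x y} → Integral x → Integral y → x ≈ y mod 3 → U p x ≈ U p y mod 2
  U-cong {x} {y} Ix Iy x≈y = diff (∣ᵖ-cancel-p (subst (3 ∣ᵖ_) eq (∣-diff (Polynomial-cong pU-polynomial Ix Iy x≈y))))
    where
    eq : pU x - pU y ≡ fromℕ p * (U p x - U p y)
    eq = trans (cong₂ _-_ (sym (p*U≡pU x)) (sym (p*U≡pU y))) (r (fromℕ p) (U p x) (U p y))
      where
      r : ∀ p a b → p * a - p * b ≡ p * (a - b)
      r = solve-∀ ℚ-ring

  -- Euler numbers are integers, so the only denominators are powers of 2.
  eulerPoly-polynomial : ∀ n → Polynomial (λ x → eulerPoly n (- x))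
  eulerPoly-polynomial n = Polynomial-sum (suc n) {λ k x → fromℕ (n C k) * (euler k ÷ 2 ^ k) * ((- x) - ½) ^ (n ∸ k)} (λ k _ →
    constant (*-integral (fromℕ-integral (n C k)) (/-integral (euler k) (2 ℕ.^ k) {{ℕₚ.m^n≢0 2 k}} (∤-^ 2 k p∤2)))
    ⊗ Polynomial-^ (n ∸ k) (⊖ identity ⊕ constant (neg-integral (/-integral 1ℤ 2 p∤2))))

  v-integral : ∀ {y} k → k ℕ.< p → Integral y → Integral (v y k)
  v-integral zero    k<p Iy = fromℕ-integral 1
  v-integral (suc k) k<p Iy = *-integral (v-integral k (ℕₚ.<-trans (ℕₚ.n<1+n k) k<p) Iy)
    (+-integral (fromℕ-integral 1) (*-integral Iy (/-integral 1ℤ (suc k) (<⇒∤ k k<p))))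

  v-∣ᵖ : ∀ {y} i k → i ℕ.< k → k ℕ.< p → Integral y → 1 ∣ᵖ (1ℚ + y * (1ℤ / suc i)) → 1 ∣ᵖ v y k
  v-∣ᵖ {y} i (suc k) i<1+k k<p Iy d = [ earlier , now ]′ (ℕₚ.m≤n⇒m<n∨m≡n (ℕₚ.≤-pred i<1+k))
    where
    earlier : i ℕ.< k → 1 ∣ᵖ v y (suc k)
    earlier i<k = ∣ᵖ-*ʳ (v-∣ᵖ i k i<k (ℕₚ.<-trans (ℕₚ.n<1+n k) k<p) Iy d)
      (+-integral (fromℕ-integral 1) (*-integral Iy (/-integral 1ℤ (suc k) (<⇒∤ k k<p))))
    now : i ≡ k → 1 ∣ᵖ v y (suc k)
    now refl = ∣ᵖ-*ˡ (v-integral k (ℕₚ.<-trans (ℕₚ.n<1+n k) k<p) Iy) d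

  -- If m is prime to p, then both ∏ (1 + m/j) and ∏ (1 − m/j) over 1 ≤ j < p have a factor divisible by p.
  w-∣ᵖ : ∀ m → p ∤ m → 2 ∣ᵖ w (ℕ.pred p) (fromℕ m)
  w-∣ᵖ m p∤m = subst (2 ∣ᵖ_) (sym (w≡v*v (ℕ.pred p) (fromℕ m)))
    -- With r = m mod p, the factor 1 + m/j is divisible by p at j = p - r, and 1 - m/j at j = r.
    (∣ᵖ-* (residue (p ∸ r) 0<p∸r (ℕₚ.∸-monoʳ-< 0<r (ℕₚ.<⇒≤ r<p)) (fromℕ-integral m) plus)
          (residue r 0<r r<p (neg-integral (fromℕ-integral m)) minus))
    where
    r = m % p
    r<p : r ℕ.< p
    r<p = m%n<n m p
    m≡ : m ≡ r ℕ.+ (m ℕ./ p) ℕ.* p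
    m≡ = m≡m%n+[m/n]*n m p
    0<r : 0 ℕ.< r
    0<r = ℕₚ.n≢0⇒n>0 (λ r≡0 → p∤m (divides (m ℕ./ p) (trans m≡ (cong (ℕ._+ (m ℕ./ p) ℕ.* p) r≡0))))
    0<p∸r : 0 ℕ.< p ∸ r
    0<p∸r = ℕₚ.m<n⇒0<n∸m r<p
    residue : ∀ {y} j → 0 ℕ.< j → j ℕ.< p → Integral y → 1 ∣ᵖ (fromℕ j + y) → 1 ∣ᵖ v y (ℕ.pred p)
    residue {y} (suc i) _ j<p Iy d = v-∣ᵖ i (ℕ.pred p) (ℕₚ.≤-pred (subst (suc i ℕ.<_) (sym (ℕₚ.suc-pred p)) j<p))
      (ℕₚ.≤-reflexive (ℕₚ.suc-pred p)) Iy (subst (1 ∣ᵖ_) eq (∣ᵖ-*ˡ (/-integral 1ℤ (suc i) (<⇒∤ i j<p)) d))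
      where
      eq : (1ℤ / suc i) * (fromℕ (suc i) + y) ≡ 1ℚ + y * (1ℤ / suc i)
      eq = trans (s (1ℤ / suc i) (fromℕ (suc i)) y) (cong (_+ y * (1ℤ / suc i)) (/-*-cancel 1ℤ (suc i)))
        where
        s : ∀ a b y → a * (b + y) ≡ a * b + y * a
        s = solve-∀ ℚ-ring
    plus : 1 ∣ᵖ (fromℕ (p ∸ r) + fromℕ m)
    plus = subst (1 ∣ᵖ_) (fromℕ-+ (p ∸ r) m) (∣⇒∣ᵖ (divides (suc (m ℕ./ p)) (begin
      p ∸ r ℕ.+ m                              ≡⟨ cong (p ∸ r ℕ.+_) m≡ ⟩
      p ∸ r ℕ.+ (r ℕ.+ (m ℕ./ p) ℕ.* p)        ≡⟨ ℕₚ.+-assoc (p ∸ r) r _ ⟨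
      p ∸ r ℕ.+ r ℕ.+ (m ℕ./ p) ℕ.* p          ≡⟨ cong (ℕ._+ (m ℕ./ p) ℕ.* p) (ℕₚ.m∸n+n≡m (ℕₚ.<⇒≤ r<p)) ⟩
      p ℕ.+ (m ℕ./ p) ℕ.* p                    ∎)))
    minus : 1 ∣ᵖ (fromℕ r + - fromℕ m)
    minus = subst (1 ∣ᵖ_) eq (∣ᵖ-neg (∣⇒∣ᵖ (divides (m ℕ./ p) refl)))
      where
      s : ∀ a b → - b ≡ a + - (a + b)
      s = solve-∀ ℚ-ring
      eq : - fromℕ ((m ℕ./ p) ℕ.* p) ≡ fromℕ r + - fromℕ m
      eq = trans (s (fromℕ r) (fromℕ ((m ℕ./ p) ℕ.* p)))
        (cong (λ u → fromℕ r + - u) (trans (sym (fromℕ-+ r ((m ℕ./ p) ℕ.* p))) (cong fromℕ (sym m≡))))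

  -- The congruence S(x) ≡ -Eₙ(-x) on ℤ₍ₚ₎

  module EulerCongruence (j n : ℕ) (j≤2 : j ℕ.≤ 2) (n≢0 : NonZero n) (even : -1ℚ ^ n ≡ 1ℚ)
    (unit-power : ∀ m → p ∤ m → fromℕ m ^ (2 ℕ.+ n) ≈ 1ℚ mod j) where

    E : ℚ → ℚ
    E x = eulerPoly n (- x)

    E-reflection : ∀ x → E (- 1ℚ - x) ≡ E x
    E-reflection x = begin
      eulerPoly n (- (- 1ℚ - x))          ≡⟨ cong (eulerPoly n) (r x) ⟩
      eulerPoly n (1ℚ - - x)              ≡⟨ eulerPoly-reflection n (- x) ⟩
      -1ℚ ^ n * eulerPoly n (- x)         ≡⟨ cong (_* eulerPoly n (- x)) even ⟩
      1ℚ * eulerPoly n (- x)              ≡⟨ ℚₚ.*-identityˡ (eulerPoly n (- x)) ⟩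
      eulerPoly n (- x)                   ∎
      where
      r : ∀ x → - (- 1ℚ - x) ≡ 1ℚ - - x
      r = solve-∀ ℚ-ring

    E-recurrence : ∀ x → E x + E (x - 1ℚ) ≡ fromℕ 2 * x ^ n
    E-recurrence x = begin
      eulerPoly n (- x) + eulerPoly n (- (x - 1ℚ))     ≡⟨ ℚₚ.+-comm (eulerPoly n (- x)) _ ⟩
      eulerPoly n (- (x - 1ℚ)) + eulerPoly n (- x)     ≡⟨ cong (λ y → eulerPoly n y + eulerPoly n (- x)) (r x) ⟩
      eulerPoly n (1ℚ + - x) + eulerPoly n (- x)       ≡⟨ eulerPoly-recurrence n (- x) ⟩
      fromℕ 2 * (- x) ^ n                              ≡⟨ cong (λ y → fromℕ 2 * y ^ n) (r′ x) ⟩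
      fromℕ 2 * (- 1ℚ * x) ^ n                         ≡⟨ cong (fromℕ 2 *_) (trans (^-distrib-* (- 1ℚ) x n) (trans (cong (_* x ^ n) even) (ℚₚ.*-identityˡ (x ^ n)))) ⟩
      fromℕ 2 * x ^ n                                  ∎
      where
      r : ∀ x → - (x - 1ℚ) ≡ 1ℚ + - x
      r = solve-∀ ℚ-ring
      r′ : ∀ x → - x ≡ - 1ℚ * x
      r′ = solve-∀ ℚ-ring

    0^n≡0 : 0ℚ ^ n ≡ 0ℚ
    0^n≡0 = trans (cong (0ℚ ^_) (sym (ℕₚ.suc-pred n {{n≢0}}))) (ℚₚ.*-zeroˡ (0ℚ ^ ℕ.pred n))

    -- Reflection identifies the values at 0 and -1, and the recurrence at 0 makes their sum 2 · 0ⁿ,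
    -- which is 0 for positive n.
    E-at-0 : E 0ℚ ≡ 0ℚ
    E-at-0 = *-cancelʳ-fromℕ 2 (begin
      E 0ℚ * fromℕ 2           ≡⟨ r (E 0ℚ) ⟩
      E 0ℚ + E 0ℚ              ≡⟨ cong (_+_ (E 0ℚ)) (E-reflection 0ℚ) ⟨
      E 0ℚ + E (- 1ℚ - 0ℚ)     ≡⟨⟩
      E 0ℚ + E (0ℚ - 1ℚ)       ≡⟨ E-recurrence 0ℚ ⟩
      fromℕ 2 * 0ℚ ^ n         ≡⟨ cong (fromℕ 2 *_) 0^n≡0 ⟩
      fromℕ 2 * 0ℚ             ≡⟨⟩
      0ℚ * fromℕ 2             ∎)
      where
      r : ∀ x → x * fromℕ 2 ≡ x + x
      r = solve-∀ ℚ-ring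

    D : ℚ → ℚ
    D x = S p x + E x

    D-polynomial : Polynomial D
    D-polynomial = S-polynomial ⊕ eulerPoly-polynomial n

    D-reflection : ∀ x → D (- 1ℚ - x) ≡ D x
    D-reflection x = cong₂ _+_ (S-reflection p x) (E-reflection x)

    D-at-0 : D 0ℚ ≡ 0ℚ
    D-at-0 = cong₂ _+_ (S-at-0 p) E-at-0

    -- With s = S(x) + S(x - 1), the identity s + 2xⁿ = -s(xⁿ⁺² - 1) + xⁿ(x²s + 2) avoids dividing
    -- by x². The first bracket vanishes by `unit-power`, the second is a multiple of `w` by
    -- `S-recurrence`.
    S-recurrence-≈ : ∀ m → p ∤ m → S p (fromℕ m) + S p (fromℕ m - 1ℚ) ≈ - (fromℕ 2 * fromℕ m ^ n) mod j
    S-recurrence-≈ m p∤m = diff (subst (j ∣ᵖ_) (r s x (x ^ n))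
      (∣ᵖ-+ (∣ᵖ-*ˡ Is (∣ᵖ-neg (∣-diff (unit-power m p∤m)))) (∣ᵖ-*ˡ (^-integral n Ix) (∣ᵖ-weaken j≤2 x²s+2))))
      where
      x = fromℕ m
      Ix = fromℕ-integral m
      s = S p x + S p (x - 1ℚ)
      Is : Integral s
      Is = +-integral (Polynomial-integral S-polynomial Ix) (Polynomial-integral S-polynomial (minus-integral Ix (fromℕ-integral 1)))
      x²s+2 : 2 ∣ᵖ (x * x * s + fromℕ 2)
      x²s+2 = subst (2 ∣ᵖ_) eq (∣ᵖ-*ʳ (∣ᵖ-*ˡ (fromℕ-integral 2) (w-∣ᵖ m p∤m))
        (+-integral (fromℕ-integral 1) (*-integral (*-integral Ix Ix) (H-integral (ℕ.pred p) (ℕₚ.≤-reflexive (ℕₚ.suc-pred p))))))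
        where
        c = fromℕ 2 * w (ℕ.pred p) x * (1ℚ + x * x * H⁽²⁾ (ℕ.pred p))
        r′ : ∀ c → c ≡ (c - fromℕ 2) + fromℕ 2
        r′ = solve-∀ ℚ-ring
        eq : c ≡ x * x * s + fromℕ 2
        eq = trans (r′ c) (cong (_+ fromℕ 2) (sym (subst (λ N → x * x * (S N x + S N (x - 1ℚ)) ≡ c - fromℕ 2) (ℕₚ.suc-pred p) (S-recurrence (ℕ.pred p) x))))
      r : ∀ s x y → s * - (x * (x * y) - 1ℚ) + y * (x * x * s + fromℕ 2) ≡ s - - (fromℕ 2 * y)
      r = solve-∀ ℚ-ring

    D-step : ∀ m → p ∤ suc m → j ∣ᵖ D (fromℕ m) → j ∣ᵖ D (fromℕ (suc m))
    D-step m p∤1+m d = subst (j ∣ᵖ_) eq (∣ᵖ-+ (∣-diff (S-recurrence-≈ (suc m) p∤1+m)) (∣ᵖ-neg d))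
      where
      x = fromℕ (suc m)
      x-1 : x - 1ℚ ≡ fromℕ m
      x-1 = trans (cong (_- 1ℚ) (fromℕ-suc m)) (r (fromℕ m))
        where
        r : ∀ x → (x + 1ℚ) - 1ℚ ≡ x
        r = solve-∀ ℚ-ring
      eq : (S p x + S p (x - 1ℚ)) - - (fromℕ 2 * x ^ n) + - D (fromℕ m) ≡ D x
      eq = begin
        (S p x + S p (x - 1ℚ)) - - (fromℕ 2 * x ^ n) + - D (fromℕ m)
          ≡⟨ cong₂ (λ u y → (S p x + S p (x - 1ℚ)) - - u + - D y) (sym (E-recurrence x)) (sym x-1) ⟩
        (S p x + S p (x - 1ℚ)) - - (E x + E (x - 1ℚ)) + - (S p (x - 1ℚ) + E (x - 1ℚ))
          ≡⟨ r (S p x) (S p (x - 1ℚ)) (E x) (E (x - 1ℚ)) ⟩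
        S p x + E x ∎
        where
        r : ∀ a b c d → (a + b) - - (c + d) + - (b + d) ≡ a + c
        r = solve-∀ ℚ-ring

    -- The recurrence is available only at arguments prime to p, so vanishing at ap is carried up to
    -- ap + p - 1 and no further.
    D-block : ∀ a r → r ℕ.< p → j ∣ᵖ D (fromℕ (a ℕ.* p)) → j ∣ᵖ D (fromℕ (r ℕ.+ a ℕ.* p))
    D-block a zero    r<p d = d
    D-block a (suc r) r<p d = D-step (r ℕ.+ a ℕ.* p) p∤ (D-block a r (ℕₚ.<-trans (ℕₚ.n<1+n r) r<p) d)
      where
      p∤ : p ∤ suc (r ℕ.+ a ℕ.* p)
      p∤ p∣ = <⇒∤ r r<p (∣.∣m+n∣m⇒∣n {m = a ℕ.* p} (subst (p ∣_) (ℕₚ.+-comm (suc r) (a ℕ.* p)) p∣) (divides a refl))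

    -- D(p − 1) ≡ D(0) = 0, and D(p − 1) = D(−p) by reflection; so the linear coefficient of D at 0 vanishes modulo p.
    D-multiple : ∀ a → j ∣ᵖ D (fromℕ (a ℕ.* p))
    D-multiple a = subst (λ y → j ∣ᵖ D y) (trans (ℚₚ.*-comm (fromℕ p) (fromℕ a)) (sym (fromℕ-* a p)))
      (≈-resp-∣ᵖ (D-linear (fromℕ a) (fromℕ-integral a)) (subst (j ∣ᵖ_) (r b (fromℕ p) (fromℕ a)) (∣ᵖ-neg (∣ᵖ-*ˡ (fromℕ-integral a) bp))))
      where
      open Linear (Polynomial-linear D-polynomial) renaming (slope to b)
      D-linear : ∀ h → Integral h → D (fromℕ p * h) ≈ b * (fromℕ p * h) mod j
      D-linear h Ih = ≈-trans (≈-weaken j≤2 (linear-≈ h Ih))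
        (≈-reflexive (trans (cong (_+ b * (fromℕ p * h)) D-at-0) (ℚₚ.+-identityˡ _)))
      D[p-1] : j ∣ᵖ D (fromℕ (ℕ.pred p))
      D[p-1] = subst (λ m → j ∣ᵖ D (fromℕ m)) (ℕₚ.+-identityʳ (ℕ.pred p))
        (D-block 0 (ℕ.pred p) (ℕₚ.≤-reflexive (ℕₚ.suc-pred p)) (subst (j ∣ᵖ_) (sym D-at-0) ∣ᵖ-0))
      -p≡ : - 1ℚ - fromℕ (ℕ.pred p) ≡ fromℕ p * - 1ℚ
      -p≡ = trans (s (fromℕ (ℕ.pred p))) (cong (_* - 1ℚ) (trans (sym (fromℕ-suc (ℕ.pred p))) (cong fromℕ (ℕₚ.suc-pred p))))
        where
        s : ∀ x → - 1ℚ - x ≡ (x + 1ℚ) * - 1ℚ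
        s = solve-∀ ℚ-ring
      D[-p] : j ∣ᵖ D (fromℕ p * - 1ℚ)
      D[-p] = subst (j ∣ᵖ_) (trans (sym (D-reflection (fromℕ (ℕ.pred p)))) (cong D -p≡)) D[p-1]
      bp : j ∣ᵖ (b * (fromℕ p * - 1ℚ))
      bp = ≈-resp-∣ᵖ (≈-sym (D-linear (- 1ℚ) (neg-integral (fromℕ-integral 1)))) D[-p]
      r : ∀ b p a → - (a * (b * (p * - 1ℚ))) ≡ b * (p * a)
      r = solve-∀ ℚ-ring

    D-natural : ∀ m → j ∣ᵖ D (fromℕ m)
    D-natural m = subst (λ k → j ∣ᵖ D (fromℕ k)) (sym (m≡m%n+[m/n]*n m p))
      (D-block (m ℕ./ p) (m % p) (m%n<n m p) (D-multiple (m ℕ./ p)))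

    S≈-E : ∀ x → Integral x → S p x ≈ - eulerPoly n (- x) mod j
    S≈-E x Ix = diff (subst (j ∣ᵖ_) (r (S p x) (E x)) D-x)
      where
      m = dense 2 Ix
      D-x : j ∣ᵖ D x
      D-x = ≈-resp-∣ᵖ (Polynomial-cong D-polynomial Ix (fromℕ-integral (proj₁ m)) (≈-weaken (ℕₚ.≤-trans j≤2 (s≤s (s≤s z≤n))) (proj₂ m)))
                      (D-natural (proj₁ m))
      r : ∀ s e → s + e ≡ s - - e
      r = solve-∀ ℚ-ring

-1^[2+n] : ∀ n → -1ℚ ^ (2 ℕ.+ n) ≡ -1ℚ ^ n
-1^[2+n] n = r (-1ℚ ^ n)
  where
  r : ∀ z → - 1ℚ * (- 1ℚ * z) ≡ z
  r = solve-∀ ℚ-ring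

-- The exponents p - 3 and p² - p - 2, and the duplication relations

module Proof (p : ℕ) (p-prime : Prime p) (3<p : 3 ℕ.< p) where

  open Sums p p-prime 3<p

  n₁ n₂ : ℕ
  n₁ = p ∸ 3
  n₂ = p ℕ.^ 2 ∸ p ∸ 2

  2+n₁≡ : 2 ℕ.+ n₁ ≡ ℕ.pred p ℕ.* p ℕ.^ 0
  2+n₁≡ = trans (ℕₚ.suc-injective (trans (ℕₚ.m+[n∸m]≡n (ℕₚ.<⇒≤ 3<p)) (sym (ℕₚ.suc-pred p)))) (sym (ℕₚ.*-identityʳ (ℕ.pred p)))

  p+[2+n₂]≡p² : p ℕ.+ (2 ℕ.+ n₂) ≡ p ℕ.^ 2
  p+[2+n₂]≡p² = begin
    p ℕ.+ (2 ℕ.+ n₂)                        ≡⟨ ℕₚ.+-assoc p 2 n₂ ⟨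
    p ℕ.+ 2 ℕ.+ n₂                          ≡⟨ cong (p ℕ.+ 2 ℕ.+_) (ℕₚ.∸-+-assoc (p ℕ.^ 2) p 2) ⟩
    p ℕ.+ 2 ℕ.+ (p ℕ.^ 2 ∸ (p ℕ.+ 2))       ≡⟨ ℕₚ.m+[n∸m]≡n p+2≤p² ⟩
    p ℕ.^ 2                                 ∎
    where
    2≤p : 2 ℕ.≤ p
    2≤p = ℕₚ.≤-trans (ℕₚ.m≤n+m 2 2) 3<p
    p+2≤p² : p ℕ.+ 2 ℕ.≤ p ℕ.^ 2
    p+2≤p² = ℕₚ.≤-trans (ℕₚ.+-monoʳ-≤ p 2≤p) (subst (ℕ._≤ p ℕ.^ 2) (2k≡k+k p)
      (subst (2 ℕ.* p ℕ.≤_) (cong (p ℕ.*_) (sym (ℕₚ.*-identityʳ p))) (ℕₚ.*-monoˡ-≤ p 2≤p)))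

  p²∸p≡2+n₂ : p ℕ.^ 2 ∸ p ≡ 2 ℕ.+ n₂
  p²∸p≡2+n₂ = trans (cong (_∸ p) (sym p+[2+n₂]≡p²)) (ℕₚ.m+n∸m≡n p (2 ℕ.+ n₂))

  2+n₂≡ : 2 ℕ.+ n₂ ≡ ℕ.pred p ℕ.* p ℕ.^ 1
  2+n₂≡ = ℕₚ.+-cancelˡ-≡ p _ _ (trans p+[2+n₂]≡p² (trans (cong (λ m → m ℕ.* (p ℕ.* 1)) (sym (ℕₚ.suc-pred p))) (r p (ℕ.pred p))))
    where
    r : ∀ p m → suc m ℕ.* (p ℕ.* 1) ≡ p ℕ.+ m ℕ.* (p ℕ.* 1)
    r = ℕ-solve-∀

  n₁≢0 : NonZero n₁
  n₁≢0 = ℕ.>-nonZero (ℕₚ.m<n⇒0<n∸m 3<p)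

  n₂≢0 : NonZero n₂
  -- If p² - p - 2 were 0, then 2 = (p - 1)p would be divisible by p.
  n₂≢0 = ℕ.≢-nonZero (λ n₂≡0 → p∤2 (divides (ℕ.pred p)
    (trans (cong (2 ℕ.+_) (sym n₂≡0)) (trans 2+n₂≡ (cong (ℕ.pred p ℕ.*_) (ℕₚ.*-identityʳ p))))))

  -1^[p-1]≡1 : -1ℚ ^ ℕ.pred p ≡ 1ℚ
  -1^[p-1]≡1 = from-remainder (p % 2) (m%n<n p 2) (m≡m%n+[m/n]*n p 2)
    where
    h = p ℕ./ 2
    from-remainder : ∀ r → r ℕ.< 2 → p ≡ r ℕ.+ h ℕ.* 2 → -1ℚ ^ ℕ.pred p ≡ 1ℚ
    from-remainder zero          _ p≡ = contradiction (prime⇒irreducible p-prime (divides h p≡))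
      [ (λ ()) , (λ 2≡p → ℕₚ.<⇒≢ (ℕₚ.<-trans (ℕₚ.n<1+n 2) 3<p) 2≡p) ]′
    from-remainder (suc zero)    _ p≡ = begin
      -1ℚ ^ ℕ.pred p       ≡⟨ cong (λ m → -1ℚ ^ ℕ.pred m) p≡ ⟩
      -1ℚ ^ (h ℕ.* 2)      ≡⟨ cong (-1ℚ ^_) (ℕₚ.*-comm h 2) ⟩
      -1ℚ ^ (2 ℕ.* h)      ≡⟨ ^-assocʳ -1ℚ 2 h ⟨
      1ℚ ^ h               ≡⟨ 1^n≡1 h ⟩
      1ℚ                   ∎
    from-remainder (suc (suc r)) (s≤s (s≤s ())) p≡

  even-exponent : ∀ n k → 2 ℕ.+ n ≡ ℕ.pred p ℕ.* k → -1ℚ ^ n ≡ 1ℚ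
  even-exponent n k eq = begin
    -1ℚ ^ n                     ≡⟨ -1^[2+n] n ⟨
    -1ℚ ^ (2 ℕ.+ n)             ≡⟨ cong (-1ℚ ^_) eq ⟩
    -1ℚ ^ (ℕ.pred p ℕ.* k)      ≡⟨ ^-assocʳ -1ℚ (ℕ.pred p) k ⟨
    (-1ℚ ^ ℕ.pred p) ^ k        ≡⟨ cong (_^ k) -1^[p-1]≡1 ⟩
    1ℚ ^ k                      ≡⟨ 1^n≡1 k ⟩
    1ℚ                          ∎

  even₁ : -1ℚ ^ n₁ ≡ 1ℚ
  even₁ = even-exponent n₁ (p ℕ.^ 0) 2+n₁≡

  even₂ : -1ℚ ^ n₂ ≡ 1ℚ
  even₂ = even-exponent n₂ (p ℕ.^ 1) 2+n₂≡

  unit-power₁ : ∀ m → p ∤ m → fromℕ m ^ (2 ℕ.+ n₁) ≈ 1ℚ mod 1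
  unit-power₁ m p∤m = subst (λ k → fromℕ m ^ k ≈ 1ℚ mod 1) (sym 2+n₁≡) (euler-theorem m 0 p∤m)

  unit-power₂ : ∀ m → p ∤ m → fromℕ m ^ (2 ℕ.+ n₂) ≈ 1ℚ mod 2
  unit-power₂ m p∤m = subst (λ k → fromℕ m ^ k ≈ 1ℚ mod 2) (sym 2+n₂≡) (euler-theorem m 1 p∤m)

  module E₁ = EulerCongruence 1 n₁ (s≤s z≤n) n₁≢0 even₁ unit-power₁
  module E₂ = EulerCongruence 2 n₂ ℕₚ.≤-refl n₂≢0 even₂ unit-power₂

  p∤4 : p ∤ 4
  p∤4 = ∤-* 2 2 p∤2 p∤2

  p∤6 : p ∤ 6
  p∤6 = ∤-* 2 3 p∤2 p∤3

  I½ : Integral ½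
  I½ = /-integral 1ℤ 2 p∤2

  S-integral : ∀ {x} → Integral x → Integral (S p x)
  S-integral = Polynomial-integral S-polynomial

  -- By `U-difference` this is also U(x) - U(x - 1), so one congruence for `s` governs the
  -- differences of both functions.
  s : ℚ → ℚ
  s x = S p x + S p (x - 1ℚ)

  s≈ : ∀ x → Integral x → s x ≈ - (fromℕ 2 * x ^ n₂) mod 2
  s≈ x Ix = ≈-trans (≈-+ (E₂.S≈-E x Ix) (E₂.S≈-E (x - 1ℚ) (minus-integral Ix (fromℕ-integral 1))))
    (≈-reflexive (trans (sym (ℚₚ.neg-distrib-+ (E₂.E x) (E₂.E (x - 1ℚ)))) (cong (-_) (E₂.E-recurrence x))))

  -- As s(x) ≡ -2xⁿ, doubling x multiplies by 2ⁿ, and 4 · 2ⁿ = 2ⁿ⁺² ≡ 1.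
  s-double : ∀ x → Integral x → fromℕ 4 * s (fromℕ 2 * x) ≈ s x mod 2
  s-double x Ix = ≈-trans (≈-*ˡ (fromℕ 4) (fromℕ-integral 4) (s≈ (fromℕ 2 * x) (*-integral (fromℕ-integral 2) Ix)))
    (≈-trans (diff (subst (2 ∣ᵖ_) eq (∣ᵖ-*ˡ (neg-integral (*-integral (fromℕ-integral 2) (^-integral n₂ Ix))) (∣-diff (unit-power₂ 2 p∤2)))))
      (≈-sym (s≈ x Ix)))
    where
    r : ∀ a b → - (fromℕ 2 * b) * (fromℕ 2 * (fromℕ 2 * a) - 1ℚ) ≡ fromℕ 4 * - (fromℕ 2 * (a * b)) - - (fromℕ 2 * b)
    r = solve-∀ ℚ-ring
    eq : - (fromℕ 2 * x ^ n₂) * (fromℕ 2 ^ (2 ℕ.+ n₂) - 1ℚ) ≡ fromℕ 4 * - (fromℕ 2 * (fromℕ 2 * x) ^ n₂) - - (fromℕ 2 * x ^ n₂)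
    eq = trans (r (fromℕ 2 ^ n₂) (x ^ n₂)) (cong (λ u → fromℕ 4 * - (fromℕ 2 * u) - - (fromℕ 2 * x ^ n₂)) (sym (^-distrib-* (fromℕ 2) x n₂)))

  -- Periodicity modulo p² carries the zero at 0 to all natural numbers, and `dense` supplies one of
  -- these modulo p³ near any x. The hypothesis on f is the form of continuity that `U-cong`
  -- provides.
  vanishes : ∀ (f : ℚ → ℚ) → (∀ {x y} → Integral x → Integral y → x ≈ y mod 3 → f x ≈ f y mod 2) →
    f 0ℚ ≈ 0ℚ mod 2 → (∀ x → Integral x → f x ≈ f (x - 1ℚ) mod 2) → ∀ x → Integral x → 2 ∣ᵖ f x
  vanishes f f-cong f-0 f-step x Ix = ≈0⇒∣ᵖ (≈-trans (f-cong Ix (fromℕ-integral (proj₁ m)) (proj₂ m)) (natural (proj₁ m)))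
    where
    m = dense 2 Ix
    natural : ∀ m → f (fromℕ m) ≈ 0ℚ mod 2
    natural zero    = f-0
    natural (suc m) = ≈-trans (f-step (fromℕ (suc m)) (fromℕ-integral (suc m)))
      (≈-trans (≈-reflexive (cong f (trans (cong (_- 1ℚ) (fromℕ-suc m)) (r (fromℕ m))))) (natural m))
      where
      r : ∀ y → (y + 1ℚ) - 1ℚ ≡ y
      r = solve-∀ ℚ-ring

  Γ Δ : ℚ → ℚ
  Γ x = fromℕ 4 * S p (fromℕ 2 * x) - U p x + U p (x - ½)
  Δ x = fromℕ 4 * U p (fromℕ 2 * x + 1ℚ) - U p x - U p (x + ½)

  ≈-- : ∀ {j a b c d} → a ≈ b mod j → c ≈ d mod j → a - c ≈ b - d mod j
  ≈-- a≈b c≈d = ≈-+ a≈b (≈-neg c≈d)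

  Γ-vanishes : ∀ x → Integral x → 2 ∣ᵖ Γ x
  Γ-vanishes = vanishes Γ cong-Γ (≈-reflexive Γ-0) step
    where
    cong-Γ : ∀ {x y} → Integral x → Integral y → x ≈ y mod 3 → Γ x ≈ Γ y mod 2
    cong-Γ Ix Iy x≈y = ≈-+ (≈-- (≈-*ˡ (fromℕ 4) (fromℕ-integral 4)
        (Polynomial-cong S-polynomial (*-integral (fromℕ-integral 2) Ix) (*-integral (fromℕ-integral 2) Iy)
          (≈-weaken (ℕₚ.n≤1+n 2) (≈-*ˡ (fromℕ 2) (fromℕ-integral 2) x≈y))))
        (U-cong Ix Iy x≈y))
      (U-cong (minus-integral Ix I½) (minus-integral Iy I½) (≈-+ x≈y ≈-refl))
    Γ-0 : Γ 0ℚ ≡ 0ℚ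
    Γ-0 = trans (cong₂ _+_ (cong₂ (λ u v → fromℕ 4 * u - v) (S-at-0 p) (U-at-0 p)) (U-at-−½ p)) refl
    step : ∀ x → Integral x → Γ x ≈ Γ (x - 1ℚ) mod 2
    -- Γ(x) - Γ(x - 1) is the defect 4s(2x) - s(x) at x minus the same defect at x - 1/2.
    step x Ix = diff (subst (2 ∣ᵖ_) eq (∣ᵖ-+ (∣-diff (s-double x Ix)) (∣ᵖ-neg (∣-diff (s-double (x - ½) (minus-integral Ix I½))))))
      where
      S₀ = S p (fromℕ 2 * x)
      S₁ = S p (fromℕ 2 * x - 1ℚ)
      S₂′ = S p (fromℕ 2 * (x - 1ℚ))
      r₁ : ∀ x → fromℕ 2 * (x - ½) ≡ fromℕ 2 * x - 1ℚ
      r₁ = solve-∀ ℚ-ring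
      r₂ : ∀ x → fromℕ 2 * (x - ½) - 1ℚ ≡ fromℕ 2 * (x - 1ℚ)
      r₂ = solve-∀ ℚ-ring
      r₃ : ∀ x → (x - ½) - 1ℚ ≡ (x - 1ℚ) - ½
      r₃ = solve-∀ ℚ-ring
      r : ∀ a b c u u′ v v′ → (fromℕ 4 * (a + b) - (u - u′)) + - (fromℕ 4 * (b + c) - (v - v′)) ≡
          (fromℕ 4 * a - u + v) - (fromℕ 4 * c - u′ + v′)
      r = solve-∀ ℚ-ring
      eq : (fromℕ 4 * s (fromℕ 2 * x) - s x) + - (fromℕ 4 * s (fromℕ 2 * (x - ½)) - s (x - ½)) ≡ Γ x - Γ (x - 1ℚ)
      eq = begin
        (fromℕ 4 * (S₀ + S₁) - s x) + - (fromℕ 4 * s (fromℕ 2 * (x - ½)) - s (x - ½))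
          ≡⟨ cong₂ (λ u v → (fromℕ 4 * (S₀ + S₁) - u) + - (fromℕ 4 * s (fromℕ 2 * (x - ½)) - v)) (sym (U-difference p x)) (sym (U-difference p (x - ½))) ⟩
        (fromℕ 4 * (S₀ + S₁) - (U p x - U p (x - 1ℚ))) + - (fromℕ 4 * s (fromℕ 2 * (x - ½)) - (U p (x - ½) - U p ((x - ½) - 1ℚ)))
          ≡⟨ cong₂ (λ u v → (fromℕ 4 * (S₀ + S₁) - (U p x - U p (x - 1ℚ))) + - (fromℕ 4 * u - (U p (x - ½) - v)))
               (cong₂ _+_ (cong (S p) (r₁ x)) (cong (S p) (r₂ x))) (cong (U p) (r₃ x)) ⟩
        (fromℕ 4 * (S₀ + S₁) - (U p x - U p (x - 1ℚ))) + - (fromℕ 4 * (S₁ + S₂′) - (U p (x - ½) - U p ((x - 1ℚ) - ½)))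
          ≡⟨ r S₀ S₁ S₂′ (U p x) (U p (x - 1ℚ)) (U p (x - ½)) (U p ((x - 1ℚ) - ½)) ⟩
        Γ x - Γ (x - 1ℚ) ∎

  Δ-vanishes : ∀ x → Integral x → 2 ∣ᵖ Δ x
  Δ-vanishes = vanishes Δ cong-Δ Δ-0 step
    where
    cong-Δ : ∀ {x y} → Integral x → Integral y → x ≈ y mod 3 → Δ x ≈ Δ y mod 2
    cong-Δ Ix Iy x≈y = ≈-- (≈-- (≈-*ˡ (fromℕ 4) (fromℕ-integral 4)
        (U-cong (+-integral (*-integral (fromℕ-integral 2) Ix) (fromℕ-integral 1)) (+-integral (*-integral (fromℕ-integral 2) Iy) (fromℕ-integral 1))
          (≈-+ (≈-*ˡ (fromℕ 2) (fromℕ-integral 2) x≈y) ≈-refl)))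
        (U-cong Ix Iy x≈y))
      (U-cong (+-integral Ix I½) (+-integral Iy I½) (≈-+ x≈y ≈-refl))
    Δ-0 : Δ 0ℚ ≈ 0ℚ mod 2
    -- Because U vanishes at 0 and at -1/2, Δ(0) equals 4s(1) - s(1/2), the duplication defect at
    -- 1/2.
    Δ-0 = ∣ᵖ⇒≈0 (subst (2 ∣ᵖ_) eq (∣-diff (s-double ½ I½)))
      where
      r : ∀ a b → fromℕ 4 * (a - 0ℚ) - (b - 0ℚ) ≡ fromℕ 4 * a - 0ℚ - b
      r = solve-∀ ℚ-ring
      eq : fromℕ 4 * s 1ℚ - s ½ ≡ Δ 0ℚ
      eq = begin
        fromℕ 4 * s 1ℚ - s ½
          ≡⟨ cong₂ (λ u v → fromℕ 4 * u - v) (U-difference p 1ℚ) (U-difference p ½) ⟨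
        fromℕ 4 * (U p 1ℚ - U p 0ℚ) - (U p ½ - U p (- ½))
          ≡⟨ cong₂ (λ u v → fromℕ 4 * (U p 1ℚ - u) - (U p ½ - v)) (U-at-0 p) (U-at-−½ p) ⟩
        fromℕ 4 * (U p 1ℚ - 0ℚ) - (U p ½ - 0ℚ)
          ≡⟨ r (U p 1ℚ) (U p ½) ⟩
        fromℕ 4 * U p 1ℚ - 0ℚ - U p ½
          ≡⟨ cong (λ u → fromℕ 4 * U p 1ℚ - u - U p ½) (U-at-0 p) ⟨
        Δ 0ℚ ∎
    step : ∀ x → Integral x → Δ x ≈ Δ (x - 1ℚ) mod 2
    -- Δ(x) - Δ(x - 1) is the sum of the duplication defects at x + 1/2 and at x.
    step x Ix = diff (subst (2 ∣ᵖ_) eq (∣ᵖ-+ (∣-diff (s-double (x + ½) (+-integral Ix I½))) (∣-diff (s-double x Ix))))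
      where
      y = fromℕ 2 * x
      r₁ : ∀ x → fromℕ 2 * (x + ½) ≡ fromℕ 2 * x + 1ℚ
      r₁ = solve-∀ ℚ-ring
      r₂ : ∀ y → (y + 1ℚ) - 1ℚ ≡ y
      r₂ = solve-∀ ℚ-ring
      r₃ : ∀ x → fromℕ 2 * x - 1ℚ ≡ fromℕ 2 * (x - 1ℚ) + 1ℚ
      r₃ = solve-∀ ℚ-ring
      r₄ : ∀ x → (x + ½) - 1ℚ ≡ (x - 1ℚ) + ½
      r₄ = solve-∀ ℚ-ring
      r : ∀ a b c u u′ v v′ → (fromℕ 4 * (a - b) - (v - v′)) + (fromℕ 4 * (b - c) - (u - u′)) ≡
          (fromℕ 4 * a - u - v) - (fromℕ 4 * c - u′ - v′)
      r = solve-∀ ℚ-ring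
      eq : (fromℕ 4 * s (fromℕ 2 * (x + ½)) - s (x + ½)) + (fromℕ 4 * s y - s x) ≡ Δ x - Δ (x - 1ℚ)
      eq = begin
        (fromℕ 4 * s (fromℕ 2 * (x + ½)) - s (x + ½)) + (fromℕ 4 * s y - s x)
          ≡⟨ cong₂ _+_ (cong₂ (λ u v → fromℕ 4 * u - v) (trans (cong s (r₁ x)) (sym (U-difference p (y + 1ℚ)))) (sym (U-difference p (x + ½))))
                       (cong₂ (λ u v → fromℕ 4 * u - v) (sym (U-difference p y)) (sym (U-difference p x))) ⟩
        (fromℕ 4 * (U p (y + 1ℚ) - U p ((y + 1ℚ) - 1ℚ)) - (U p (x + ½) - U p ((x + ½) - 1ℚ))) + (fromℕ 4 * (U p y - U p (y - 1ℚ)) - (U p x - U p (x - 1ℚ)))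
          ≡⟨ cong₂ (λ u v → (fromℕ 4 * (U p (y + 1ℚ) - u) - (U p (x + ½) - v)) + (fromℕ 4 * (U p y - U p (y - 1ℚ)) - (U p x - U p (x - 1ℚ))))
               (cong (U p) (r₂ y)) (cong (U p) (r₄ x)) ⟩
        (fromℕ 4 * (U p (y + 1ℚ) - U p y) - (U p (x + ½) - U p ((x - 1ℚ) + ½))) + (fromℕ 4 * (U p y - U p (y - 1ℚ)) - (U p x - U p (x - 1ℚ)))
          ≡⟨ cong (λ u → (fromℕ 4 * (U p (y + 1ℚ) - U p y) - (U p (x + ½) - U p ((x - 1ℚ) + ½))) + (fromℕ 4 * (U p y - u) - (U p x - U p (x - 1ℚ))))
               (cong (U p) (r₃ x)) ⟩
        (fromℕ 4 * (U p (y + 1ℚ) - U p y) - (U p (x + ½) - U p ((x - 1ℚ) + ½))) + (fromℕ 4 * (U p y - U p (fromℕ 2 * (x - 1ℚ) + 1ℚ)) - (U p x - U p (x - 1ℚ)))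
          ≡⟨ r (U p (y + 1ℚ)) (U p y) (U p (fromℕ 2 * (x - 1ℚ) + 1ℚ)) (U p x) (U p (x - 1ℚ)) (U p (x + ½)) (U p ((x - 1ℚ) + ½)) ⟩
        Δ x - Δ (x - 1ℚ) ∎

-- For p = 5 the general argument loses a power of p through the factor 1/5, so both sides are evaluated.
module Five (p-prime : Prime 5) where

  open Congruence 5 p-prime

  -- Turns divisibility by 25 into a condition on the reduced denominator of x/25, which can be
  -- decided by computation.
  evaluate : ∀ x → 5 ∤ ↧ₙ ((+ 1 / 25) * x) → 2 ∣ᵖ x
  evaluate x 5∤ = divisible {quot = y} (integral {den = ↧ₙ y} {num = ↥ y} 5∤
      (trans (cong (_* fromℕ (↧ₙ y)) (sym (ℚₚ.↥p/↧p≡p y))) (/-*-cancel (↥ y) (↧ₙ y)))) (r x)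
    where
    y = (+ 1 / 25) * x
    r : ∀ x → x ≡ fromℕ 25 * ((+ 1 / 25) * x)
    r = solve-∀ ℚ-ring

  S₂≈S₆/5 : S 5 (- (+ 1 / 2)) ≈ (+ 1 / 5) * S 5 (- (+ 1 / 6)) mod 2
  S₂≈S₆/5 = diff (evaluate (S 5 (- (+ 1 / 2)) - (+ 1 / 5) * S 5 (- (+ 1 / 6)))
    (toWitnessFalse {a? = 5 ∣.∣? ↧ₙ ((+ 1 / 25) * (S 5 (- (+ 1 / 2)) - (+ 1 / 5) * S 5 (- (+ 1 / 6))))} _))

  S₃≈3U₆/10 : S 5 (- (+ 1 / 3)) ≈ (+ 3 / 10) * U 5 (- (+ 1 / 6)) mod 2
  S₃≈3U₆/10 = diff (evaluate (S 5 (- (+ 1 / 3)) - (+ 3 / 10) * U 5 (- (+ 1 / 6)))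
    (toWitnessFalse {a? = 5 ∣.∣? ↧ₙ ((+ 1 / 25) * (S 5 (- (+ 1 / 3)) - (+ 3 / 10) * U 5 (- (+ 1 / 6))))} _))

S₂≈S₆/5-at-5 : ∀ {p} (p-prime : Prime p) → p ≡ 5 →
  Congruence._≈_mod_ p p-prime (S p (- (+ 1 / 2))) ((+ 1 / 5) * S p (- (+ 1 / 6))) 2
S₂≈S₆/5-at-5 p-prime refl = Five.S₂≈S₆/5 p-prime

S₃≈3U₆/10-at-5 : ∀ {p} (p-prime : Prime p) → p ≡ 5 →
  Congruence._≈_mod_ p p-prime (S p (- (+ 1 / 3))) ((+ 3 / 10) * U p (- (+ 1 / 6))) 2
S₃≈3U₆/10-at-5 p-prime refl = Five.S₃≈3U₆/10 p-prime

prime[5] : Prime 5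
prime[5] = toWitness {a? = prime? 5} _

-- Values at -1/2, -1/3, -1/4 and -1/6

module Values (p : ℕ) (p-prime : Prime p) (3<p : 3 ℕ.< p) where

  open Sums p p-prime 3<p
  open Proof p p-prime 3<p

  I₂ : Integral (- (+ 1 / 2))
  I₂ = neg-integral I½

  I₃ : Integral (- (+ 1 / 3))
  I₃ = neg-integral (/-integral 1ℤ 3 p∤3)

  I₄ : Integral (- (+ 1 / 4))
  I₄ = neg-integral (/-integral 1ℤ 4 p∤4)

  I₆ : Integral (- (+ 1 / 6))
  I₆ = neg-integral (/-integral 1ℤ 6 p∤6)

  s₂ s₃ s₆ u₃ u₄ u₆ : ℚ
  s₂ = S p (- (+ 1 / 2))
  s₃ = S p (- (+ 1 / 3))
  s₆ = S p (- (+ 1 / 6))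
  u₃ = U p (- (+ 1 / 3))
  u₄ = U p (- (+ 1 / 4))
  u₆ = U p (- (+ 1 / 6))

  -- In Γ(-1/4) the arguments are 2x = -1/2 and x - 1/2 = -3/4 = -1 - x, where the odd function U
  -- takes the value -U(-1/4).
  s₂≈u₄/2 : s₂ ≈ ½ * u₄ mod 2
  s₂≈u₄/2 = diff (subst (2 ∣ᵖ_) eq (∣ᵖ-*ˡ (/-integral 1ℤ 4 p∤4) (Γ-vanishes (- (+ 1 / 4)) I₄)))
    where
    r : ∀ s u → (+ 1 / 4) * (fromℕ 4 * s - u + - u) ≡ s - ½ * u
    r = solve-∀ ℚ-ring
    eq : (+ 1 / 4) * Γ (- (+ 1 / 4)) ≡ s₂ - ½ * u₄
    eq = trans (cong (λ v → (+ 1 / 4) * (fromℕ 4 * s₂ - u₄ + v)) (U-reflection p (- (+ 1 / 4)))) (r s₂ u₄)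

  -- In Γ(-1/3) the arguments -2/3 and -5/6 reflect to -1/3 and -1/6.
  4s₃≈u₃+u₆ : 2 ∣ᵖ (fromℕ 4 * s₃ - u₃ - u₆)
  4s₃≈u₃+u₆ = subst (2 ∣ᵖ_) (cong₂ (λ a b → fromℕ 4 * a - u₃ + b) (S-reflection p (- (+ 1 / 3))) (U-reflection p (- (+ 1 / 6))))
    (Γ-vanishes (- (+ 1 / 3)) I₃)

  -- In Δ(-2/3) the arguments are 2x + 1 = -1/3, x = -2/3, which reflects to -1/3, and x + 1/2 =
  -- -1/6.
  5u₃≈u₆ : 2 ∣ᵖ (fromℕ 4 * u₃ - - u₃ - u₆)
  5u₃≈u₆ = subst (2 ∣ᵖ_) (cong (λ a → fromℕ 4 * u₃ - a - u₆) (U-reflection p (- (+ 1 / 3))))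
    (Δ-vanishes (- (+ 2 / 3)) (neg-integral (/-integral (+ 2) 3 p∤3)))

  -- Eliminates U(-1/6) between the two preceding relations.
  s₃≈3u₃/2 : s₃ ≈ (+ 3 / 2) * u₃ mod 2
  s₃≈3u₃/2 = diff (subst (2 ∣ᵖ_) (r s₃ u₃ u₆) (∣ᵖ-*ˡ (/-integral 1ℤ 4 p∤4) (∣ᵖ-+ 4s₃≈u₃+u₆ (∣ᵖ-neg 5u₃≈u₆))))
    where
    r : ∀ s u w → (+ 1 / 4) * ((fromℕ 4 * s - u - w) + - (fromℕ 4 * u - - u - w)) ≡ s - (+ 3 / 2) * u
    r = solve-∀ ℚ-ring

  ∤5 : p ≢ 5 → p ∤ 5
  ∤5 p≢5 p∣5 = [ (λ p≡1 → ℕₚ.<⇒≱ 3<p (ℕₚ.≤-trans (ℕₚ.≤-reflexive p≡1) (s≤s z≤n))) , p≢5 ]′ (prime⇒irreducible prime[5] p∣5)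

  -- Eliminates U(-1/3) instead, which introduces a denominator 20 and so singles out p = 5.
  s₃≈3u₆/10 : s₃ ≈ (+ 3 / 10) * u₆ mod 2
  s₃≈3u₆/10 = [ S₃≈3U₆/10-at-5 p-prime , generic ]′ (toSum (p ℕₚ.≟ 5))
    where
    r : ∀ s u w → (+ 1 / 20) * (fromℕ 5 * (fromℕ 4 * s - u - w) + (fromℕ 4 * u - - u - w)) ≡ s - (+ 3 / 10) * w
    r = solve-∀ ℚ-ring
    generic : p ≢ 5 → s₃ ≈ (+ 3 / 10) * u₆ mod 2
    generic p≢5 = diff (subst (2 ∣ᵖ_) (r s₃ u₃ u₆)
      (∣ᵖ-*ˡ (/-integral 1ℤ 20 (∤-* 4 5 p∤4 (∤5 p≢5))) (∣ᵖ-+ (∣ᵖ-*ˡ (fromℕ-integral 5) 4s₃≈u₃+u₆) 5u₃≈u₆)))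

  -- With 3ⁿ ≡ 1/9, `eulerPoly-1/6` becomes 2 Eₙ(1/6) ≡ 10 Eₙ(1/2), where 10 = 9(1 + 1/9). The
  -- congruence with S then gives S(-1/6) ≡ 5 S(-1/2), to be divided by 5.
  s₂≈s₆/5 : s₂ ≈ (+ 1 / 5) * s₆ mod 2
  s₂≈s₆/5 = [ S₂≈S₆/5-at-5 p-prime , generic ]′ (toSum (p ℕₚ.≟ 5))
    where
    e₂ = eulerPoly n₂ ½
    e₆ = eulerPoly n₂ (+ 1 / 6)
    Ie₂ : Integral e₂
    Ie₂ = Polynomial-integral (eulerPoly-polynomial n₂) I₂
    Ie₆ : Integral e₆
    Ie₆ = Polynomial-integral (eulerPoly-polynomial n₂) I₆
    2e₆≈10e₂ : 2 ∣ᵖ (fromℕ 2 * e₆ - fromℕ 10 * e₂)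
    2e₆≈10e₂ = subst (2 ∣ᵖ_) eq (∣ᵖ-*ˡ (minus-integral Ie₂ (*-integral (fromℕ-integral 2) Ie₆)) (∣-diff (unit-power₂ 3 p∤3)))
      where
      c = fromℕ 3 ^ n₂
      r₁ : ∀ c x y → (y - fromℕ 2 * x) * (fromℕ 3 * (fromℕ 3 * c) - 1ℚ) ≡ fromℕ 9 * (c * y) - y + fromℕ 2 * x - fromℕ 9 * (c * (fromℕ 2 * x))
      r₁ = solve-∀ ℚ-ring
      r₂ : ∀ c x y → fromℕ 9 * (c * y) - y + fromℕ 2 * x - fromℕ 9 * ((1ℚ + c) * y) ≡ fromℕ 2 * x - fromℕ 10 * y
      r₂ = solve-∀ ℚ-ring
      eq : (e₂ - fromℕ 2 * e₆) * (fromℕ 3 ^ (2 ℕ.+ n₂) - 1ℚ) ≡ fromℕ 2 * e₆ - fromℕ 10 * e₂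
      eq = trans (r₁ c e₆ e₂) (trans (cong (λ u → fromℕ 9 * (c * e₂) - e₂ + fromℕ 2 * e₆ - fromℕ 9 * u) (eulerPoly-1/6 n₂ even₂)) (r₂ c e₆ e₂))
    r : ∀ s s′ x y → (s - - x) + - ((+ 1 / 5) * (s′ - - y)) + (+ 1 / 10) * (fromℕ 2 * y - fromℕ 10 * x) ≡ s - (+ 1 / 5) * s′
    r = solve-∀ ℚ-ring
    generic : p ≢ 5 → s₂ ≈ (+ 1 / 5) * s₆ mod 2
    generic p≢5 = diff (subst (2 ∣ᵖ_) (r s₂ s₆ e₂ e₆)
      (∣ᵖ-+ (∣ᵖ-+ (∣-diff (E₂.S≈-E (- (+ 1 / 2)) I₂)) (∣ᵖ-neg (∣ᵖ-*ˡ (/-integral 1ℤ 5 (∤5 p≢5)) (∣-diff (E₂.S≈-E (- (+ 1 / 6)) I₆)))))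
        (∣ᵖ-*ˡ (/-integral 1ℤ 10 (∤-* 2 5 p∤2 (∤5 p≢5))) 2e₆≈10e₂)))

  -- From 2ⁿ⁺² ≡ 1 it follows that 2⁻ⁿ ≡ 4; this is the 4 in -4Eₙ, since Eₙ(1/2) = Eₙ/2ⁿ.
  half-power : ∀ {j} n x → Integral x → fromℕ 2 ^ (2 ℕ.+ n) ≈ 1ℚ mod j → ½ ^ n * x ≈ fromℕ 4 * x mod j
  half-power {j} n x Ix 2^ = diff (subst (j ∣ᵖ_) eq (∣ᵖ-neg (∣ᵖ-*ˡ (*-integral (^-integral n I½) Ix) (∣-diff 2^))))
    where
    r : ∀ h c x → - (h * x * (fromℕ 2 * (fromℕ 2 * c) - 1ℚ)) ≡ h * x - (h * c) * (fromℕ 4 * x)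
    r = solve-∀ ℚ-ring
    eq : - (½ ^ n * x * (fromℕ 2 ^ (2 ℕ.+ n) - 1ℚ)) ≡ ½ ^ n * x - fromℕ 4 * x
    eq = trans (r (½ ^ n) (fromℕ 2 ^ n) x) (cong (λ u → ½ ^ n * x - u)
      (trans (cong (_* (fromℕ 4 * x)) (trans (sym (^-distrib-* ½ (fromℕ 2) n)) (1^n≡1 n))) (ℚₚ.*-identityˡ (fromℕ 4 * x))))

  half-value : ∀ {j} n → fromℕ 2 ^ (2 ℕ.+ n) ≈ 1ℚ mod j → s₂ ≈ - eulerPoly n ½ mod j → s₂ ≈ - (fromℕ 4 * eulerℚ n) mod j
  half-value n 2^ s₂≈ = ≈-trans s₂≈ (≈-neg (≈-trans (≈-reflexive (eulerPoly-½ n)) (half-power n (eulerℚ n) (fromℤ-integral (euler n)) 2^)))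

  s₂≈-4E₂ : s₂ ≈ - (fromℕ 4 * eulerℚ n₂) mod 2
  s₂≈-4E₂ = half-value n₂ (unit-power₂ 2 p∤2) (E₂.S≈-E (- (+ 1 / 2)) I₂)

  s₂≈-4E₁ : s₂ ≈ - (fromℕ 4 * eulerℚ n₁) mod 1
  s₂≈-4E₁ = half-value n₁ (unit-power₁ 2 p∤2) (E₁.S≈-E (- (+ 1 / 2)) I₂)

  -- Since k ≡ 3 is a unit, (n + 1) Eₙ(1/3) = − k Bₙ₊₁(1/3) shows that Bₙ₊₁(1/3) lies in ℤ₍ₚ₎,
  -- although individual Bernoulli numbers need not.
  module Third {j} (n : ℕ) (0<j : 0 ℕ.< j) (even : -1ℚ ^ n ≡ 1ℚ) (2^ : fromℕ 2 ^ (2 ℕ.+ n) ≈ 1ℚ mod j) where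

    b e k : ℚ
    b = bernoulliPoly (suc n) (+ 1 / 3)
    e = eulerPoly n (+ 1 / 3)
    k = fromℕ 2 * (fromℕ 2 ^ suc n + 1ℚ)

    -- The natural number 2ⁿ⁺² + 2 that represents `k`, so that its reciprocal and divisibility by p
    -- can be formed.
    K : ℕ
    K = 2 ℕ.^ (2 ℕ.+ n) ℕ.+ 2

    K≡k : fromℕ K ≡ k
    K≡k = trans (fromℕ-+ (2 ℕ.^ (2 ℕ.+ n)) 2) (trans (cong (_+ fromℕ 2) (fromℕ-^ 2 (2 ℕ.+ n))) (r (fromℕ 2 ^ suc n)))
      where
      r : ∀ c → fromℕ 2 * c + fromℕ 2 ≡ fromℕ 2 * (c + 1ℚ)
      r = solve-∀ ℚ-ring

    k≈3 : k ≈ fromℕ 3 mod j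
    k≈3 = ≈-trans (≈-reflexive (r (fromℕ 2 ^ suc n))) (≈-+ 2^ (≈-refl {x = fromℕ 2}))
      where
      r : ∀ c → fromℕ 2 * (c + 1ℚ) ≡ fromℕ 2 * c + fromℕ 2
      r = solve-∀ ℚ-ring

    p∤K : p ∤ K
    p∤K p∣K = p∤3 (∣ᵖ⇒∣ 3 (≈-resp-∣ᵖ (≈-weaken 0<j (≈-sym k≈3)) (subst (1 ∣ᵖ_) K≡k (∣⇒∣ᵖ p∣K))))

    e-integral : Integral e
    e-integral = Polynomial-integral (eulerPoly-polynomial n) I₃

    kb≡ : k * b ≡ - (fromℕ (suc n) * e)
    kb≡ = trans (r (k * b)) (cong (-_) (sym (eulerPoly-1/3 n even)))
      where
      r : ∀ x → x ≡ - - x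
      r = solve-∀ ℚ-ring

    b-integral : Integral b
    b-integral = subst Integral eq (*-integral (/-integral 1ℤ K {{K≢0}} p∤K) (neg-integral (*-integral (fromℕ-integral (suc n)) e-integral)))
      where
      K≢0 : NonZero K
      K≢0 = ℕ.>-nonZero (ℕₚ.≤-trans (s≤s z≤n) (ℕₚ.m≤n+m 2 (2 ℕ.^ (2 ℕ.+ n))))
      eq : (1ℤ / K) {{K≢0}} * - (fromℕ (suc n) * e) ≡ b
      eq = begin
        (1ℤ / K) {{K≢0}} * - (fromℕ (suc n) * e)    ≡⟨ cong ((1ℤ / K) {{K≢0}} *_) kb≡ ⟨
        (1ℤ / K) {{K≢0}} * (k * b)                  ≡⟨ ℚₚ.*-assoc ((1ℤ / K) {{K≢0}}) k b ⟨
        (1ℤ / K) {{K≢0}} * k * b                    ≡⟨ cong (λ u → (1ℤ / K) {{K≢0}} * u * b) K≡k ⟨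
        (1ℤ / K) {{K≢0}} * fromℕ K * b              ≡⟨ cong (_* b) (/-*-cancel 1ℤ K {{K≢0}}) ⟩
        1ℚ * b                                      ≡⟨ ℚₚ.*-identityˡ b ⟩
        b                                           ∎

    3b≈ : fromℕ 3 * b ≈ - (fromℕ (suc n) * e) mod j
    3b≈ = ≈-trans (≈-* b-integral (≈-integral (fromℕ-integral 3) k≈3) (≈-sym k≈3) ≈-refl) (≈-reflexive kb≡)

  p²-p-1≡ : p ℕ.^ 2 ∸ p ∸ 1 ≡ suc n₂
  p²-p-1≡ = cong (_∸ 1) p²∸p≡2+n₂

  p-2≡ : p ∸ 2 ≡ suc n₁
  p-2≡ = ℕₚ.+-∸-assoc 1 (ℕₚ.<⇒≤ 3<p)

  B₁ B₂ : ℚ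
  B₁ = bernoulliPoly (p ∸ 2) (+ 1 / 3)
  B₂ = bernoulliPoly (p ℕ.^ 2 ∸ p ∸ 1) (+ 1 / 3)

  module T₁ = Third n₁ (s≤s z≤n) even₁ (unit-power₁ 2 p∤2)
  module T₂ = Third n₂ (s≤s z≤n) even₂ (unit-power₂ 2 p∤2)

  -- Here n + 1 = p - 2 ≡ -2, so 3B ≡ -(n + 1)E reads 3B ≡ 2E, with B = Bₙ₊₁(1/3) and E = Eₙ(1/3).
  s₃≈B₁ : s₃ ≈ - ((+ 3 / 2) * B₁) mod 1
  s₃≈B₁ = subst (λ m → s₃ ≈ - ((+ 3 / 2) * bernoulliPoly m (+ 1 / 3)) mod 1) (sym p-2≡)
    (≈-trans (E₁.S≈-E (- (+ 1 / 3)) I₃) (diff (subst (1 ∣ᵖ_) eq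
      (∣ᵖ-*ˡ I½ (∣ᵖ-+ (∣-diff T₁.3b≈) (∣ᵖ-neg (∣ᵖ-*ʳ p∣ᵖ T₁.e-integral)))))))
    where
    p≡ : fromℕ p ≡ fromℕ (suc n₁) + fromℕ 2
    p≡ = trans (cong fromℕ (trans (sym (ℕₚ.m+[n∸m]≡n (ℕₚ.<⇒≤ 3<p))) (ℕₚ.+-comm 2 (suc n₁)))) (fromℕ-+ (suc n₁) 2)
    r : ∀ b e N → ½ * ((fromℕ 3 * b - - (N * e)) + - ((N + fromℕ 2) * e)) ≡ - e - - ((+ 3 / 2) * b)
    r = solve-∀ ℚ-ring
    eq : ½ * ((fromℕ 3 * T₁.b - - (fromℕ (suc n₁) * T₁.e)) + - (fromℕ p * T₁.e)) ≡ - T₁.e - - ((+ 3 / 2) * T₁.b)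
    eq = trans (cong (λ P → ½ * ((fromℕ 3 * T₁.b - - (fromℕ (suc n₁) * T₁.e)) + - (P * T₁.e))) p≡) (r T₁.b T₁.e (fromℕ (suc n₁)))

  -- Now n + 1 = p² - p - 1 ≡ -(1 + p), so 3B ≡ (1 + p)E. Multiplying by 1 - p, the inverse of 1 + p
  -- modulo p², gives -E ≡ (3p - 3)B.
  s₃≈B₂ : s₃ ≈ (fromℕ 3 * fromℕ p - fromℕ 3) * B₂ mod 2
  s₃≈B₂ = subst (λ m → s₃ ≈ (fromℕ 3 * fromℕ p - fromℕ 3) * bernoulliPoly m (+ 1 / 3) mod 2) (sym p²-p-1≡)
    (≈-trans (E₂.S≈-E (- (+ 1 / 3)) I₃) (diff (subst (2 ∣ᵖ_) eq
      (∣ᵖ-+ (∣ᵖ-*ˡ (minus-integral (fromℕ-integral 1) Ip) (∣-diff T₂.3b≈))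
            (∣ᵖ-*ʳ p²∣ (*-integral (minus-integral Ip (fromℕ-integral 2)) T₂.e-integral))))))
    where
    Ip = fromℕ-integral p
    N = fromℕ (suc n₂)
    p²∣ : 2 ∣ᵖ (fromℕ p * fromℕ p)
    p²∣ = ∣ᵖ-* p∣ᵖ p∣ᵖ
    p²≡ : fromℕ p * fromℕ p ≡ fromℕ p + (N + 1ℚ)
    p²≡ = begin
      fromℕ p * fromℕ p                   ≡⟨ fromℕ-* p p ⟨
      fromℕ (p ℕ.* p)                     ≡⟨ cong (λ m → fromℕ (p ℕ.* m)) (ℕₚ.*-identityʳ p) ⟨
      fromℕ (p ℕ.* (p ℕ.* 1))             ≡⟨ cong fromℕ p+[2+n₂]≡p² ⟨
      fromℕ (p ℕ.+ suc (suc n₂))          ≡⟨ trans (fromℕ-+ p (suc (suc n₂))) (cong (_+_ (fromℕ p)) (fromℕ-suc (suc n₂))) ⟩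
      fromℕ p + (N + 1ℚ)                  ∎
    N≡ : N ≡ fromℕ p * fromℕ p - fromℕ p - 1ℚ
    N≡ = trans (r N (fromℕ p)) (cong (λ u → u - fromℕ p - 1ℚ) (sym p²≡))
      where
      r : ∀ n p → n ≡ (p + (n + 1ℚ)) - p - 1ℚ
      r = solve-∀ ℚ-ring
    r : ∀ b e p → (1ℚ - p) * (fromℕ 3 * b - - ((p * p - p - 1ℚ) * e)) + p * p * ((p - fromℕ 2) * e) ≡
        - e - (fromℕ 3 * p - fromℕ 3) * b
    r = solve-∀ ℚ-ring
    eq : (1ℚ - fromℕ p) * (fromℕ 3 * T₂.b - - (N * T₂.e)) + fromℕ p * fromℕ p * ((fromℕ p - fromℕ 2) * T₂.e) ≡
         - T₂.e - (fromℕ 3 * fromℕ p - fromℕ 3) * T₂.b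
    eq = trans (cong (λ u → (1ℚ - fromℕ p) * (fromℕ 3 * T₂.b - - (u * T₂.e)) + fromℕ p * fromℕ p * ((fromℕ p - fromℕ 2) * T₂.e)) N≡)
               (r T₂.b T₂.e (fromℕ p))

  congruence : ∀ {j x y a c} → a ≡ x → c ≡ y → Integral y → x ≈ y mod j → a ≡ c [mod p ^ j ]
  congruence refl refl = ≈⇒≡mod

  Is₂ : Integral s₂
  Is₂ = S-integral I₂

  Is₃ : Integral s₃
  Is₃ = S-integral I₃

-- The sums with denominators 2k + 1 as multiples of U

module Terms (p : ℕ) where

  A₄ A₃ A₆ : ℚ
  A₃ = ∑[ k < p ] + a₃ k ÷ suc (2 ℕ.* k) · 27 ^ k * H⁽²⁾ k
  A₄ = ∑[ k < p ] + a₄ k ÷ suc (2 ℕ.* k) · 64 ^ k * H⁽²⁾ k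
  A₆ = ∑[ k < p ] + a₆ k ÷ suc (2 ℕ.* k) · 432 ^ k * H⁽²⁾ k

  -- U is 2x + 1 times the sum, so the coefficients of the theorem split as 1/4 = 1/2 · 1/2, 1/2 =
  -- 3/2 · 1/3 and 1/5 = 3/10 · 2/3.
  A₄/4≡ : (+ 1 / 4) * A₄ ≡ ½ * U p (- (+ 1 / 4))
  A₄/4≡ = trans (r A₄) (cong (½ *_) (U₄ p))
    where
    r : ∀ x → (+ 1 / 4) * x ≡ ½ * ((+ 1 / 2) * x)
    r = solve-∀ ℚ-ring

  A₃/2≡ : (+ 1 / 2) * A₃ ≡ (+ 3 / 2) * U p (- (+ 1 / 3))
  A₃/2≡ = trans (r A₃) (cong ((+ 3 / 2) *_) (U₃ p))
    where
    r : ∀ x → (+ 1 / 2) * x ≡ (+ 3 / 2) * ((+ 1 / 3) * x)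
    r = solve-∀ ℚ-ring

  A₆/5≡ : (+ 1 / 5) * A₆ ≡ (+ 3 / 10) * U p (- (+ 1 / 6))
  A₆/5≡ = trans (r A₆) (cong ((+ 3 / 10) *_) (U₆ p))
    where
    r : ∀ x → (+ 1 / 5) * x ≡ (+ 3 / 10) * ((+ 2 / 3) * x)
    r = solve-∀ ℚ-ring

corollary1p2 : (p : ℕ) → Prime p → 3 ℕ.< p →
    -- (a)
    ( ((∑[ k < p ] + ((4 ℕ.* k C 2 ℕ.* k) ℕ.* (2 ℕ.* k C k)) ÷ 64 ^ k * H⁽²⁾ k)
        ≡ - eulerPoly (p ℕ.^ 2 ∸ p ∸ 2) (+ 1 / 4) [mod p ^ 2 ])
    × ((∑[ k < p ] + ((4 ℕ.* k C 2 ℕ.* k) ℕ.* (2 ℕ.* k C k)) ÷ 64 ^ k * H⁽²⁾ k)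
        ≡ - eulerPoly (p ∸ 3) (+ 1 / 4) [mod p ^ 1 ]) )
    -- (b)
  × ( ((∑[ k < p ] + ((2 ℕ.* k C k) ℕ.^ 2) ÷ 16 ^ k * H⁽²⁾ k)
        ≡ (+ 1 / 4) * (∑[ k < p ] + ((4 ℕ.* k C 2 ℕ.* k) ℕ.* (2 ℕ.* k C k)) ÷ suc (2 ℕ.* k) · 64 ^ k * H⁽²⁾ k) [mod p ^ 2 ])
    × ((+ 1 / 4) * (∑[ k < p ] + ((4 ℕ.* k C 2 ℕ.* k) ℕ.* (2 ℕ.* k C k)) ÷ suc (2 ℕ.* k) · 64 ^ k * H⁽²⁾ k)
        ≡ (+ 1 / 5) * (∑[ k < p ] + ((6 ℕ.* k C 3 ℕ.* k) ℕ.* (3 ℕ.* k C k)) ÷ 432 ^ k * H⁽²⁾ k) [mod p ^ 2 ])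
    × ((+ 1 / 5) * (∑[ k < p ] + ((6 ℕ.* k C 3 ℕ.* k) ℕ.* (3 ℕ.* k C k)) ÷ 432 ^ k * H⁽²⁾ k)
        ≡ - (fromℕ 4 * fromℤ (euler (p ℕ.^ 2 ∸ p ∸ 2))) [mod p ^ 2 ])
    × ((∑[ k < p ] + ((2 ℕ.* k C k) ℕ.^ 2) ÷ 16 ^ k * H⁽²⁾ k)
        ≡ - (fromℕ 4 * fromℤ (euler (p ∸ 3))) [mod p ^ 1 ]) )
    -- (c)
  × ( ((∑[ k < p ] + ((2 ℕ.* k C k) ℕ.* (3 ℕ.* k C k)) ÷ 27 ^ k * H⁽²⁾ k)
        ≡ (+ 1 / 2) * (∑[ k < p ] + ((2 ℕ.* k C k) ℕ.* (3 ℕ.* k C k)) ÷ suc (2 ℕ.* k) · 27 ^ k * H⁽²⁾ k) [mod p ^ 2 ])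
    × ((+ 1 / 2) * (∑[ k < p ] + ((2 ℕ.* k C k) ℕ.* (3 ℕ.* k C k)) ÷ suc (2 ℕ.* k) · 27 ^ k * H⁽²⁾ k)
        ≡ (+ 1 / 5) * (∑[ k < p ] + ((6 ℕ.* k C 3 ℕ.* k) ℕ.* (3 ℕ.* k C k)) ÷ suc (2 ℕ.* k) · 432 ^ k * H⁽²⁾ k) [mod p ^ 2 ])
    × ((+ 1 / 5) * (∑[ k < p ] + ((6 ℕ.* k C 3 ℕ.* k) ℕ.* (3 ℕ.* k C k)) ÷ suc (2 ℕ.* k) · 432 ^ k * H⁽²⁾ k)
        ≡ (fromℕ 3 * fromℕ p - fromℕ 3) * bernoulliPoly (p ℕ.^ 2 ∸ p ∸ 1) (+ 1 / 3) [mod p ^ 2 ])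
    × ((∑[ k < p ] + ((2 ℕ.* k C k) ℕ.* (3 ℕ.* k C k)) ÷ 27 ^ k * H⁽²⁾ k)
        ≡ - ((+ 3 / 2) * bernoulliPoly (p ∸ 2) (+ 1 / 3)) [mod p ^ 1 ]) )
corollary1p2 p p-prime 3<p =
  ( congruence (S₄ p) refl (neg-integral (Polynomial-integral (eulerPoly-polynomial n₂) I₄)) (E₂.S≈-E (- (+ 1 / 4)) I₄)
  , congruence (S₄ p) refl (neg-integral (Polynomial-integral (eulerPoly-polynomial n₁) I₄)) (E₁.S≈-E (- (+ 1 / 4)) I₄) )
  -- S(-1/2) is integral because S has integral coefficients, and the congruence passes this on to
  -- the right side. The same is done below with S(-1/3).
  , ( congruence (S₂ p) A₄/4≡ (≈-integral Is₂ (≈-sym s₂≈u₄/2)) s₂≈u₄/2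
    , congruence A₄/4≡ (cong ((+ 1 / 5) *_) (S₆ p)) (≈-integral Is₂ (≈-sym s₂≈s₆/5)) (≈-trans (≈-sym s₂≈u₄/2) s₂≈s₆/5)
    , congruence (cong ((+ 1 / 5) *_) (S₆ p)) refl (4E-integral n₂) (≈-trans (≈-sym s₂≈s₆/5) s₂≈-4E₂)
    , congruence (S₂ p) refl (4E-integral n₁) s₂≈-4E₁ )
  , ( congruence (S₃ p) A₃/2≡ (≈-integral Is₃ (≈-sym s₃≈3u₃/2)) s₃≈3u₃/2
    , congruence A₃/2≡ A₆/5≡ (≈-integral Is₃ (≈-sym s₃≈3u₆/10)) (≈-trans (≈-sym s₃≈3u₃/2) s₃≈3u₆/10)
    , congruence A₆/5≡ refl (≈-integral Is₃ (≈-sym s₃≈B₂)) (≈-trans (≈-sym s₃≈3u₆/10) s₃≈B₂)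
    , congruence (S₃ p) refl (≈-integral Is₃ (≈-sym s₃≈B₁)) s₃≈B₁ )
  where
  open Sums p p-prime 3<p
  open Proof p p-prime 3<p
  open Values p p-prime 3<p
  open Terms p
  4E-integral : ∀ n → Integral (- (fromℕ 4 * fromℤ (euler n)))
  4E-integral n = neg-integral (*-integral (fromℕ-integral 4) (fromℤ-integral (euler n)))
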